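{- Let $\mathbf{T}=(G,\mathcal{G},\mathcal{M},\mathcal{X},\simeq)$ be a decisive matroid tableau. Then $G$ is a gammoid if and only if there is a matroid $M\in\mathcal{G}$ such that $G\simeq M$.
   Context: Matroids are pairs $M=(E,\mathcal{I})$ with $E$ a finite ground set and $\mathcal{I}$ the system of independent sets; $\mathrm{rk}_M$ is the rank function. A matroid $N=(E',\mathcal{I}')$ is an extension of $M=(E,\mathcal{I})$ if $E\subseteq E'$ and $\mathcal{I}=\{X\in\mathcal{I}'\mid X\subseteq E\}$. A digraph is a pair $D=(V,A)$ with $V$ finite and $A\subseteq V\times V$. A path in $D$ is a non-empty, non-repeating sequence of vertices $p_1p_2\ldots p_n$ with $(p_i,p_{i+1})\in A$ for $1\le i<n$. A routing from $X$ to $Y$ in $D$ is a family $R$ of paths in $D$ such that every $x\in X$ is the first vertex of some $p\in R$, every $p\in R$ ends in a vertex of $Y$, and any two distinct paths of $R$ are vertex-disjoint. For $E,T\subseteq V$, $\Gamma(D,T,E)$ is the matroid on $E$ whose independent sets are those $X\subseteq E$ for which there is a routing from $X$ to $T$ in $D$. A matroid $(E,\mathcal{I})$ is a gammoid if it equals $\Gamma(D,T,E)$ for some digraph $D=(V,A)$ with $E\subseteq V$ and some $T\subseteq V$; it is a strict gammoid if such a representation exists with $V=E$. A matroid tableau is a tuple $\mathbf{T}=(G,\mathcal{G},\mathcal{M},\mathcal{X},\simeq)$ where $G$ is a matroid (the goal), $\mathcal{G},\mathcal{M},\mathcal{X}$ are families of matroids, and $\simeq$ is an equivalence relation on $\{G'\mid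 G'\text{ is a minor of }G\}\cup\mathcal{G}\cup\mathcal{M}\cup\mathcal{X}$. $\mathbf{T}$ is valid if (i) all matroids in $\mathcal{G}$ are gammoids, (ii) no matroid in $\mathcal{M}$ is a strict gammoid, (iii) no matroid in $\mathcal{X}$ is a gammoid, and (iv) every equivalence class of $\simeq$ either consists only of gammoids or contains no gammoid. $\mathbf{T}$, with goal $G=(E,\mathcal{I})$, is decisive if it is valid and at least one of the following holds: (i) there is $M\in\mathcal{G}$ with $G\simeq M$; (ii) there is $X\in\mathcal{X}$ that is isomorphic to a minor of $G$; (iii) for every extension $N=(E',\mathcal{I}')$ of $G$ with $|E'|=\mathrm{rk}_G(E)^2\cdot|E|+\mathrm{rk}_G(E)+|E|$ there is a matroid $M\in\mathcal{M}$ that is isomorphic to $N$. -}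

module Defs where

open import Data.List using (List; []; _∷_; _++_; [_]; map; filter; length; deduplicate)
open import Data.List.Extrema.Nat using (max)
open import Data.List.NonEmpty as List⁺ using (List⁺)
open import Data.List.Membership.Propositional using (_∈_; _∉_)
import Data.List.Membership.DecPropositional as DecMembership
open import Data.List.Relation.Unary.All using (All)
open import Data.List.Relation.Unary.Linked using (Linked)
open import Data.List.Relation.Unary.Unique.Propositional using (Unique)
open import Data.List.Relation.Binary.BagAndSetEquality using (_∼[_]_; set)
open import Data.List.Relation.Binary.Disjoint.Propositional using (Disjoint)
open import Data.List.Relation.Binary.Subset.Propositional using (_⊆_)
open import Data.Nat using (ℕ; _+_; _*_; _^_; _<_)
open import Data.Product using (∃; ∃-syntax; _×_; _,_; proj₁)
open import Data.Sum using (_⊎_)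
open import Function using (_on_; _⇔_)
open import Level using (Level; 0ℓ; suc; _⊔_)
open import Relation.Binary.Core using (Rel)
open import Relation.Binary.Definitions using (DecidableEquality)
open import Relation.Binary.PropositionalEquality using (_≡_; _≢_)
open import Relation.Binary.Structures using (IsEquivalence)
open import Relation.Nullary using (¬_)
open import Relation.Unary using (Pred; Decidable)

-- No finite list exhausts U, so finite sets of elements of U can always be
-- enlarged by further elements.
Infinite : Set → Set
Infinite U = (xs : List U) → ∃[ x ] x ∉ xs

-- U is the universe from which all ground sets and all vertex sets are drawn.
-- A finite subset of U is given by a list of its members; order and repetitions
-- carry no meaning, and equality of finite sets is  _∼[ set ]_ .
module Matroids (U : Set) (_≟_ : DecidableEquality U) where

  open DecMembership _≟_ using (_∉?_)

  ∣_∣ : List U → ℕ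
  ∣ X ∣ = length (deduplicate _≟_ X)

  infixl 6 _∖_
  _∖_ : List U → List U → List U
  X ∖ Y = filter (_∉? Y) X

  powerset : List U → List (List U)
  powerset []       = [ [] ]
  powerset (x ∷ xs) = powerset xs ++ map (x ∷_) (powerset xs)

  record SetSystem : Set₁ where
    field
      ground : List U
      Indep  : Pred (List U) 0ℓ

  open SetSystem public

  infix 4 _≋_
  _≋_ : Rel SetSystem 0ℓ
  S ≋ S′ = (ground S ∼[ set ] ground S′) × (∀ X → Indep S X ⇔ Indep S′ X)

  -- `hereditary` also makes `Indep` depend only on the set of members of a list.
  -- `indep?` reflects that the independent sets form a finite system of finite sets.
  record IsMatroid (S : SetSystem) : Set where
    field
      indep⊆ground : ∀ {X} → Indep S X → X ⊆ ground S
      indep?       : Decidable (Indep S)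
      ∅-indep      : Indep S []
      hereditary   : ∀ {X Y} → X ⊆ Y → Indep S Y → Indep S X
      augmentation : ∀ {X Y} → Indep S X → Indep S Y → ∣ X ∣ < ∣ Y ∣ →
                     ∃[ y ] y ∈ Y × y ∉ X × Indep S (y ∷ X)

  record Matroid : Set₁ where
    field
      system    : SetSystem
      isMatroid : IsMatroid system

    open IsMatroid isMatroid public

  open Matroid public using (system; isMatroid; indep?)

  E : Matroid → List U
  E M = ground (system M)

  rk : Matroid → List U → ℕ
  rk M X = max 0 (map ∣_∣ (filter (indep? M) (powerset X)))

  _IsExtensionOf_ : Rel Matroid 0ℓ
  N IsExtensionOf M =
    E M ⊆ E N × (∀ X → Indep (system M) X ⇔ (Indep (system N) X × X ⊆ E M))

  IsBasisOf : SetSystem → List U → List U → Set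
  IsBasisOf S B C =
    B ⊆ C × Indep S B × (∀ {x} → x ∈ C → Indep S (x ∷ B) → x ∈ B)

  delete : SetSystem → List U → SetSystem
  delete S D .ground  = ground S ∖ D
  delete S D .Indep X = Indep S X × X ⊆ ground S ∖ D

  contract : SetSystem → List U → SetSystem
  contract S C .ground  = ground S ∖ C
  contract S C .Indep X =
    X ⊆ ground S ∖ C × (∃[ B ] IsBasisOf S B C × Indep S (X ++ B))

  _IsMinorOf_ : Rel Matroid 0ℓ
  N IsMinorOf M =
    ∃[ C ] ∃[ D ] C ⊆ E M × D ⊆ E M × Disjoint C D ×
      system N ≋ delete (contract (system M) C) D

  -- A bijection E M → E N is given by a function on the whole of U, of which only
  -- the values on E M matter.
  record _≅_ (M N : Matroid) : Set where
    field
      to         : U → U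
      to-ground  : ∀ {x} → x ∈ E M → to x ∈ E N
      injective  : ∀ {x y} → x ∈ E M → y ∈ E M → to x ≡ to y → x ≡ y
      surjective : ∀ {y} → y ∈ E N → ∃[ x ] x ∈ E M × to x ≡ y
      to-indep   : ∀ {X} → X ⊆ E M →
                   Indep (system M) X ⇔ Indep (system N) (map to X)

  record Digraph : Set where
    field
      V     : List U
      A     : List (U × U)
      A⊆V×V : ∀ {u v} → (u , v) ∈ A → u ∈ V × v ∈ V

  open Digraph public using (V; A)

  record IsPath (D : Digraph) (p : List⁺ U) : Set where
    field
      vertices : All (_∈ V D) (List⁺.toList p)
      arcs     : Linked (λ u v → (u , v) ∈ A D) (List⁺.toList p)
      unique   : Unique (List⁺.toList p)

  record IsRouting (D : Digraph) (X Y : List U) (R : List (List⁺ U)) : Set where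
    field
      paths    : ∀ {p} → p ∈ R → IsPath D p
      starts   : ∀ {x} → x ∈ X → ∃[ p ] p ∈ R × List⁺.head p ≡ x
      ends     : ∀ {p} → p ∈ R → List⁺.last p ∈ Y
      disjoint : ∀ {p q} → p ∈ R → q ∈ R → p ≢ q →
                 Disjoint (List⁺.toList p) (List⁺.toList q)

  -- Γ(D,T,F), as a pair of ground set and independence predicate.
  Γ : Digraph → List U → List U → SetSystem
  Γ D T F .ground  = F
  Γ D T F .Indep X = X ⊆ F × ∃ (IsRouting D X T)

  IsGammoid : Pred Matroid 0ℓ
  IsGammoid M =
    ∃[ D ] ∃[ T ] E M ⊆ V D × T ⊆ V D × system M ≋ Γ D T (E M)

  IsStrictGammoid : Pred Matroid 0ℓ
  IsStrictGammoid M =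
    ∃[ D ] ∃[ T ] (V D ∼[ set ] E M) × T ⊆ V D × system M ≋ Γ D T (E M)

  -- The families are predicates, and _≃_ is a relation on all matroids of which only
  -- the values on `Carrier` matter. `≃-reflexive` says that _≃_ does not distinguish
  -- matroids which are equal as pairs of ground set and independent sets.
  record Tableau (ℓ : Level) : Set (suc ℓ ⊔ suc 0ℓ) where
    infix 4 _≃_
    field
      G     : Matroid
      𝒢 ℳ 𝒳 : Pred Matroid ℓ
      _≃_   : Rel Matroid ℓ

    Carrier : Pred Matroid ℓ
    Carrier M = M IsMinorOf G ⊎ 𝒢 M ⊎ ℳ M ⊎ 𝒳 M

    field
      ≃-isEquivalence : IsEquivalence {A = ∃ Carrier} (_≃_ on proj₁)
      ≃-reflexive     : ∀ {M N} → Carrier M → Carrier N →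
                        system M ≋ system N → M ≃ N

  record Valid {ℓ} (𝐓 : Tableau ℓ) : Set (ℓ ⊔ suc 0ℓ) where
    open Tableau 𝐓
    field
      𝒢-gammoids          : ∀ M → 𝒢 M → IsGammoid M
      ℳ-no-strict-gammoid : ∀ M → ℳ M → ¬ IsStrictGammoid M
      𝒳-no-gammoid        : ∀ M → 𝒳 M → ¬ IsGammoid M
      -- the class in question is that of M
      classes             : ∀ M → Carrier M →
                            (∀ N → Carrier N → M ≃ N → IsGammoid N) ⊎
                            (∀ N → Carrier N → M ≃ N → ¬ IsGammoid N)

  record Decisive {ℓ} (𝐓 : Tableau ℓ) : Set (ℓ ⊔ suc 0ℓ) where
    open Tableau 𝐓

    field
      valid : Valid 𝐓
      cases : (∃[ M ] 𝒢 M × G ≃ M)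
            ⊎ (∃[ X ] 𝒳 X × (∃[ N ] N IsMinorOf G × X ≅ N))
            ⊎ (∀ N → N IsExtensionOf G →
                 ∣ E N ∣ ≡ rk G (E G) ^ 2 * ∣ E G ∣ + rk G (E G) + ∣ E G ∣ →
               ∃[ M ] ℳ M × M ≅ N)

{-# OPTIONS --safe #-}
module Submission where

open import Defs
open import Data.Empty using (⊥; ⊥-elim)
open import Data.Fin as Fin using (Fin; toℕ)
open import Data.Fin.Properties using (toℕ-injective)
open import Data.Integer as ℤ using (ℤ; 0ℤ; 1ℤ)
import Data.Integer.Properties as ℤ
open import Data.List
  using ( List; []; _∷_; _++_; [_]; map; filter; length; deduplicate; lookup; upTo; applyUpTo; allFin
        ; cartesianProduct; cartesianProductWith; initLast; _∷ʳ′_)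
open import Data.List.Extrema.Nat using (xs≤max) renaming (argmax-sel to max-sel)
import Data.List.Membership.DecPropositional as DecMembership
open import Data.List.Membership.Propositional using (_∈_; _∉_; find; lose)
open import Data.List.Membership.Propositional.Properties
  using ( ∈-map⁺; ∈-map⁻; ∈-++⁺ˡ; ∈-++⁺ʳ; ∈-++⁻; ∈-∃++; ∈-filter⁺; ∈-filter⁻; ∈-deduplicate⁺; ∈-deduplicate⁻
        ; ∈-lookup; ∈-upTo⁺; ∈-applyUpTo⁻; ∈-allFin; ∈-cartesianProduct⁺; ∈-cartesianProduct⁻
        ; ∈-cartesianProductWith⁺)
open import Data.List.NonEmpty as List⁺ using (List⁺; _∷_)
open import Data.List.Properties as List
  using (length-++; length-map; ++-assoc; filter-notAll; length-upTo; length-applyUpTo; length-tabulate)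
open import Data.List.Relation.Binary.Disjoint.Propositional using (Disjoint)
open import Data.List.Relation.Binary.Permutation.Propositional as ↭
  using (_↭_; ↭-refl; ↭-sym; ↭-trans; ↭-reflexive; prep; ↭⇒↭ₛ)
open import Data.List.Relation.Binary.Permutation.Propositional.Properties using (∈-resp-↭; ↭-length; shift; ++⁺ˡ)
import Data.List.Relation.Binary.Permutation.Setoid.Properties as Permutation
open import Data.List.Relation.Binary.Subset.Propositional using (_⊆_)
open import Data.List.Relation.Binary.Subset.Propositional.Properties using (map⁺)
open import Data.List.Relation.Unary.All as All using (All; []; _∷_)
import Data.List.Relation.Unary.All.Properties as All
open import Data.List.Relation.Unary.AllPairs using ([]; _∷_)
open import Data.List.Relation.Unary.Any using (Any; here; there; any?)
open import Data.List.Relation.Unary.Linked using (Linked; []; [-]; _∷_)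
import Data.List.Relation.Unary.Linked.Properties as Linked
open import Data.List.Relation.Unary.Unique.DecPropositional.Properties using (deduplicate-!)
open import Data.List.Relation.Unary.Unique.Propositional using (Unique)
import Data.List.Relation.Unary.Unique.Propositional.Properties as Unique
open import Data.Maybe using (Maybe; just; nothing)
open import Data.Maybe.Properties using (≡-dec; just-injective)
open import Data.Nat as ℕ using (ℕ; zero; suc; _≤_; _<_; _≤?_; _<?_; z≤n; s≤s)
open import Data.Nat.ListAction using (sum)
open import Data.Nat.Properties as ℕ
  using ( ≤-refl; ≤-reflexive; ≤-trans; ≤-antisym; ≤-pred; n≤1+n; m≤m+n; m≤n+m; <⇒≱; ≰⇒>; ≮⇒≥; suc-injective
        ; +-suc; +-comm; +-assoc; +-cancelˡ-≡; +-cancelˡ-≤; +-cancelʳ-≤; +-cancelʳ-<; +-monoˡ-≤; +-monoʳ-≤; *-mono-≤)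
open import Data.Product using (Σ; ∃; ∃-syntax; _×_; _,_; proj₁; proj₂)
open import Data.Product.Properties using () renaming (≡-dec to ×-≡-dec)
open import Data.Sum using (_⊎_; inj₁; inj₂; [_,_]′)
open import Data.Unit using (⊤; tt)
open import Function using (_∘_; id; case_of_; _⇔_; mk⇔; Equivalence)
open import Relation.Binary.Definitions using (DecidableEquality)
open import Relation.Binary.PropositionalEquality
  using (_≡_; _≢_; refl; sym; trans; cong; cong₂; subst; subst₂; setoid; module ≡-Reasoning)
open import Relation.Binary.Structures using (IsEquivalence)
open import Relation.Nullary
  using (¬_; Dec; yes; no; contradiction; ¬?; _×-dec_; _⊎-dec_; _→-dec_; decidable-stable; map′)
open import Relation.Unary using (Decidable)

-- A set X is linked to T in D iff the vertices outside T can be matched injectively, each to itself or to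
-- an out-neighbour, avoiding X: the matching sends a vertex to its successor on its path. In these terms a
-- gammoid is given by a bipartite graph of rows and columns, contracting a basis deletes columns, and an
-- isomorphism renames columns; so gammoids are closed under minors and isomorphism.
--
-- It remains to extend a gammoid of rank r on e elements to a strict gammoid on r²e + r + e vertices.
-- One may assume that exactly r columns stay unmatched. Bypassing a vertex v outside the ground set
-- (deleting v and joining its in-neighbours to its out-neighbours) can only enlarge the matroid. If it does,
-- some set X that becomes independent is separated from T by a vertex cut C of size at most r containing v.
-- Let L be an integer matrix supported on the bipartite graph which is generic, in that every matchable
-- square submatrix is nonsingular. The cut yields a vector y with yL supported on the ground set, a kernel
-- vector z of L and a polynomial of degree < r vanishing on C \ {v}, whose product separates v from all
-- other vertices. These data range over spaces of dimension e, r and r, so at most r²e vertices v are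
-- essential in this sense, as in the cut-covering lemma of Kratsch and Wahlström, and the remaining ones
-- can be bypassed one at a time.

-- Origin of the summands of r²e + r + e: relative to a fixed matching `m₀` of all rows, r columns
-- are unmatched, at most e matched columns lie in the ground set, and each remaining column belongs
-- to a row that is essential or can be bypassed. The two factors r have different sources: the r
-- unmatched columns serve as coordinates on the kernel of L, and a cut of size at most r that
-- contains v leaves at most r - 1 roots, hence a space of polynomials of dimension r. Both counts
-- rely on exactly r columns being unmatched.
--
-- The vectors y and z record the two sides of a cut. At another vertex, y is evaluated at an
-- in-neighbour and z at an out-neighbour; if both values are nonzero, that vertex lies on the cut
-- and is a root of the polynomial. For v itself both are nonzero, and v is not a root.
--
-- Integers suffice for genericity, since only finitely many submatrices have to be nonsingular: the
-- rows are chosen one after another, each off finitely many hyperplanes. Elimination without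
-- division keeps all vectors integral, which is why inverses and coordinates carry a nonzero factor
-- `d`.

module Lists where

  private variable
    A B : Set

  InjectiveOn : {A B : Set} → List A → (A → B) → Set
  InjectiveOn xs f = ∀ {x y} → x ∈ xs → y ∈ xs → f x ≡ f y → x ≡ y

  ∉-∷ : ∀ {x : A} {xs} → Unique (x ∷ xs) → x ∉ xs
  ∉-∷ = Unique.Unique[x∷xs]⇒x∉xs

  ∷-unique : ∀ {x : A} {xs} → x ∉ xs → Unique xs → Unique (x ∷ xs)
  ∷-unique x∉xs u = All.tabulate (λ y∈xs x≡y → x∉xs (subst (_∈ _) (sym x≡y) y∈xs)) ∷ u

  unique-tail : ∀ {x : A} {xs} → Unique (x ∷ xs) → Unique xs
  unique-tail (_ ∷ u) = u

  unique-resp-↭ : ∀ {xs ys : List A} → xs ↭ ys → Unique xs → Unique ys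
  unique-resp-↭ p = Permutation.Unique-resp-↭ (setoid _) (↭⇒↭ₛ p)

  ∈⇒↭ : ∀ {x : A} {xs} → x ∈ xs → ∃[ ys ] xs ↭ x ∷ ys
  ∈⇒↭ x∈xs with ys , zs , refl ← ∈-∃++ x∈xs = ys ++ zs , shift _ ys zs

  ⊆-length : ∀ {xs ys : List A} → Unique xs → xs ⊆ ys → length xs ≤ length ys
  ⊆-length {xs = []} _ _ = z≤n
  ⊆-length {xs = x ∷ xs} {ys} u xs⊆ys with zs , p ← ∈⇒↭ (xs⊆ys (here refl)) =
    subst (suc (length xs) ≤_) (sym (↭-length p)) (s≤s (⊆-length (unique-tail u) xs⊆zs))
    where
    xs⊆zs : xs ⊆ zs
    xs⊆zs y∈xs with ∈-resp-↭ p (xs⊆ys (there y∈xs))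
    ... | here refl = contradiction y∈xs (∉-∷ u)
    ... | there y∈zs = y∈zs

  map-unique : ∀ {xs} {f : A → B} → InjectiveOn xs f → Unique xs → Unique (map f xs)
  map-unique {xs = []} _ _ = []
  map-unique {xs = x ∷ xs} inj u = ∷-unique
    (λ fx∈ → let y , y∈xs , eq = ∈-map⁻ _ fx∈ in
      ∉-∷ u (subst (_∈ xs) (sym (inj (here refl) (there y∈xs) eq)) y∈xs))
    (map-unique (λ p q → inj (there p) (there q)) (unique-tail u))

  injectiveOn-⊆ : ∀ {xs ys} {f : A → B} → xs ⊆ ys → InjectiveOn ys f → InjectiveOn xs f
  injectiveOn-⊆ xs⊆ys inj p q = inj (xs⊆ys p) (xs⊆ys q)

  ∈-map-injectiveOn : ∀ {xs ys} {f : A → B} {x} → InjectiveOn xs f → ys ⊆ xs → x ∈ xs →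
                      f x ∈ map f ys → x ∈ ys
  ∈-map-injectiveOn inj ys⊆xs x∈xs fx∈ with y , y∈ys , eq ← ∈-map⁻ _ fx∈ =
    subst (_∈ _) (sym (inj x∈xs (ys⊆xs y∈ys) eq)) y∈ys

  unique-++⁻ : ∀ (xs : List A) {ys} → Unique (xs ++ ys) → Unique xs × Unique ys × Disjoint xs ys
  unique-++⁻ [] u = [] , u , λ ()
  unique-++⁻ (x ∷ xs) (px ∷ u) with uxs , uys , disj ← unique-++⁻ xs u =
    All.++⁻ˡ xs px ∷ uxs , uys ,
    λ { (here refl , q) → All.lookup (All.++⁻ʳ xs px) q refl
      ; (there p , q) → disj (p , q) }

  lookup-injective : ∀ {xs : List A} → Unique xs → ∀ {i j} → lookup xs i ≡ lookup xs j → i ≡ j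
  lookup-injective {xs = _ ∷ _} u {Fin.zero} {Fin.zero} eq = refl
  lookup-injective {xs = _ ∷ xs} u {Fin.zero} {Fin.suc j} refl = contradiction (∈-lookup {xs = xs} j) (∉-∷ u)
  lookup-injective {xs = _ ∷ xs} u {Fin.suc i} {Fin.zero} refl = contradiction (∈-lookup {xs = xs} i) (∉-∷ u)
  lookup-injective {xs = _ ∷ _} u {Fin.suc i} {Fin.suc j} eq = cong Fin.suc (lookup-injective (unique-tail u) eq)

  length-cartesianProductWith : ∀ {A B C : Set} (f : A → B → C) xs ys →
    length (cartesianProductWith f xs ys) ≡ length xs ℕ.* length ys
  length-cartesianProductWith f [] ys = refl
  length-cartesianProductWith f (x ∷ xs) ys = trans (length-++ (map (f x) ys))
    (cong₂ ℕ._+_ (length-map (f x) ys) (length-cartesianProductWith f xs ys))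

  last-∷ : ∀ {A : Set} (x y : A) ys → List⁺.last (x ∷ y ∷ ys) ≡ List⁺.last (y ∷ ys)
  last-∷ x y ys with initLast ys
  ... | [] = refl
  ... | zs ∷ʳ′ z = refl

  last-applyUpTo : ∀ {A : Set} (f : ℕ → A) n → List⁺.last (f 0 ∷ applyUpTo (f ∘ suc) n) ≡ f n
  last-applyUpTo f zero = refl
  last-applyUpTo f (suc n) = trans (last-∷ (f 0) (f 1) (applyUpTo (f ∘ suc ∘ suc) n)) (last-applyUpTo (f ∘ suc) n)

open Lists

module FiniteSet {A : Set} (_≟_ : DecidableEquality A) where

  open Matroids A _≟_ public using (_∖_; powerset; ∣_∣)
  open DecMembership _≟_ public using (_∈?_; _∉?_)

  ∈-∖⁺ : ∀ {x xs ys} → x ∈ xs → x ∉ ys → x ∈ xs ∖ ys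
  ∈-∖⁺ = ∈-filter⁺ (_∉? _)

  ∈-∖⁻ : ∀ {x} xs {ys} → x ∈ xs ∖ ys → x ∈ xs × x ∉ ys
  ∈-∖⁻ xs = ∈-filter⁻ (_∉? _) {xs = xs}

  ∖-⊆ : ∀ xs ys → xs ∖ ys ⊆ xs
  ∖-⊆ xs ys x∈ = proj₁ (∈-∖⁻ xs {ys} x∈)

  ∖-mono : ∀ xs ys {xs′ ys′} → xs ⊆ xs′ → ys′ ⊆ ys → xs ∖ ys ⊆ xs′ ∖ ys′
  ∖-mono xs ys p q x∈ with x∈xs , x∉ys ← ∈-∖⁻ xs {ys} x∈ = ∈-∖⁺ (p x∈xs) (x∉ys ∘ q)

  ∖-unique : ∀ {xs} ys → Unique xs → Unique (xs ∖ ys)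
  ∖-unique ys = Unique.filter⁺ (_∉? ys)

  ∖-length : ∀ {xs ys} → Unique xs → Unique ys → ys ⊆ xs → length ys ℕ.+ length (xs ∖ ys) ≡ length xs
  ∖-length {xs} {ys} uxs uys ys⊆xs = trans (sym (length-++ ys)) (≤-antisym
    (⊆-length (Unique.++⁺ uys (∖-unique ys uxs) λ (p , q) → proj₂ (∈-∖⁻ xs q) p)
      λ p → split (∈-++⁻ ys p))
    (⊆-length uxs λ {x} p → join x p (x ∈? ys)))
    where
    split : ∀ {x} → x ∈ ys ⊎ x ∈ xs ∖ ys → x ∈ xs
    split (inj₁ p) = ys⊆xs p
    split (inj₂ p) = ∖-⊆ xs ys p
    join : ∀ x → x ∈ xs → Dec (x ∈ ys) → x ∈ ys ++ xs ∖ ys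
    join x p (yes q) = ∈-++⁺ˡ q
    join x p (no q) = ∈-++⁺ʳ ys (∈-∖⁺ p q)

  ∖-length₁ : ∀ {xs x} → Unique xs → x ∈ xs → suc (length (xs ∖ [ x ])) ≡ length xs
  ∖-length₁ u x∈xs = ∖-length u ([] ∷ []) λ { (here refl) → x∈xs }

  filter-∈-powerset : ∀ {P : A → Set} (P? : Decidable P) xs → filter P? xs ∈ powerset xs
  filter-∈-powerset P? [] = here refl
  filter-∈-powerset P? (x ∷ xs) with P? x
  ... | yes _ = ∈-++⁺ʳ (powerset xs) (∈-map⁺ (x ∷_) (filter-∈-powerset P? xs))
  ... | no _ = ∈-++⁺ˡ (filter-∈-powerset P? xs)

  powerset-⊆ : ∀ xs {ys} → ys ∈ powerset xs → ys ⊆ xs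
  powerset-⊆ [] (here refl) ()
  powerset-⊆ (x ∷ xs) p q with ∈-++⁻ (powerset xs) p
  ... | inj₁ p′ = there (powerset-⊆ xs p′ q)
  ... | inj₂ p′ with zs , zs∈ , refl ← ∈-map⁻ _ p′ with q
  ...   | here eq = here eq
  ...   | there q′ = there (powerset-⊆ xs zs∈ q′)

  merge : {B : Set} → List A → (A → B) → (A → B) → A → B
  merge xs f g x with x ∈? xs
  ... | yes _ = f x
  ... | no _ = g x

  merge-∈ : ∀ {B : Set} xs {x} (f g : A → B) → x ∈ xs → merge xs f g x ≡ f x
  merge-∈ xs {x} f g p with x ∈? xs
  ... | yes _ = refl
  ... | no ¬p = contradiction p ¬p

  merge-∉ : ∀ {B : Set} xs {x} (f g : A → B) → x ∉ xs → merge xs f g x ≡ g x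
  merge-∉ xs {x} f g ¬p with x ∈? xs
  ... | yes p = contradiction p ¬p
  ... | no _ = refl

-- Bipartite matchings and alternating paths.

module Bipartite {R C : Set} (_≟R_ : DecidableEquality R) (_≟C_ : DecidableEquality C) where

  open FiniteSet _≟C_
  private module R = FiniteSet _≟R_

  record Matching (N : R → C → Set) (rs : List R) (cs : List C) (f : R → C) : Set where
    field
      edge      : ∀ {i} → i ∈ rs → N i (f i)
      into      : ∀ {i} → i ∈ rs → f i ∈ cs
      injective : InjectiveOn rs f

    map-⊆ : map f rs ⊆ cs
    map-⊆ p with i , i∈rs , refl ← ∈-map⁻ _ p = into i∈rs

  open Matching public

  Matchable : (R → C → Set) → List R → List C → Set
  Matchable N rs cs = ∃ (Matching N rs cs)

  private variable
    N : R → C → Set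
    rs rs′ : List R
    cs cs′ : List C
    f g : R → C

  matching-⊆ : rs′ ⊆ rs → cs ⊆ cs′ → Matching N rs cs f → Matching N rs′ cs′ f
  matching-⊆ p q m = record
    { edge = edge m ∘ p ; into = q ∘ into m ∘ p ; injective = injectiveOn-⊆ p (injective m) }

  matching-onto : Matching N rs cs f → rs′ ⊆ rs → Matching N rs′ (map f rs′) f
  matching-onto m p = record
    { edge = edge m ∘ p ; into = ∈-map⁺ _ ; injective = injectiveOn-⊆ p (injective m) }

  matching-≤ : Unique rs → Matching N rs cs f → length rs ≤ length cs
  matching-≤ {rs = rs} {f = f} u m = subst (_≤ _) (length-map f rs)
    (⊆-length (map-unique (injective m) u) (map-⊆ m))

  matching-merge : Matching N rs cs f → Matching N rs′ cs′ g → Disjoint cs cs′ →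
                   Matching N (rs ++ rs′) (cs ++ cs′) (R.merge rs f g)
  matching-merge {N} {rs} {cs} {f} {rs′} {cs′} {g} m m′ disj = record
    { edge = λ p → proj₁ (value p)
    ; into = λ p → side⇒∈ (proj₂ (value p))
    ; injective = λ p q eq → inj (proj₂ (value p)) (proj₂ (value q)) eq }
    where
    h = R.merge rs f g
    Side : R → Set
    Side i = (i ∈ rs × h i ≡ f i × f i ∈ cs) ⊎ (i ∈ rs′ × h i ≡ g i × g i ∈ cs′)
    value : ∀ {i} → i ∈ rs ++ rs′ → N i (h i) × Side i
    value {i} p with i R.∈? rs | ∈-++⁻ rs p
    ... | yes q | _ = edge m q , inj₁ (q , refl , into m q)
    ... | no ¬q | inj₁ q = contradiction q ¬q
    ... | no ¬q | inj₂ q = edge m′ q , inj₂ (q , refl , into m′ q)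
    side⇒∈ : ∀ {i} → Side i → h i ∈ cs ++ cs′
    side⇒∈ (inj₁ (_ , eq , p)) = ∈-++⁺ˡ (subst (_∈ cs) (sym eq) p)
    side⇒∈ (inj₂ (_ , eq , p)) = ∈-++⁺ʳ cs (subst (_∈ cs′) (sym eq) p)
    inj : ∀ {i j} → Side i → Side j → h i ≡ h j → i ≡ j
    inj (inj₁ (p , e , _)) (inj₁ (q , e′ , _)) eq = injective m p q (trans (sym e) (trans eq e′))
    inj (inj₂ (p , e , _)) (inj₂ (q , e′ , _)) eq = injective m′ p q (trans (sym e) (trans eq e′))
    inj (inj₁ (_ , e , c)) (inj₂ (_ , e′ , c′)) eq =
      ⊥-elim (disj (c , subst (_∈ cs′) (trans (sym e′) (trans (sym eq) e)) c′))
    inj (inj₂ (_ , e , c)) (inj₁ (_ , e′ , c′)) eq =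
      ⊥-elim (disj (c′ , subst (_∈ cs′) (trans (sym e) (trans eq e′)) c))

  matching-[_] : ∀ {k c} → N k c → Matching N [ k ] [ c ] (λ _ → c)
  matching-[ e ] = record
    { edge = λ { (here refl) → e } ; into = λ { (here refl) → here refl }
    ; injective = λ { (here refl) (here refl) _ → refl } }

  -- The extra row enters only through its neighbourhood `N₀`, and `c` is the column kept for it. It
  -- may thus be a second copy of a row in `rs`, or stand for a set of columns one of which is to be
  -- set free.
  Augmented : (R → C → Set) → (C → Set) → List R → List C → Set
  Augmented N N₀ rs cs = ∃[ c ] ∃[ g ] N₀ c × c ∈ cs × Matching N rs (cs ∖ [ c ]) g

  -- The alternating-path obstruction to matching one more row, whose neighbours are N₀.
  record Blocked (N : R → C → Set) (N₀ : C → Set) (rs : List R) (cs cs₀ : List C) (f : R → C) : Set where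
    constructor blocked
    field
      S S′    : List R
      split   : rs ↭ S ++ S′
      closed₀ : ∀ {c} → c ∈ cs₀ → c ∈ cs → N₀ c → c ∈ map f S
      closed  : ∀ {i c} → i ∈ S → c ∈ cs → N i c → c ∈ map f S

  module _ {N : R → C → Set} (N? : ∀ i c → Dec (N i c)) where

    private
      -- Depth-first search for an alternating path. The list `cs₀` holds the columns examined so
      -- far for the extra row, and `n` bounds the number of rows, which drops when the search moves
      -- on to a matched row.
      augment′ : ∀ n {N₀ : C → Set} → Decidable N₀ → ∀ rs {cs f} → length rs < n → Unique rs →
                 Matching N rs cs f → ∀ cs₀ → Augmented N N₀ rs cs ⊎ Blocked N N₀ rs cs cs₀ f

    augment : {N₀ : C → Set} → Decidable N₀ → ∀ {rs cs f} → Unique rs → Matching N rs cs f →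
              Augmented N N₀ rs cs ⊎ Blocked N N₀ rs cs cs f
    augment N₀? {rs} {cs} u m = augment′ (suc (length rs)) N₀? rs ≤-refl u m cs

    augment′ (suc n) N₀? rs lt u m [] = inj₂ (blocked [] rs ↭-refl (λ ()) (λ ()))
    augment′ (suc n) {N₀} N₀? rs {cs} {f} lt u m (c ∷ cs₀) with augment′ (suc n) N₀? rs lt u m cs₀
    ... | inj₁ a = inj₁ a
    ... | inj₂ (blocked S S′ split cl₀ cl) with c ∈? cs | N₀? c | c ∈? map f S | c ∈? map f rs
    ...   | no c∉ | _ | _ | _ = inj₂ (blocked S S′ split
              (λ { (here refl) p → contradiction p c∉ ; (there q) → cl₀ q }) cl)
    ...   | yes _ | no ¬e | _ | _ = inj₂ (blocked S S′ split
              (λ { (here refl) _ e → contradiction e ¬e ; (there q) → cl₀ q }) cl)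
    ...   | yes _ | yes _ | yes c∈ | _ = inj₂ (blocked S S′ split
              (λ { (here refl) _ _ → c∈ ; (there q) → cl₀ q }) cl)
    ...   | yes c∈ | yes e | no _ | no c∉f = inj₁ (c , f , e , c∈ ,
              record { edge = edge m ; injective = injective m
                     ; into = λ p → ∈-∖⁺ (into m p) λ { (here eq) → c∉f (subst (_∈ _) eq (∈-map⁺ f p)) } })
    ...   | yes c∈ | yes e | no c∉S | yes c∈f
            with k , k∈rs , refl ← ∈-map⁻ f c∈f
            with ∈-++⁻ S (∈-resp-↭ split k∈rs)
    ...     | inj₁ k∈S = contradiction (∈-map⁺ f k∈S) c∉S
    ...     | inj₂ k∈S′ with S″ , p ← ∈⇒↭ k∈S′ = result
      where
      split′ : rs ↭ S ++ k ∷ S″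
      split′ = ↭-trans split (++⁺ˡ S p)
      parts : Unique S × Unique (k ∷ S″) × Disjoint S (k ∷ S″)
      parts = unique-++⁻ S (unique-resp-↭ split′ u)
      S⊆ : S ⊆ rs
      S⊆ q = ∈-resp-↭ (↭-sym split′) (∈-++⁺ˡ q)
      S″⊆ : S″ ⊆ rs
      S″⊆ q = ∈-resp-↭ (↭-sym split′) (∈-++⁺ʳ S (there q))
      fresh : ∀ {i} → i ∈ S″ → f i ∉ f k ∷ map f S
      fresh i∈S″ (here eq) with refl ← injective m (S″⊆ i∈S″) k∈rs eq =
        ∉-∷ (proj₁ (proj₂ parts)) i∈S″
      fresh i∈S″ (there q) =
        proj₂ (proj₂ parts) (∈-map-injectiveOn (injective m) S⊆ (S″⊆ i∈S″) q , there i∈S″)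
      cs″ = cs ∖ (f k ∷ map f S)
      m″ : Matching N S″ cs″ f
      m″ = record { edge = edge m ∘ S″⊆ ; into = λ q → ∈-∖⁺ (into m (S″⊆ q)) (fresh q)
                  ; injective = injectiveOn-⊆ S″⊆ (injective m) }
      lt″ : length S″ < n
      lt″ = ≤-trans (s≤s (m≤n+m _ (length S))) (≤-pred (subst (_< suc n)
        (trans (↭-length split′) (trans (length-++ S) (+-suc (length S) _))) lt))
      result : Augmented N N₀ rs cs ⊎ Blocked N N₀ rs cs (f k ∷ cs₀) f
      -- The wanted column `f k` is held by `k`, so `k` is asked to move to a column not yet
      -- reached. If it can, `f k` is kept for the extra row; if not, `k` and the rows that block it
      -- join `S`.
      result with augment′ n (N? k) S″ lt″ (unique-tail (proj₁ (proj₂ parts))) m″ cs″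
      ... | inj₁ (c₂ , g , e₂ , c₂∈ , m₂) = inj₁ (f k , _ , e , c∈ , matching-⊆ (∈-resp-↭ split′) sub
              (matching-merge (matching-onto m S⊆) (matching-merge matching-[ e₂ ] m₂ disj₂) disj₁))
        where
        ⊆cs″ : [ c₂ ] ++ (cs″ ∖ [ c₂ ]) ⊆ cs″
        ⊆cs″ (here refl) = c₂∈
        ⊆cs″ (there q) = ∖-⊆ cs″ [ c₂ ] q
        disj₂ : Disjoint [ c₂ ] (cs″ ∖ [ c₂ ])
        disj₂ (q , q′) = proj₂ (∈-∖⁻ cs″ q′) q
        disj₁ : Disjoint (map f S) ([ c₂ ] ++ (cs″ ∖ [ c₂ ]))
        disj₁ (q , q′) = proj₂ (∈-∖⁻ cs (⊆cs″ q′)) (there q)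
        sub : map f S ++ [ c₂ ] ++ (cs″ ∖ [ c₂ ]) ⊆ cs ∖ [ f k ]
        sub q with ∈-++⁻ (map f S) q
        ... | inj₂ q′ = ∖-mono cs (f k ∷ map f S) id (λ { (here eq) → here eq }) (⊆cs″ q′)
        ... | inj₁ q′ with i , i∈S , refl ← ∈-map⁻ f q′ = ∈-∖⁺ (into m (S⊆ i∈S))
          λ { (here eq) → proj₂ (proj₂ parts)
                (i∈S , here (injective m (S⊆ i∈S) k∈rs eq)) }
      ... | inj₂ (blocked S₂ S₃ split₂ cl₂₀ cl₂) = inj₂ (blocked (k ∷ S ++ S₂) S₃ split₃ cl₀′ cl′)
        where
        S⁺ = map f (k ∷ S ++ S₂)
        split₃ : rs ↭ (k ∷ S ++ S₂) ++ S₃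
        split₃ = ↭-trans split′ (↭-trans (shift k S S″) (prep k
          (↭-trans (++⁺ˡ S split₂) (↭-reflexive (sym (++-assoc S S₂ S₃))))))
        old : map f S ⊆ S⁺
        old = map⁺ f (there ∘ ∈-++⁺ˡ)
        new : map f S₂ ⊆ S⁺
        new = map⁺ f (there ∘ ∈-++⁺ʳ S)
        cl₀′ : ∀ {c} → c ∈ f k ∷ cs₀ → c ∈ cs → N₀ c → c ∈ S⁺
        cl₀′ (here refl) _ _ = here refl
        cl₀′ (there q) c∈ e = old (cl₀ q c∈ e)
        extend : ∀ {c} → c ∈ cs → (c ∈ cs″ → c ∈ map f S₂) → c ∈ S⁺
        extend {c} c∈ h with c ∈? (f k ∷ map f S)
        ... | yes (here eq) = here eq
        ... | yes (there q) = old q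
        ... | no ¬q = new (h (∈-∖⁺ c∈ ¬q))
        cl′ : ∀ {i c} → i ∈ k ∷ S ++ S₂ → c ∈ cs → N i c → c ∈ S⁺
        cl′ (here refl) c∈ e = extend c∈ λ q → cl₂₀ q q e
        cl′ (there i∈) c∈ e with ∈-++⁻ S i∈
        ... | inj₁ i∈S = old (cl i∈S c∈ e)
        ... | inj₂ i∈S₂ = extend c∈ λ q → cl₂ i∈S₂ q e

-- Linear algebra over the integers.

-- The ring operations of ℤ are kept opaque: unfolding them defeats unification.
module Scalars where

  open import Data.Integer.Tactic.RingSolver using (solve-∀)

  infixl 6 _+_
  infixl 7 _*_
  infix 8 -_

  _≟0 : (a : ℤ) → Dec (a ≡ 0ℤ)
  a ≟0 = a ℤ.≟ 0ℤ

  1≢0 : 1ℤ ≢ 0ℤ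
  1≢0 ()

  opaque
    _+_ _*_ : ℤ → ℤ → ℤ
    _+_ = ℤ._+_
    _*_ = ℤ._*_

    -_ : ℤ → ℤ
    -_ = ℤ.-_

    *-zeroˡ : ∀ a → 0ℤ * a ≡ 0ℤ
    *-zeroˡ = ℤ.*-zeroˡ

    *-zeroʳ : ∀ a → a * 0ℤ ≡ 0ℤ
    *-zeroʳ = ℤ.*-zeroʳ

    +-identityˡ : ∀ a → 0ℤ + a ≡ a
    +-identityˡ = ℤ.+-identityˡ

    +-identityʳ : ∀ a → a + 0ℤ ≡ a
    +-identityʳ = ℤ.+-identityʳ

    *-identityˡ : ∀ a → 1ℤ * a ≡ a
    *-identityˡ = ℤ.*-identityˡ

    *-identityʳ : ∀ a → a * 1ℤ ≡ a
    *-identityʳ = ℤ.*-identityʳ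

    *-assoc : ∀ a b c → (a * b) * c ≡ a * (b * c)
    *-assoc = ℤ.*-assoc

    *-comm : ∀ a b → a * b ≡ b * a
    *-comm = ℤ.*-comm

    *-distribˡ-+ : ∀ a b c → a * (b + c) ≡ a * b + a * c
    *-distribˡ-+ = ℤ.*-distribˡ-+

    *-distribʳ-+ : ∀ a b c → (b + c) * a ≡ b * a + c * a
    *-distribʳ-+ = ℤ.*-distribʳ-+

    *-cancel-0 : ∀ {a b} → a ≢ 0ℤ → a * b ≡ 0ℤ → b ≡ 0ℤ
    *-cancel-0 a≢0 eq with ℤ.i*j≡0⇒i≡0∨j≡0 _ eq
    ... | inj₁ p = contradiction p a≢0
    ... | inj₂ p = p

    +-neg-inverse : ∀ a → a + - a ≡ 0ℤ
    +-neg-inverse = ℤ.+-inverseʳ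

    *-neg-cancel : ∀ a b → a * b + - a * b ≡ 0ℤ
    *-neg-cancel = solve-∀

    *-neg-swap : ∀ a b c → a * - b + c ≡ c + - a * b
    *-neg-swap = solve-∀

    +-interchange : ∀ a b c d → (a + b) + (c + d) ≡ (a + c) + (b + d)
    +-interchange = solve-∀

    +-exchange : ∀ a b c → a + (b + c) ≡ b + (a + c)
    +-exchange = solve-∀

    *-exchange : ∀ a b c → a * (b * c) ≡ b * (a * c)
    *-exchange = solve-∀

    *-rotate : ∀ a b c → a * (b * c) ≡ c * (b * a)
    *-rotate = solve-∀

    *-regroup : ∀ a b c d → (a * (b * c)) * d ≡ (b * (a * d)) * c
    *-regroup = solve-∀

    *-reassoc : ∀ a b c d → (a * (b * c)) * (1ℤ * d) ≡ a * (b * (c * d))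
    *-reassoc = solve-∀

    *-exchangeˡ : ∀ a b c → (a * b) * c ≡ b * (a * c)
    *-exchangeˡ = solve-∀

    *-root : ∀ a b c d e → a * (b * ((c + - d) * e)) ≡ a * ((c * b) * e) + - d * (a * (b * e))
    *-root = solve-∀

    +-neg≢0 : ∀ {a b} → a ≢ b → a + - b ≢ 0ℤ
    +-neg≢0 a≢b eq = a≢b (ℤ.i-j≡0⇒i≡j _ _ eq)

    cross-cancel : ∀ a b → a * b + - b * a ≡ 0ℤ
    cross-cancel = solve-∀

    *-combination : ∀ a b c d e → a * (b * c + - d * e) ≡ b * (a * c) + - d * (a * e)
    *-combination = solve-∀

    combination-* : ∀ a b c d e → (a * b + - c * d) * e ≡ a * (b * e) + - c * (d * e)
    combination-* = solve-∀

    -- Were the sum zero, `k` times the absolute value of `a` would equal that of `b`, yet it is at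
    -- least `k`.
    dominates : ∀ {k a b} → ℤ.∣ b ∣ ℕ.< k → a ≢ 0ℤ → ℤ.+ k * a + b ≢ 0ℤ
    dominates {k} {a} {b} lt a≢0 eq =
      ℕ.<⇒≱ lt (subst (k ℕ.≤_) size (ℕ.m≤m*n k ℤ.∣ a ∣ ⦃ ℕ.≢-nonZero (a≢0 ∘ ℤ.∣i∣≡0⇒i≡0) ⦄))
      where
      opposite : ∀ x y → y ≡ (x + y) + - x
      opposite = solve-∀
      size : k ℕ.* ℤ.∣ a ∣ ≡ ℤ.∣ b ∣
      size = trans (sym (ℤ.abs-* (ℤ.+ k) a)) (trans (sym (ℤ.∣-i∣≡∣i∣ (ℤ.+ k * a)))
        (cong ℤ.∣_∣ (sym (trans (opposite (ℤ.+ k * a) b)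
          (trans (cong (_+ - (ℤ.+ k * a)) eq) (ℤ.+-identityˡ (- (ℤ.+ k * a))))))))

  *-nonzero : ∀ {a b} → a ≢ 0ℤ → b ≢ 0ℤ → a * b ≢ 0ℤ
  *-nonzero a≢0 b≢0 eq = b≢0 (*-cancel-0 a≢0 eq)

  *-zero-cong : ∀ a {b} → b ≡ 0ℤ → a * b ≡ 0ℤ
  *-zero-cong a refl = *-zeroʳ a

  zero-*-cong : ∀ {a} b → a ≡ 0ℤ → a * b ≡ 0ℤ
  zero-*-cong b refl = *-zeroˡ b

  +-zero-cong : ∀ {a b} → a ≡ 0ℤ → b ≡ 0ℤ → a + b ≡ 0ℤ
  +-zero-cong refl refl = +-identityˡ 0ℤ

module Sums where

  private variable
    A B : Set

  open Scalars

  ∑ : List A → (A → ℤ) → ℤ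
  ∑ [] f = 0ℤ
  ∑ (x ∷ xs) f = f x + ∑ xs f

  ∑-cong : ∀ xs {f g : A → ℤ} → (∀ {x} → x ∈ xs → f x ≡ g x) → ∑ xs f ≡ ∑ xs g
  ∑-cong [] h = refl
  ∑-cong (x ∷ xs) h = cong₂ _+_ (h (here refl)) (∑-cong xs (h ∘ there))

  ∑-zero : ∀ xs {f : A → ℤ} → (∀ {x} → x ∈ xs → f x ≡ 0ℤ) → ∑ xs f ≡ 0ℤ
  ∑-zero [] h = refl
  ∑-zero (x ∷ xs) h = +-zero-cong (h (here refl)) (∑-zero xs (h ∘ there))

  ∑-+ : ∀ xs (f g : A → ℤ) → ∑ xs (λ x → f x + g x) ≡ ∑ xs f + ∑ xs g
  ∑-+ [] f g = sym (+-identityˡ 0ℤ)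
  ∑-+ (x ∷ xs) f g = trans (cong (f x + g x +_) (∑-+ xs f g)) (+-interchange (f x) (g x) (∑ xs f) (∑ xs g))

  ∑-* : ∀ xs (a : ℤ) (f : A → ℤ) → ∑ xs (λ x → a * f x) ≡ a * ∑ xs f
  ∑-* [] a f = sym (*-zeroʳ a)
  ∑-* (x ∷ xs) a f = trans (cong (a * f x +_) (∑-* xs a f)) (sym (*-distribˡ-+ a _ _))

  ∑-swap : ∀ xs ys (f : A → B → ℤ) →
           ∑ xs (λ x → ∑ ys (λ y → f x y)) ≡ ∑ ys (λ y → ∑ xs (λ x → f x y))
  ∑-swap [] ys f = sym (∑-zero ys λ _ → refl)
  ∑-swap (x ∷ xs) ys f = trans (cong (∑ ys (f x) +_) (∑-swap xs ys f)) (sym (∑-+ ys _ _))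

  ∑-↭ : ∀ {xs ys} → xs ↭ ys → (f : A → ℤ) → ∑ xs f ≡ ∑ ys f
  ∑-↭ ↭.refl f = refl
  ∑-↭ (↭.prep x p) f = cong (f x +_) (∑-↭ p f)
  ∑-↭ (↭.swap x y p) f = trans (cong (λ s → f x + (f y + s)) (∑-↭ p f)) (+-exchange (f x) (f y) _)
  ∑-↭ (↭.trans p q) f = trans (∑-↭ p f) (∑-↭ q f)

  ∑-map : ∀ (h : A → B) xs (f : B → ℤ) → ∑ (map h xs) f ≡ ∑ xs (f ∘ h)
  ∑-map h [] f = refl
  ∑-map h (x ∷ xs) f = cong (f (h x) +_) (∑-map h xs f)

  ∑-support : ∀ {xs ys} → Unique xs → Unique ys → xs ⊆ ys → {f : A → ℤ} →
              (∀ {y} → y ∈ ys → y ∉ xs → f y ≡ 0ℤ) → ∑ ys f ≡ ∑ xs f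
  ∑-support {xs = []} {ys} _ _ _ h = ∑-zero ys λ p → h p λ ()
  ∑-support {xs = x ∷ xs} {ys} uxs uys sub {f} h with zs , p ← ∈⇒↭ (sub (here refl)) =
    trans (∑-↭ p f) (cong (f x +_) (∑-support (unique-tail uxs) (unique-tail uzs) sub′ h′))
    where
    uzs : Unique (x ∷ zs)
    uzs = unique-resp-↭ p uys
    sub′ : xs ⊆ zs
    sub′ q with ∈-resp-↭ p (sub (there q))
    ... | here refl = contradiction q (∉-∷ uxs)
    ... | there r = r
    h′ : ∀ {y} → y ∈ zs → y ∉ xs → f y ≡ 0ℤ
    h′ q ∉xs = h (∈-resp-↭ (↭-sym p) (there q))
      λ { (here refl) → ∉-∷ uzs q ; (there r) → ∉xs r }

  ∑-single : ∀ {xs} {x : A} {f : A → ℤ} → Unique xs → x ∈ xs →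
             (∀ {y} → y ∈ xs → y ≢ x → f y ≡ 0ℤ) → ∑ xs f ≡ f x
  ∑-single u x∈ h = trans
    (∑-support ([] ∷ []) u (λ { (here refl) → x∈ }) λ p ¬q → h p λ eq → ¬q (here eq))
    (+-identityʳ _)

module LinearDependence {A : Set} (_≟_ : DecidableEquality A) where

  open Sums
  open FiniteSet _≟_
  open Scalars

  record Solution (xs : List A) (eqs : List (A → ℤ)) : Set where
    field
      value    : A → ℤ
      witness  : ∃[ x ] x ∈ xs × value x ≢ 0ℤ
      support  : ∀ {x} → x ∉ xs → value x ≡ 0ℤ
      solves   : ∀ {a} → a ∈ eqs → ∑ xs (λ x → a x * value x) ≡ 0ℤ

  open Solution public

  private
    δ : A → A → ℤ
    δ x = merge [ x ] (λ _ → 1ℤ) (λ _ → 0ℤ)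

    -- Elimination without division: a first equation with zero coefficients is dropped; otherwise a
    -- pivot `x₀` of it is removed from the other equations by cross-multiplication.
    dependence′ : ∀ n {xs} eqs → length eqs ≡ n → Unique xs → n < length xs → Solution xs eqs
    dependence′ zero {x ∷ xs} [] _ u _ = record
      { value = δ x
      ; witness = x , here refl , λ eq →
          contradiction (trans (sym (merge-∈ [ x ] (λ _ → 1ℤ) (λ _ → 0ℤ) (here refl))) eq) 1≢0
      ; support = λ ∉ → merge-∉ [ x ] (λ _ → 1ℤ) (λ _ → 0ℤ) λ { (here p) → ∉ (here p) }
      ; solves = λ () }
    dependence′ (suc n) {xs} (a ∷ eqs) len u lt with any? (λ x → ¬? ((a x) ≟0)) xs
    ... | no all-zero = record
      { value = value s ; witness = witness s ; support = support s
      ; solves = λ { (here refl) → ∑-zero xs λ {x} p →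
                       zero-*-cong (value s x) (decidable-stable ((a x) ≟0) (all-zero ∘ lose p))
                   ; (there p) → solves s p } }
      where
      s : Solution xs eqs
      s = dependence′ n eqs (suc-injective len) u (≤-trans (n≤1+n _) lt)
    ... | yes found with x₀ , x₀∈ , a₀≢0 ← find found | ys , p ← ∈⇒↭ (proj₁ (proj₂ (find found))) = record
      { value = z
      ; witness = proj₁ w , ∈-resp-↭ (↭-sym p) (there (proj₁ (proj₂ w))) ,
          λ eq → *-nonzero a₀≢0 (proj₂ (proj₂ w)) (trans (sym (z-other (proj₁ (proj₂ w)))) eq)
      ; support = λ {x} ∉xs → trans (merge-∉ [ x₀ ] _ _ λ { (here refl) → ∉xs x₀∈ })
          (trans (cong (a x₀ *_) (support s (∉xs ∘ ∈-resp-↭ (↭-sym p) ∘ there))) (*-zeroʳ (a x₀)))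
      ; solves = λ {b} → solves′ b }
      where
      eliminate : (A → ℤ) → A → ℤ
      eliminate b x = a x₀ * b x + - b x₀ * a x
      u′ : Unique (x₀ ∷ ys)
      u′ = unique-resp-↭ p u
      s : Solution ys (map eliminate eqs)
      s = dependence′ n (map eliminate eqs)
          (trans (length-map eliminate eqs) (suc-injective len)) (unique-tail u′)
          (≤-pred (subst (suc (suc n) ≤_) (↭-length p) lt))
      w = witness s
      Σ⟨_⟩ : (A → ℤ) → ℤ
      Σ⟨ b ⟩ = ∑ ys (λ x → b x * value s x)
      -- Scaling the other values by the pivot `a x₀` makes the value at `x₀` integral.
      z : A → ℤ
      z = merge [ x₀ ] (λ _ → - Σ⟨ a ⟩) (λ x → a x₀ * value s x)
      z-other : ∀ {x} → x ∈ ys → z x ≡ a x₀ * value s x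
      z-other q = merge-∉ [ x₀ ] _ _ λ { (here refl) → ∉-∷ u′ q }
      total : ∀ b → ∑ xs (λ x → b x * z x) ≡ a x₀ * Σ⟨ b ⟩ + - b x₀ * Σ⟨ a ⟩
      total b = trans (∑-↭ p _) (trans
        (cong₂ _+_ (cong (b x₀ *_) (merge-∈ [ x₀ ] (λ _ → - Σ⟨ a ⟩) (λ x → a x₀ * value s x) (here refl)))
          (trans (∑-cong ys λ {x} q → trans (cong (b x *_) (z-other q)) (*-exchange (b x) (a x₀) (value s x)))
                 (∑-* ys (a x₀) _)))
        (*-neg-swap (b x₀) Σ⟨ a ⟩ (a x₀ * Σ⟨ b ⟩)))
      solved : ∀ b → b ∈ eqs → a x₀ * Σ⟨ b ⟩ + - b x₀ * Σ⟨ a ⟩ ≡ 0ℤ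
      solved b q = trans (sym (trans
        (∑-cong ys λ {x} _ → combination-* (a x₀) (b x) (b x₀) (a x) (value s x))
        (trans (∑-+ ys _ _) (cong₂ _+_ (∑-* ys (a x₀) _) (∑-* ys (- b x₀) _)))))
        (solves s (∈-map⁺ eliminate q))
      solves′ : ∀ b → b ∈ a ∷ eqs → ∑ xs (λ x → b x * z x) ≡ 0ℤ
      solves′ b (here refl) = trans (total a) (*-neg-cancel (a x₀) Σ⟨ a ⟩)
      solves′ b (there q) = trans (total b) (solved b q)

  dependence : ∀ {xs} eqs → Unique xs → length eqs < length xs → Solution xs eqs
  dependence eqs = dependence′ _ eqs refl

-- Generic matrices supported on a bipartite graph.

module GenericMatrix {R C : Set} (_≟R_ : DecidableEquality R) (_≟C_ : DecidableEquality C) where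

  open Sums
  open FiniteSet _≟C_
  private module R = FiniteSet _≟R_
  open Bipartite _≟R_ _≟C_
  open LinearDependence _≟C_
  open Scalars
  open import Data.Integer using () renaming (+_ to pos; ∣_∣ to abs)

  private
    ∈-≤-sum : ∀ {m ms} → m ∈ ms → m ≤ sum ms
    ∈-≤-sum {ms = n ∷ ms} (here refl) = m≤m+n n _
    ∈-≤-sum {ms = n ∷ ms} (there p) = ≤-trans (∈-≤-sum p) (m≤n+m _ n)
      where open import Data.Nat.Properties using (m≤n+m)

  -- If the row found so far annihilates `z`, it is scaled by a factor exceeding the entries at `c₁`
  -- of all other vectors, and 1 is added at `c₁`. The product with `z` becomes `z c₁`, and the
  -- products that were nonzero stay so.
  avoid : ∀ {cols} {N₀ : C → Set} → Unique cols → Decidable N₀ → ∀ (zs : List (C → ℤ)) →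
          Σ (C → ℤ) λ l → (∀ c → ¬ N₀ c → l c ≡ 0ℤ) ×
            (∀ {z} → z ∈ zs → (∃[ c ] c ∈ cols × N₀ c × z c ≢ 0ℤ) → ∑ cols (λ c → l c * z c) ≢ 0ℤ)
  avoid u N₀? [] = (λ _ → 0ℤ) , (λ _ _ → refl) , λ ()
  avoid {cols} {N₀} u N₀? (z ∷ zs) with l , supp , ok ← avoid {cols} {N₀} u N₀? zs
    with ∑ cols (λ c → l c * z c) ≟0
  ... | no ≢0 = l , supp , λ { (here refl) _ → ≢0 ; (there p) → ok p }
  ... | yes ≡0 with any? (λ c → N₀? c ×-dec ¬? (z c ≟0)) cols
  ...   | no none = l , supp , λ { (here refl) (c , c∈ , h) → contradiction (lose c∈ h) none
                                 ; (there p) → ok p }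
  ...   | yes found with c₁ , c₁∈ , n₁ , z₁≢0 ← find found = l′ , supp′ , ok′
    where
    k : ℕ
    k = suc (sum (map (λ z′ → abs (z′ c₁)) zs))
    δ l′ : C → ℤ
    δ = merge [ c₁ ] (λ _ → 1ℤ) (λ _ → 0ℤ)
    l′ c = pos k * l c + δ c
    supp′ : ∀ c → ¬ N₀ c → l′ c ≡ 0ℤ
    supp′ c ¬n = +-zero-cong (*-zero-cong (pos k) (supp c ¬n))
      (merge-∉ [ c₁ ] (λ _ → 1ℤ) (λ _ → 0ℤ) λ { (here refl) → ¬n n₁ })
    value-l′ : ∀ z′ → ∑ cols (λ c → l′ c * z′ c) ≡ pos k * ∑ cols (λ c → l c * z′ c) + z′ c₁
    value-l′ z′ = trans (∑-cong cols λ {c} _ → trans (*-distribʳ-+ (z′ c) (pos k * l c) (δ c))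
        (cong (_+ δ c * z′ c) (*-assoc (pos k) (l c) (z′ c))))
      (trans (∑-+ cols _ _) (cong₂ _+_ (∑-* cols (pos k) _)
      (trans (∑-single u c₁∈ λ {c} _ c≢ → zero-*-cong (z′ c)
               (merge-∉ [ c₁ ] (λ _ → 1ℤ) (λ _ → 0ℤ) λ { (here refl) → c≢ refl }))
             (trans (cong (_* z′ c₁) (merge-∈ [ c₁ ] (λ _ → 1ℤ) (λ _ → 0ℤ) (here refl)))
                    (*-identityˡ (z′ c₁))))))
    ok′ : ∀ {z′} → z′ ∈ z ∷ zs → (∃[ c ] c ∈ cols × N₀ c × z′ c ≢ 0ℤ) → ∑ cols (λ c → l′ c * z′ c) ≢ 0ℤ
    ok′ {z′} (here refl) _ eq = z₁≢0 (trans (sym (trans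
      (cong (_+ z′ c₁) (*-zero-cong (pos k) ≡0)) (+-identityˡ (z′ c₁))))
      (trans (sym (value-l′ z′)) eq))
    ok′ {z′} (there p) h eq = dominates (s≤s (∈-≤-sum (∈-map⁺ _ p))) (ok p h) (trans (sym (value-l′ z′)) eq)

  -- Trivial kernel of the square submatrix with rows `rs` and columns `map f rs`, in place of a
  -- nonzero determinant; its vectors are functions on all columns that vanish elsewhere.
  Nonsingular : (R → C → ℤ) → List C → List R → (R → C) → Set
  Nonsingular L cols rs f = ∀ (z : C → ℤ) → (∀ {c} → c ∉ map f rs → z c ≡ 0ℤ) →
    (∀ {i} → i ∈ rs → ∑ cols (λ c → L i c * z c) ≡ 0ℤ) → ∀ c → z c ≡ 0ℤ

  record Generic (N : R → C → Set) (rows : List R) (cols : List C) : Set where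
    field
      entry       : R → C → ℤ
      zero-entry  : ∀ {i c} → ¬ N i c → entry i c ≡ 0ℤ
      nonsingular : ∀ {rs f} → rs ⊆ rows → Unique rs → Matching N rs cols f → Nonsingular entry cols rs f

  open Generic

  module _ {N : R → C → Set} (N? : ∀ i c → Dec (N i c)) {cols : List C} (ucols : Unique cols) where

    sub : List C → List C
    sub b = filter (_∈? b) cols

    usub : ∀ b → Unique (sub b)
    usub b = Unique.filter⁺ (_∈? b) ucols

    -- The default zero vector is harmless: `avoid` only concerns vectors with a nonzero entry on
    -- the given neighbourhood.
    kernel : (R → C → ℤ) → List R → List C → C → ℤ
    kernel L a b with length (map L a) <? length (sub b)
    ... | yes lt = value (dependence (map L a) (usub b) lt)
    ... | no _ = λ _ → 0ℤ

    kernel-solution : ∀ L a b → length (map L a) < length (sub b) →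
                      Σ (Solution (sub b) (map L a)) λ s → value s ≡ kernel L a b
    kernel-solution L a b lt with length (map L a) <? length (sub b)
    ... | yes lt′ = dependence (map L a) (usub b) lt′ , refl
    ... | no ¬lt = contradiction lt ¬lt

    -- The new row avoids the kernel vectors of all smaller systems, of which there are finitely many.
    generic : ∀ {rows} → Unique rows → Generic N rows cols
    generic {[]} _ = record
      { entry = λ _ _ → 0ℤ ; zero-entry = λ _ → refl
      ; nonsingular = λ { {[]} _ _ _ z supp _ c → supp (λ ()) ; {_ ∷ _} sub → contradiction (sub (here refl)) λ () } }
    generic {ρ ∷ rows} u = record
      { entry = L′
      ; zero-entry = λ {i} {c} → zero′ i c (i ≟R ρ)
      ; nonsingular = nonsingular′ }
      where
      G : Generic N rows cols
      G = generic (unique-tail u)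
      L : R → C → ℤ
      L = entry G
      kernels : List (C → ℤ)
      kernels = cartesianProductWith (kernel L) (R.powerset rows) (powerset cols)
      row = avoid ucols (N? ρ) kernels
      l : C → ℤ
      l = proj₁ row
      L′ : R → C → ℤ
      L′ = R.merge [ ρ ] (λ _ → l) L
      L′ρ : L′ ρ ≡ l
      L′ρ = R.merge-∈ [ ρ ] (λ _ → l) L (here refl)
      L′-other : ∀ {i} → i ≢ ρ → L′ i ≡ L i
      L′-other i≢ρ = R.merge-∉ [ ρ ] (λ _ → l) L λ { (here refl) → i≢ρ refl }
      zero′ : ∀ i c → Dec (i ≡ ρ) → ¬ N i c → L′ i c ≡ 0ℤ
      zero′ i c (yes refl) ¬n = trans (cong (λ h → h c) L′ρ) (proj₁ (proj₂ row) c ¬n)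
      zero′ i c (no i≢ρ) ¬n = trans (cong (λ h → h c) (L′-other i≢ρ)) (zero-entry G ¬n)
      nonsingular′ : ∀ {rs f} → rs ⊆ ρ ∷ rows → Unique rs → Matching N rs cols f → Nonsingular L′ cols rs f
      nonsingular′ {rs} {f} sub-rs urs m z supp sol with ρ R.∈? rs
      ... | no ρ∉ = nonsingular G rs⊆ urs m z supp λ {i} i∈ →
              trans (∑-cong cols λ {c} _ → cong (λ h → h c * z c) (sym (L′-other λ { refl → ρ∉ i∈ }))) (sol i∈)
        where
        rs⊆ : rs ⊆ rows
        rs⊆ p with sub-rs p
        ... | here refl = contradiction p ρ∉
        ... | there q = q
      -- The rows of `rs` other than `ρ` have a kernel vector `z̃` on `map f rs`, unique up to scale
      -- because they are nonsingular on their own columns, and the new row does not annihilate it.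
      ... | yes ρ∈ = λ c → *-cancel-0 z̃₀≢0 (z-zero c)
        where
        c₀ = f ρ
        -- Filtering `rows` and `cols` puts `a` and `b` in canonical order, so that their kernel
        -- vector is among the finitely many in `kernels`.
        a = filter (R._∈? rs) rows
        b = sub (map f rs)
        a⊆rs : a ⊆ rs
        a⊆rs p = proj₂ (∈-filter⁻ (R._∈? rs) {xs = rows} p)
        a⊆rows : a ⊆ rows
        a⊆rows p = proj₁ (∈-filter⁻ (R._∈? rs) {xs = rows} p)
        ρ∉a : ρ ∉ a
        ρ∉a p = ∉-∷ u (a⊆rows p)
        ua : Unique a
        ua = Unique.filter⁺ (R._∈? rs) (unique-tail u)
        rs⊆ρa : rs ⊆ ρ ∷ a
        rs⊆ρa p with sub-rs p
        ... | here refl = here refl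
        ... | there q = there (∈-filter⁺ (R._∈? rs) q p)
        image⊆ : map f rs ⊆ sub b
        image⊆ p = ∈-filter⁺ (_∈? b) p′ (∈-filter⁺ (_∈? map f rs) p′ p)
          where p′ = map-⊆ m p
        ⊆image : sub b ⊆ map f rs
        ⊆image p = proj₂ (∈-filter⁻ (_∈? map f rs) {xs = cols} (proj₂ (∈-filter⁻ (_∈? b) {xs = cols} p)))
        lt : length (map L a) < length (sub b)
        lt = ≤-trans (s≤s (≤-reflexive (length-map L a)))
          (≤-trans (⊆-length (∷-unique ρ∉a ua) λ { (here refl) → ρ∈ ; (there p) → a⊆rs p })
          (≤-trans (≤-reflexive (sym (length-map f rs))) (⊆-length (map-unique (injective m) urs) image⊆)))
        s = proj₁ (kernel-solution L a b lt)
        z̃ : C → ℤ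
        z̃ = value s
        z̃∈ : z̃ ∈ kernels
        z̃∈ = subst (_∈ kernels) (sym (proj₂ (kernel-solution L a b lt)))
          (∈-cartesianProductWith⁺ (kernel L) (R.filter-∈-powerset _ rows) (filter-∈-powerset _ cols))
        z̃-supp : ∀ {c} → c ∉ map f rs → z̃ c ≡ 0ℤ
        z̃-supp c∉ = support s (c∉ ∘ ⊆image)
        z̃-sol : ∀ {i} → i ∈ a → ∑ cols (λ c → L i c * z̃ c) ≡ 0ℤ
        z̃-sol {i} i∈ = trans (∑-support (usub b) ucols (λ p → proj₁ (∈-filter⁻ (_∈? b) {xs = cols} p))
          (λ {c} _ c∉ → *-zero-cong (L i c) (support s c∉)))
          (solves s (∈-map⁺ L i∈))
        fa-supp : ∀ {w : C → ℤ} → (∀ {c} → c ∉ map f rs → w c ≡ 0ℤ) → w c₀ ≡ 0ℤ → ∀ {c} → c ∉ map f a → w c ≡ 0ℤ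
        fa-supp {w} w-supp w₀ {c} c∉ with c ∈? map f rs
        ... | no c∉′ = w-supp c∉′
        ... | yes c∈ with i , i∈ , refl ← ∈-map⁻ f c∈ with rs⊆ρa i∈
        ...   | here refl = w₀
        ...   | there q = contradiction (∈-map⁺ f q) c∉
        ma : Matching N a cols f
        ma = matching-⊆ a⊆rs id m
        z̃₀≢0 : z̃ c₀ ≢ 0ℤ
        z̃₀≢0 eq = proj₂ (proj₂ (witness s)) (nonsingular G a⊆rows ua ma z̃ (fa-supp z̃-supp eq) z̃-sol _)
        lz̃≢0 : ∑ cols (λ c → l c * z̃ c) ≢ 0ℤ
        lz̃≢0 = proj₂ (proj₂ row) z̃∈ (c₀ , into m ρ∈ , edge m ρ∈ , z̃₀≢0)
        lz : ∑ cols (λ c → l c * z c) ≡ 0ℤ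
        lz = trans (∑-cong cols λ {c} _ → cong (λ h → h c * z c) (sym L′ρ)) (sol ρ∈)
        z-sol : ∀ {i} → i ∈ a → ∑ cols (λ c → L i c * z c) ≡ 0ℤ
        z-sol {i} i∈ = trans (∑-cong cols λ {c} _ → cong (λ h → h c * z c) (sym (L′-other λ { refl → ρ∉a i∈ })))
          (sol (a⊆rs i∈))
        -- The entries at `c₀` cancel, so this is a kernel vector of the rows `a` supported on
        -- `map f a`, hence zero.
        ẑ : C → ℤ
        ẑ c = z̃ c₀ * z c + - z c₀ * z̃ c
        ∑ẑ : ∀ (h : C → ℤ) → ∑ cols (λ c → h c * ẑ c) ≡
             z̃ c₀ * ∑ cols (λ c → h c * z c) + - z c₀ * ∑ cols (λ c → h c * z̃ c)
        ∑ẑ h = trans (∑-cong cols λ {c} _ → *-combination (h c) (z̃ c₀) (z c) (z c₀) (z̃ c))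
          (trans (∑-+ cols _ _) (cong₂ _+_ (∑-* cols (z̃ c₀) _) (∑-* cols (- z c₀) _)))
        combine : ∀ {x y} → x ≡ 0ℤ → y ≡ 0ℤ → z̃ c₀ * x + - z c₀ * y ≡ 0ℤ
        combine p q = +-zero-cong (*-zero-cong (z̃ c₀) p) (*-zero-cong (- z c₀) q)
        ẑ≡0 : ∀ c → ẑ c ≡ 0ℤ
        ẑ≡0 = nonsingular G a⊆rows ua ma ẑ
          (fa-supp (λ c∉ → combine (supp c∉) (z̃-supp c∉)) (cross-cancel (z̃ c₀) (z c₀)))
          λ {i} i∈ → trans (∑ẑ (L i)) (combine (z-sol i∈) (z̃-sol i∈))
        lẑ : z̃ c₀ * ∑ cols (λ c → l c * z c) + - z c₀ * ∑ cols (λ c → l c * z̃ c) ≡ 0ℤ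
        lẑ = trans (sym (∑ẑ l)) (∑-zero cols λ {c} _ → *-zero-cong (l c) (ẑ≡0 c))
        z₀≡0 : - z c₀ ≡ 0ℤ
        z₀≡0 = *-cancel-0 lz̃≢0 (trans (*-comm _ _) (trans
          (sym (trans (cong (_+ - z c₀ * ∑ cols (λ c → l c * z̃ c)) (*-zero-cong (z̃ c₀) lz)) (+-identityˡ _))) lẑ))
        z-zero : ∀ c → z̃ c₀ * z c ≡ 0ℤ
        z-zero c = trans (sym (trans (cong (z̃ c₀ * z c +_) (zero-*-cong (z̃ c) z₀≡0)) (+-identityʳ _))) (ẑ≡0 c)

-- Deciding whether all rows can be matched.

module Matchability {R C : Set} (_≟R_ : DecidableEquality R) (_≟C_ : DecidableEquality C) where

  open FiniteSet _≟C_
  private module R = FiniteSet _≟R_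
  open Bipartite _≟R_ _≟C_

  matching-cons : ∀ {N : R → C → Set} {ρ rs rs′ cs f c} → N ρ c → c ∈ cs → rs′ ⊆ ρ ∷ rs →
                  Matching N rs (cs ∖ [ c ]) f → Matching N rs′ cs (R.merge [ ρ ] (λ _ → c) f)
  matching-cons {cs = cs} {c = c} e c∈ sub m = matching-⊆ sub sub′ (matching-merge matching-[ e ] m
    λ (p , q) → proj₂ (∈-∖⁻ cs {[ c ]} q) p)
    where
    sub′ : [ c ] ++ (cs ∖ [ c ]) ⊆ cs
    sub′ (here refl) = c∈
    sub′ (there q) = ∖-⊆ cs [ c ] q

  pigeonhole : ∀ {N : R → C → Set} {rs cs ks f} → Unique rs → Matching N rs cs f →
               (∀ {ρ} → ρ ∈ rs → f ρ ∈ ks) → length ks < length rs → ⊥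
  pigeonhole {N} u m h lt = <⇒≱ lt (matching-≤ {N = N} u
    record { edge = edge m ; into = h ; injective = injective m })

  module _ {N : R → C → Set} (N? : ∀ ρ c → Dec (N ρ c)) (f₀ : R → C) where

    -- Rows are added one at a time. A blocked augmentation exhibits `ρ ∷ S`, all of whose
    -- neighbours in `cs` lie among the `length S` columns `map f S`.
    matchable? : ∀ {rs} → Unique rs → ∀ cs → Dec (Matchable N rs cs)
    matchable? {[]} _ cs = yes (f₀ , record { edge = λ () ; into = λ () ; injective = λ () })
    matchable? {ρ ∷ rs} u cs with matchable? (unique-tail u) cs
    ... | no ¬m = no λ (f , m) → ¬m (f , matching-⊆ there id m)
    ... | yes (f , m) with augment N? (N? ρ) (unique-tail u) m
    ...   | inj₁ (c , g , e , c∈ , m′) = yes (_ , matching-cons e c∈ id m′)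
    ...   | inj₂ b = no λ (g , m′) → pigeonhole u′ (matching-⊆ J⊆ id m′)
              (λ { (here refl) → closed₀ (into m′ (here refl)) (into m′ (here refl)) (edge m′ (here refl))
                 ; (there p) → closed p (into m′ (J⊆ (there p))) (edge m′ (J⊆ (there p))) })
              (s≤s (≤-reflexive (length-map f S)))
      where
      open Blocked b
      S⊆ : S ⊆ rs
      S⊆ p = ∈-resp-↭ (↭-sym split) (∈-++⁺ˡ p)
      J⊆ : ρ ∷ S ⊆ ρ ∷ rs
      J⊆ (here refl) = here refl
      J⊆ (there p) = there (S⊆ p)
      u′ : Unique (ρ ∷ S)
      u′ = ∷-unique (∉-∷ u ∘ S⊆) (proj₁ (unique-++⁻ S (unique-resp-↭ split (unique-tail u))))

-- Inverses and kernel coordinates of a nonsingular submatrix.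

module Duality {R C : Set} (_≟R_ : DecidableEquality R) (_≟C_ : DecidableEquality C) where

  open Sums
  open Scalars
  open FiniteSet _≟C_
  private module R = FiniteSet _≟R_
  open Bipartite _≟R_ _≟C_
  open GenericMatrix _≟R_ _≟C_

  private
    _≟M_ : DecidableEquality (Maybe C)
    _≟M_ = ≡-dec _≟C_
    _≟N_ : DecidableEquality (Maybe R)
    _≟N_ = ≡-dec _≟R_
    module RC = LinearDependence _≟M_
    module CR = LinearDependence _≟N_

    -- `nothing` stands for the additional unknown, the coefficient of a unit vector.
    unknowns : {A : Set} {xs : List A} → Unique xs → Unique (nothing ∷ map just xs)
    unknowns u = ∷-unique (λ p → case ∈-map⁻ just p of λ ()) (map-unique (λ _ _ → just-injective) u)

  infix 8 _ᵀ
  _ᵀ : (R → C → ℤ) → C → R → ℤ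
  (L ᵀ) c ρ = L ρ c

  -- Up to the scalar d, the function g is a column of the inverse of L[rs, f rs].
  record RightInverse (L : R → C → ℤ) (cols : List C) (rs : List R) (f : R → C) (ρ : R) : Set where
    field
      d       : ℤ
      g       : C → ℤ
      d≢0     : d ≢ 0ℤ
      inverse : ∀ (y : R → ℤ) → y ρ * d + ∑ cols (λ c → g c * ∑ rs (λ ρ′ → L ρ′ c * y ρ′)) ≡ 0ℤ
      g-supp  : ∀ {c} → c ∉ map f rs → g c ≡ 0ℤ

  module _ {N : R → C → Set} {L : R → C → ℤ} {cols rs f} (ucols : Unique cols) (u : Unique rs)
           (m : Matching N rs cols f) (ns : Nonsingular L cols rs f) where

    private
      image = map f rs
      uimage : Unique image
      uimage = map-unique (injective m) u

    -- There is one unknown more than there are equations, and a solution with `d` zero would be a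
    -- kernel vector of the nonsingular submatrix.
    right-inverse : ∀ {ρ} → ρ ∈ rs → RightInverse L cols rs f ρ
    right-inverse {ρ} ρ∈ = record { d = d ; g = g ; d≢0 = d≢0 ; inverse = inverse ; g-supp = g-supp }
      where
      δ : R → ℤ
      δ = R.merge [ ρ ] (λ _ → 1ℤ) (λ _ → 0ℤ)
      equation : R → Maybe C → ℤ
      equation ρ′ nothing = δ ρ′
      equation ρ′ (just c) = L ρ′ c
      s : RC.Solution (nothing ∷ map just image) (map equation rs)
      s = RC.dependence (map equation rs) (unknowns uimage)
        (s≤s (≤-reflexive (trans (length-map equation rs)
          (sym (trans (length-map just image) (length-map f rs))))))
      d : ℤ
      d = RC.value s nothing
      g : C → ℤ
      g c = RC.value s (just c)
      g-supp : ∀ {c} → c ∉ image → g c ≡ 0ℤ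
      g-supp c∉ = RC.support s λ { (there p) → case ∈-map⁻ just p of λ { (_ , q , refl) → c∉ q } }
      row : ∀ ρ′ → ρ′ ∈ rs → δ ρ′ * d + ∑ cols (λ c → L ρ′ c * g c) ≡ 0ℤ
      row ρ′ p = trans (cong (δ ρ′ * d +_) (trans
        (∑-support uimage ucols (map-⊆ m) λ {c} _ c∉ → *-zero-cong (L ρ′ c) (g-supp c∉))
        (sym (∑-map just image _)))) (RC.solves s (∈-map⁺ equation p))
      d≢0 : d ≢ 0ℤ
      d≢0 d≡0 = proj₂ (proj₂ (RC.witness s)) (all-zero (proj₁ (RC.witness s)))
        where
        all-zero : ∀ x → RC.value s x ≡ 0ℤ
        all-zero nothing = d≡0
        all-zero (just c) = ns g g-supp (λ {ρ′} p → trans (sym (+-identityˡ _))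
          (trans (cong (_+ ∑ cols (λ c → L ρ′ c * g c)) (sym (*-zero-cong (δ ρ′) d≡0))) (row ρ′ p))) c
      inverse : ∀ (y : R → ℤ) → y ρ * d + ∑ cols (λ c → g c * ∑ rs (λ ρ′ → L ρ′ c * y ρ′)) ≡ 0ℤ
      inverse y = trans (cong₂ _+_ (sym first) (sym second))
        (trans (sym (∑-+ rs _ _)) (∑-zero rs λ {ρ′} p → trans (sym (*-distribˡ-+ (y ρ′) _ _))
          (*-zero-cong (y ρ′) (row ρ′ p))))
        where
        first : ∑ rs (λ ρ′ → y ρ′ * (δ ρ′ * d)) ≡ y ρ * d
        first = trans (∑-single u ρ∈ λ {ρ′} _ ≢ρ → *-zero-cong (y ρ′) (zero-*-cong d
            (R.merge-∉ [ ρ ] (λ _ → 1ℤ) (λ _ → 0ℤ) λ { (here eq) → ≢ρ eq })))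
          (cong (y ρ *_) (trans (cong (_* d) (R.merge-∈ [ ρ ] (λ _ → 1ℤ) (λ _ → 0ℤ) (here refl))) (*-identityˡ d)))
        second : ∑ rs (λ ρ′ → y ρ′ * ∑ cols (λ c → L ρ′ c * g c)) ≡
                 ∑ cols (λ c → g c * ∑ rs (λ ρ′ → L ρ′ c * y ρ′))
        second = trans (∑-cong rs λ {ρ′} _ → sym (∑-* cols (y ρ′) _)) (trans (∑-swap rs cols _)
          (∑-cong cols λ {c} _ → trans (∑-cong rs λ {ρ′} _ → *-rotate (y ρ′) (L ρ′ c) (g c)) (∑-* rs (g c) _)))

    -- The identity `inverse` recovers `y ρ`, up to the factor `d`, from the products of `y` with
    -- the columns in `image`.
    left-nonsingular : (y : R → ℤ) → (∀ {c} → c ∈ image → ∑ rs (λ ρ → L ρ c * y ρ) ≡ 0ℤ) →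
                       ∀ {ρ} → ρ ∈ rs → y ρ ≡ 0ℤ
    left-nonsingular y h {ρ} ρ∈ = *-cancel-0 d≢0 (trans (*-comm d (y ρ)) (trans
      (sym (trans (cong (y ρ * d +_) (∑-zero cols λ {c} _ → vanish c (c ∈? image))) (+-identityʳ _))) (inverse y)))
      where
      open RightInverse (right-inverse ρ∈)
      vanish : ∀ c → Dec (c ∈ image) → g c * ∑ rs (λ ρ′ → L ρ′ c * y ρ′) ≡ 0ℤ
      vanish c (yes p) = *-zero-cong (g c) (h p)
      vanish c (no p) = zero-*-cong _ (g-supp p)

    record Coordinates (c : C) : Set where
      field
        d           : ℤ
        h           : C → ℤ
        d≢0         : d ≢ 0ℤ
        coordinates : (z : C → ℤ) → (∀ {ρ} → ρ ∈ rs → ∑ cols (λ c → L ρ c * z c) ≡ 0ℤ) →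
                      z c * d ≡ ∑ (cols ∖ image) (λ t → h t * z t)

    -- Some combination of the rows `rs` agrees on `image` with `- d` times the unit vector at `c`.
    -- Pairing it with a kernel vector leaves only entries at columns outside `image`.
    coordinates : ∀ {c} → c ∈ cols → Coordinates c
    coordinates {c} c∈ = record { d = d ; h = h ; d≢0 = d≢0 ; coordinates = coords }
      where
      δ : C → ℤ
      δ = merge [ c ] (λ _ → 1ℤ) (λ _ → 0ℤ)
      equation : C → Maybe R → ℤ
      equation c′ nothing = δ c′
      equation c′ (just ρ) = L ρ c′
      s : CR.Solution (nothing ∷ map just rs) (map equation image)
      s = CR.dependence (map equation image) (unknowns u)
        (s≤s (≤-reflexive (trans (length-map equation image)
          (trans (length-map f rs) (sym (length-map just rs))))))
      d : ℤ
      d = CR.value s nothing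
      y : R → ℤ
      y ρ = CR.value s (just ρ)
      h : C → ℤ
      h c′ = δ c′ * d + ∑ rs (λ ρ → L ρ c′ * y ρ)
      column : ∀ {c′} → c′ ∈ image → h c′ ≡ 0ℤ
      column {c′} p = trans (cong (δ c′ * d +_) (sym (∑-map just rs _))) (CR.solves s (∈-map⁺ equation p))
      y-supp : ∀ {ρ} → ρ ∉ rs → y ρ ≡ 0ℤ
      y-supp ρ∉ = CR.support s λ { (there p) → case ∈-map⁻ just p of λ { (_ , q , refl) → ρ∉ q } }
      d≢0 : d ≢ 0ℤ
      d≢0 d≡0 with CR.witness s
      ... | nothing , _ , ≢0 = ≢0 d≡0
      ... | just ρ , p , ≢0 with ρ R.∈? rs
      ...   | no ρ∉ = ≢0 (y-supp ρ∉)
      ...   | yes ρ∈ = ≢0 (left-nonsingular y (λ {c′} q → trans (sym (trans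
                (cong (_+ ∑ rs (λ ρ → L ρ c′ * y ρ)) (*-zero-cong (δ c′) d≡0)) (+-identityˡ _))) (column q)) ρ∈)
      coords : (z : C → ℤ) → (∀ {ρ} → ρ ∈ rs → ∑ cols (λ c → L ρ c * z c) ≡ 0ℤ) →
               z c * d ≡ ∑ (cols ∖ image) (λ t → h t * z t)
      coords z sol = trans (sym total) (∑-support (∖-unique image ucols) ucols (∖-⊆ cols image)
        λ {c′} p q → zero-*-cong (z c′) (column (decidable-stable (c′ ∈? image) λ ¬p → q (∈-∖⁺ p ¬p))))
        where
        total : ∑ cols (λ t → h t * z t) ≡ z c * d
        total = trans (∑-cong cols λ {t} _ → *-distribʳ-+ (z t) (δ t * d) _) (trans (∑-+ cols _ _)
          (trans (cong₂ _+_ first second) (+-identityʳ _)))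
          where
          first : ∑ cols (λ t → (δ t * d) * z t) ≡ z c * d
          first = trans (∑-single ucols c∈ λ {t} _ t≢ → zero-*-cong (z t) (zero-*-cong d
              (merge-∉ [ c ] (λ _ → 1ℤ) (λ _ → 0ℤ) λ { (here eq) → t≢ eq })))
            (trans (cong (λ x → (x * d) * z c) (merge-∈ [ c ] (λ _ → 1ℤ) (λ _ → 0ℤ) (here refl)))
              (trans (cong (_* z c) (*-identityˡ d)) (*-comm d (z c))))
          second : ∑ cols (λ t → ∑ rs (λ ρ → L ρ t * y ρ) * z t) ≡ 0ℤ
          second = trans (∑-cong cols λ {t} _ → trans (*-comm _ (z t)) (trans (sym (∑-* rs (z t) _))
              (∑-cong rs λ {ρ} _ → *-rotate (z t) (L ρ t) (y ρ))))
            (trans (∑-swap cols rs _) (∑-zero rs λ {ρ} p → trans (∑-* cols (y ρ) _) (*-zero-cong (y ρ) (sol p))))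

-- Bypassing a vertex, and the certificate that this enlarges the matroid.

module Bypass {R C : Set} (_≟R_ : DecidableEquality R) (_≟C_ : DecidableEquality C) where

  open Sums
  open Scalars
  open FiniteSet _≟C_
  private module R = FiniteSet _≟R_
  open Bipartite _≟R_ _≟C_
  open Matchability _≟R_ _≟C_
  open GenericMatrix _≟R_ _≟C_
  open Generic
  open Duality _≟R_ _≟C_
  private
    module RowDependence = LinearDependence _≟R_
    module ColDependence = LinearDependence _≟C_

  -- In the digraph, vertex v (row i, column v) is deleted and each passage u → v → w becomes an arc u → w.
  bypass : (R → C → Set) → R → C → R → C → Set
  bypass N i v ρ c = N ρ c ⊎ (N ρ v × N i c)

  -- If another row is matched to `v`, it takes over the column `f i` of the deleted row, which is
  -- an edge of the bypass.
  bypass-matchable : ∀ {N : R → C → Set} {rows cs i v} → i ∈ rows →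
                     Matchable N rows cs → Matchable (bypass N i v) (rows R.∖ [ i ]) (cs ∖ [ v ])
  bypass-matchable {N} {rows} {cs} {i} {v} i∈ (f , m) with v ∈? map f (rows R.∖ [ i ])
  ... | no v∉ = f , record
    { edge = inj₁ ∘ edge m ∘ R.∖-⊆ rows [ i ]
    ; into = λ p → ∈-∖⁺ (into m (R.∖-⊆ rows [ i ] p)) λ { (here eq) → v∉ (subst (_∈ _) eq (∈-map⁺ f p)) }
    ; injective = injectiveOn-⊆ (R.∖-⊆ rows [ i ]) (injective m) }
  ... | yes v∈ with k , k∈ , refl ← ∈-map⁻ f v∈ = h , record
    { edge = λ {ρ} p → edge′ p (ρ ≟R k)
    ; into = λ {ρ} p → into′ p (ρ ≟R k)
    ; injective = λ {ρ} {ρ′} p p′ → injective′ p p′ (ρ ≟R k) (ρ′ ≟R k) }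
    where
    others = rows R.∖ [ i ]
    h : R → C
    h = R.merge [ k ] (λ _ → f i) f
    hk : h k ≡ f i
    hk = R.merge-∈ [ k ] (λ _ → f i) f (here refl)
    h-other : ∀ {ρ} → ρ ≢ k → h ρ ≡ f ρ
    h-other ρ≢k = R.merge-∉ [ k ] (λ _ → f i) f λ { (here eq) → ρ≢k eq }
    others⊆ : others ⊆ rows
    others⊆ = R.∖-⊆ rows [ i ]
    i≢ : ∀ {ρ} → ρ ∈ others → f ρ ≢ f i
    i≢ p eq = proj₂ (R.∈-∖⁻ rows {[ i ]} p) (here (injective m (others⊆ p) i∈ eq))
    edge′ : ∀ {ρ} → ρ ∈ others → Dec (ρ ≡ k) → bypass N i (f k) ρ (h ρ)
    edge′ p (yes refl) = inj₂ (edge m (others⊆ p) , subst (N i) (sym hk) (edge m i∈))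
    edge′ p (no ρ≢k) = inj₁ (subst (N _) (sym (h-other ρ≢k)) (edge m (others⊆ p)))
    into′ : ∀ {ρ} → ρ ∈ others → Dec (ρ ≡ k) → h ρ ∈ cs ∖ [ f k ]
    into′ p (yes refl) = subst (_∈ _) (sym hk) (∈-∖⁺ (into m i∈) λ { (here eq) → i≢ p (sym eq) })
    into′ p (no ρ≢k) = subst (_∈ _) (sym (h-other ρ≢k)) (∈-∖⁺ (into m (others⊆ p))
      λ { (here eq) → ρ≢k (injective m (others⊆ p) (others⊆ k∈) eq) })
    injective′ : ∀ {ρ ρ′} → ρ ∈ others → ρ′ ∈ others → Dec (ρ ≡ k) → Dec (ρ′ ≡ k) → h ρ ≡ h ρ′ → ρ ≡ ρ′
    injective′ p p′ (yes refl) (yes refl) eq = refl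
    injective′ p p′ (yes refl) (no ρ′≢k) eq = contradiction (trans (sym (h-other ρ′≢k)) (trans (sym eq) hk)) (i≢ p′)
    injective′ p p′ (no ρ≢k) (yes refl) eq = contradiction (trans (sym (h-other ρ≢k)) (trans eq hk)) (i≢ p)
    injective′ p p′ (no ρ≢k) (no ρ′≢k) eq =
      injective m (others⊆ p) (others⊆ p′) (trans (sym (h-other ρ≢k)) (trans eq (h-other ρ′≢k)))

  -- The cut separates the support of y from the support of z; it is a vertex cut of the digraph through i.
  record Witness {N : R → C → Set} {rows cols} (L : Generic N rows cols) (m₀ : R → C) (P : List C) (r : ℕ) (i : R) : Set where
    field
      y      : R → ℤ
      z      : C → ℤ
      y-left : ∀ {c} → c ∈ cols → c ∉ P → ∑ rows (λ ρ → entry L ρ c * y ρ) ≡ 0ℤ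
      z-right : ∀ {ρ} → ρ ∈ rows → ∑ cols (λ c → entry L ρ c * z c) ≡ 0ℤ
      j      : R
      j∈     : j ∈ rows
      edge-j : N j (m₀ i)
      y≢0    : y j ≢ 0ℤ
      w      : C
      w∈     : w ∈ cols
      edge-w : N i w
      z≢0    : z w ≢ 0ℤ
      cut    : List R
      i∈cut  : i ∈ cut
      cut-≤  : length cut ≤ r
      separates : ∀ {k j w} → k ∈ rows → m₀ k ∉ P → N j (m₀ k) → N k w → y j ≢ 0ℤ → z w ≢ 0ℤ → k ∈ cut

  -- The set that becomes independent is taken with all but one element `x` already independent, so
  -- that a single row lacks a column and a Hall violator of deficiency one arises.
  module _ {N : R → C → Set} (N? : ∀ ρ c → Dec (N ρ c)) {rows cols} (urows : Unique rows) (ucols : Unique cols)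
           {m₀} (M₀ : Matching N rows cols m₀) {P : List C} {r} (size : length cols ≡ length rows ℕ.+ r)
           (G : Generic N rows cols)
           {i} (i∈ : i ∈ rows) (v∉P : m₀ i ∉ P)
           {x : C} {X : List C} (X⊆P : x ∷ X ⊆ P)
           {μ} (M : Matching N rows (cols ∖ X) μ)
           {μ′} (M′ : Matching (bypass N i (m₀ i)) (rows R.∖ [ i ]) ((cols ∖ (x ∷ X)) ∖ [ m₀ i ]) μ′)
           (unmatchable : ¬ Matchable N rows (cols ∖ (x ∷ X))) where

    private
      v : C
      v = m₀ i
      L : R → C → ℤ
      L = entry G
      allowed : List C
      allowed = cols ∖ (x ∷ X)

      v∈allowed : v ∈ allowed
      v∈allowed = ∈-∖⁺ (into M₀ i∈) (v∉P ∘ X⊆P)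

      allowed⊆cols : allowed ⊆ cols
      allowed⊆cols = ∖-⊆ cols (x ∷ X)

      P-allowed : ∀ {c} → c ∈ cols → c ∉ P → c ∈ allowed
      P-allowed c∈ c∉ = ∈-∖⁺ c∈ (c∉ ∘ X⊆P)

      μ-allowed : ∀ {ρ} → ρ ∈ rows → μ ρ ≢ x → μ ρ ∈ allowed
      μ-allowed p μ≢x = ∈-∖⁺ (∖-⊆ cols X (into M p))
        λ { (here eq) → μ≢x eq ; (there q) → proj₂ (∈-∖⁻ cols {X} (into M p)) q }

      opaque
        x∈μ : x ∈ map μ rows
        x∈μ = decidable-stable (x ∈? map μ rows) λ x∉ → unmatchable (μ , record
          { edge = edge M ; injective = injective M
          ; into = λ p → μ-allowed p λ eq → x∉ (subst (_∈ map μ rows) eq (∈-map⁺ μ p)) })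

      ρ₀ : R
      ρ₀ = proj₁ (∈-map⁻ μ x∈μ)
      ρ₀∈ : ρ₀ ∈ rows
      ρ₀∈ = proj₁ (proj₂ (∈-map⁻ μ x∈μ))
      μρ₀≡x : μ ρ₀ ≡ x
      μρ₀≡x = sym (proj₂ (proj₂ (∈-map⁻ μ x∈μ)))

      opaque
        rest : List R
        rest = proj₁ (∈⇒↭ ρ₀∈)
        rows↭ : rows ↭ ρ₀ ∷ rest
        rows↭ = proj₂ (∈⇒↭ ρ₀∈)
      urest : Unique (ρ₀ ∷ rest)
      urest = unique-resp-↭ rows↭ urows
      rest⊆ : rest ⊆ rows
      rest⊆ = ∈-resp-↭ (↭-sym rows↭) ∘ there
      Mrest : Matching N rest allowed μ
      Mrest = record
        { edge = edge M ∘ rest⊆ ; injective = injectiveOn-⊆ rest⊆ (injective M)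
        ; into = λ p → μ-allowed (rest⊆ p) λ eq → ∉-∷ urest
            (subst (_∈ rest) (injective M (rest⊆ p) ρ₀∈ (trans eq (sym μρ₀≡x))) p) }

      opaque
        block : Blocked N (N ρ₀) rest allowed allowed μ
        block with augment N? (N? ρ₀) (unique-tail urest) Mrest
        ... | inj₂ b = b
        ... | inj₁ (c , g , e , c∈ , m) = ⊥-elim (unmatchable (_ , matching-cons e c∈ (∈-resp-↭ rows↭) m))
      open Blocked block

      -- A Hall violator: the allowed neighbours of `J` lie in `K`, which has one element less than
      -- `J`.
      J : List R
      J = ρ₀ ∷ S
      K : List C
      K = map μ S
      |K| : length K ≡ length S
      |K| = length-map μ S

      whole : rows ↭ J ++ S′
      whole = ↭-trans rows↭ (prep ρ₀ split)
      parts : Unique J × Unique S′ × Disjoint J S′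
      parts = unique-++⁻ J (unique-resp-↭ whole urows)
      uJ = proj₁ parts
      uS′ = proj₁ (proj₂ parts)
      J⊆ : J ⊆ rows
      J⊆ = ∈-resp-↭ (↭-sym whole) ∘ ∈-++⁺ˡ
      S⊆rest : S ⊆ rest
      S⊆rest = ∈-resp-↭ (↭-sym split) ∘ ∈-++⁺ˡ
      S′⊆rest : S′ ⊆ rest
      S′⊆rest = ∈-resp-↭ (↭-sym split) ∘ ∈-++⁺ʳ S
      S′⊆ : S′ ⊆ rows
      S′⊆ = rest⊆ ∘ S′⊆rest

      J-closed : ∀ {ρ c} → ρ ∈ J → c ∈ allowed → N ρ c → c ∈ K
      J-closed (here refl) p e = closed₀ p p e
      J-closed (there q) p e = closed q p e

      -- After the bypass, the rows of J⁺ other than i would be matched into K⁺ without v.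
      crowded : ∀ {J⁺ K⁺} → Unique J⁺ → J⁺ ⊆ rows → i ∈ J⁺ → v ∈ K⁺ →
                (∀ {ρ c} → ρ ∈ J⁺ → c ∈ allowed → N ρ c → c ∈ K⁺) → length K⁺ < length J⁺ → ⊥
      crowded {J⁺} {K⁺} u sub i∈J⁺ v∈K⁺ cl lt = pigeonhole (R.∖-unique [ i ] u)
        (matching-⊆ (R.∖-mono J⁺ [ i ] sub id) id M′)
        (λ {ρ} p → let q = into M′ (R.∖-mono J⁺ [ i ] sub id p)
                       p′ = R.∖-⊆ J⁺ [ i ] p
                       q′ = ∖-⊆ allowed [ v ] q
          in ∈-∖⁺ ([ cl p′ q′ , cl i∈J⁺ q′ ∘ proj₂ ]′ (edge M′ (R.∖-mono J⁺ [ i ] sub id p)))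
                  (proj₂ (∈-∖⁻ allowed {[ v ]} q)))
        (≤-trans (filter-notAll (_∉? [ v ]) K⁺ (lose v∈K⁺ λ h → h (here refl)))
          (≤-pred (subst (suc (length K⁺) ≤_) (sym (R.∖-length₁ u i∈J⁺)) lt)))

      -- Were `i` in `J`, its column `v` would lie in `K`, and the bypass would match the other rows
      -- of `J` into `K` without `v`, still one column too few.
      i∉J : i ∉ J
      i∉J p = crowded uJ J⊆ p (J-closed p v∈allowed (edge M₀ i∈)) J-closed (s≤s (≤-reflexive |K|))
      i∈S′ : i ∈ S′
      i∈S′ with ∈-++⁻ J (∈-resp-↭ whole i∈)
      ... | inj₁ p = contradiction p i∉J
      ... | inj₂ p = p

      columns : List (R → ℤ)
      columns = map (L ᵀ) K
      opaque
        s : RowDependence.Solution J columns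
        s = RowDependence.dependence columns uJ (s≤s (≤-reflexive (trans (length-map (L ᵀ) K) |K|)))
      -- The vector `y` exists since `K` has fewer columns than `J` has rows. On allowed columns
      -- outside `K` the rows of `J` have only zero entries, so orthogonality to `K` extends to all
      -- allowed columns.
      y : R → ℤ
      y = RowDependence.value s
      y-supp : ∀ {ρ} → y ρ ≢ 0ℤ → ρ ∈ J
      y-supp {ρ} ≢0 = decidable-stable (ρ R.∈? J) λ p → ≢0 (RowDependence.support s p)
      y-allowed : ∀ {c} → c ∈ allowed → ∑ rows (λ ρ → L ρ c * y ρ) ≡ 0ℤ
      y-allowed {c} p = trans (∑-support uJ urows J⊆ λ {ρ} _ q → *-zero-cong (L ρ c) (RowDependence.support s q))
        (on-J (c ∈? K))
        where
        on-J : Dec (c ∈ K) → ∑ J (λ ρ → L ρ c * y ρ) ≡ 0ℤ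
        on-J (yes q) = RowDependence.solves s (∈-map⁺ (L ᵀ) q)
        on-J (no q) = ∑-zero J λ {ρ} r → zero-*-cong (y ρ) (zero-entry G (q ∘ J-closed r p))

      opaque
        -- If no row in the support of `y` were joined to `v`, the bypass would match that support
        -- by original edges, and the nonsingular submatrix on these would force `y` to vanish.
        link : ∃[ j ] j ∈ J × N j v × y j ≢ 0ℤ
        link with any? (λ ρ → N? ρ v ×-dec ¬? (y ρ ≟0)) J
        ... | yes found = find found
        ... | no none = ⊥-elim (proj₂ (proj₂ (RowDependence.witness s))
                (left-nonsingular ucols uJ₀ M₂ ns y vanish
                  (∈-filter⁺ y≢0? (proj₁ (proj₂ (RowDependence.witness s))) (proj₂ (proj₂ (RowDependence.witness s))))))
          where
          y≢0? : ∀ ρ → Dec (y ρ ≢ 0ℤ)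
          y≢0? ρ = ¬? (y ρ ≟0)
          J₀ : List R
          J₀ = filter y≢0? J
          uJ₀ : Unique J₀
          uJ₀ = Unique.filter⁺ y≢0? uJ
          J₀⊆ : J₀ ⊆ J
          J₀⊆ p = proj₁ (∈-filter⁻ y≢0? {xs = J} p)
          J₀⊆′ : J₀ ⊆ rows R.∖ [ i ]
          J₀⊆′ p = R.∈-∖⁺ (J⊆ (J₀⊆ p)) λ { (here refl) → i∉J (J₀⊆ p) }
          M₁ : Matching N J₀ allowed μ′
          M₁ = record
            { edge = λ p → [ id , (λ (e , _) → ⊥-elim (none (lose (J₀⊆ p)
                       (e , proj₂ (∈-filter⁻ y≢0? {xs = J} p))))) ]′ (edge M′ (J₀⊆′ p))
            ; into = λ p → ∖-⊆ allowed [ v ] (into M′ (J₀⊆′ p))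
            ; injective = injectiveOn-⊆ J₀⊆′ (injective M′) }
          M₂ : Matching N J₀ cols μ′
          M₂ = matching-⊆ id allowed⊆cols M₁
          ns : Nonsingular L cols J₀ μ′
          ns = nonsingular G (J⊆ ∘ J₀⊆) uJ₀ M₂
          vanish : ∀ {c} → c ∈ map μ′ J₀ → ∑ J₀ (λ ρ → L ρ c * y ρ) ≡ 0ℤ
          vanish {c} p = trans (sym (∑-support uJ₀ urows (J⊆ ∘ J₀⊆) λ {ρ} _ q → *-zero-cong (L ρ c)
              (decidable-stable (y ρ ≟0) λ ≢0 → q (∈-filter⁺ y≢0? (y-supp ≢0) ≢0))))
            (y-allowed (map-⊆ M₁ p))

      v∈K : v ∈ K
      v∈K = J-closed (proj₁ (proj₂ link)) v∈allowed (proj₁ (proj₂ (proj₂ link)))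

      Q : List C
      Q = allowed ∖ K
      MS′ : Matching N S′ Q μ
      MS′ = record
        { edge = edge M ∘ S′⊆ ; injective = injectiveOn-⊆ S′⊆ (injective M)
        ; into = λ p → ∈-∖⁺ (into Mrest (S′⊆rest p)) λ q → proj₂ (proj₂ parts)
            (there (∈-map-injectiveOn (injective M) (J⊆ ∘ there) (S′⊆ p) q) , p) }

      opaque
        -- A second copy of row `i` asks for a column of `Q`. A set `S₂` blocking it would contain
        -- `i`, and `J ++ S₂` would be a Hall violator with `i` among its rows and `v` among its
        -- columns, which `crowded` excludes.
        exit : Augmented N (N i) S′ Q
        exit with augment N? (N? i) uS′ MS′
        ... | inj₁ a = a
        ... | inj₂ (blocked S₂ S₃ split₂ cl₀ cl) = ⊥-elim (crowded
                uJ⁺ J⁺⊆ (∈-++⁺ʳ J i∈S₂) (∈-++⁺ˡ v∈K) cl⁺ lt)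
          where
          S₂⊆ : S₂ ⊆ S′
          S₂⊆ = ∈-resp-↭ (↭-sym split₂) ∘ ∈-++⁺ˡ
          uJ⁺ : Unique (J ++ S₂)
          uJ⁺ = Unique.++⁺ uJ (proj₁ (unique-++⁻ S₂ (unique-resp-↭ split₂ uS′)))
            λ (p , q) → proj₂ (proj₂ parts) (p , S₂⊆ q)
          J⁺⊆ : J ++ S₂ ⊆ rows
          J⁺⊆ p with ∈-++⁻ J p
          ... | inj₁ q = J⊆ q
          ... | inj₂ q = S′⊆ (S₂⊆ q)
          i∈S₂ : i ∈ S₂
          i∈S₂ = ∈-map-injectiveOn (injective MS′) S₂⊆ i∈S′ (cl₀ (into MS′ i∈S′) (into MS′ i∈S′) (edge MS′ i∈S′))
          cl⁺ : ∀ {ρ c} → ρ ∈ J ++ S₂ → c ∈ allowed → N ρ c → c ∈ K ++ map μ S₂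
          cl⁺ {ρ} {c} p q e with ∈-++⁻ J p | c ∈? K
          ... | inj₁ p′ | _ = ∈-++⁺ˡ (J-closed p′ q e)
          ... | inj₂ p′ | yes r = ∈-++⁺ˡ r
          ... | inj₂ p′ | no r = ∈-++⁺ʳ K (cl p′ (∈-∖⁺ q r) e)
          lt : length (K ++ map μ S₂) < length (J ++ S₂)
          lt = ≤-reflexive (cong suc (trans (length-++ K)
            (trans (cong₂ ℕ._+_ |K| (length-map μ S₂)) (sym (length-++ S)))))

      w : C
      w = proj₁ exit
      g : R → C
      g = proj₁ (proj₂ exit)
      w∈Q : w ∈ Q
      w∈Q = proj₁ (proj₂ (proj₂ (proj₂ exit)))
      Mg : Matching N S′ (Q ∖ [ w ]) g
      Mg = proj₂ (proj₂ (proj₂ (proj₂ exit)))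
      unknowns : List C
      unknowns = w ∷ map g S′
      uunknowns : Unique unknowns
      uunknowns = ∷-unique (λ p → proj₂ (∈-∖⁻ Q {[ w ]} (map-⊆ Mg p)) (here refl)) (map-unique (injective Mg) uS′)
      unknowns⊆ : unknowns ⊆ Q
      unknowns⊆ (here refl) = w∈Q
      unknowns⊆ (there p) = ∖-⊆ Q [ w ] (map-⊆ Mg p)
      Q⊆cols : Q ⊆ cols
      Q⊆cols = allowed⊆cols ∘ ∖-⊆ allowed K
      opaque
        t : ColDependence.Solution unknowns (map L S′)
        t = ColDependence.dependence (map L S′) uunknowns
          (s≤s (≤-reflexive (trans (length-map L S′) (sym (length-map g S′)))))
      -- There is one column more in `unknowns` than there are rows in `S′`, which gives `z`. It
      -- cannot vanish at `w`, because the rows `S′` are nonsingular on `map g S′`.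
      z : C → ℤ
      z = ColDependence.value t
      z-supp : ∀ {c} → z c ≢ 0ℤ → c ∈ Q
      z-supp {c} ≢0 = unknowns⊆ (decidable-stable (c ∈? unknowns) λ p → ≢0 (ColDependence.support t p))
      z-S′ : ∀ {ρ} → ρ ∈ S′ → ∑ cols (λ c → L ρ c * z c) ≡ 0ℤ
      z-S′ {ρ} p = trans (∑-support uunknowns ucols (Q⊆cols ∘ unknowns⊆)
          λ {c} _ q → *-zero-cong (L ρ c) (ColDependence.support t q))
        (ColDependence.solves t (∈-map⁺ L p))
      z≢0 : z w ≢ 0ℤ
      z≢0 eq = proj₂ (proj₂ (ColDependence.witness t)) (nonsingular G S′⊆ uS′
        (matching-⊆ id (Q⊆cols ∘ ∖-⊆ Q [ w ]) Mg) z supp z-S′ (proj₁ (ColDependence.witness t)))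
        where
        supp : ∀ {c} → c ∉ map g S′ → z c ≡ 0ℤ
        supp {c} q with c ≟C w
        ... | yes refl = eq
        ... | no c≢w = ColDependence.support t λ { (here eq) → c≢w eq ; (there p) → q p }
      Q-K : ∀ {ρ c} → ρ ∈ J → c ∈ Q → ¬ N ρ c
      Q-K p q e = proj₂ (∈-∖⁻ allowed {K} q) (J-closed p (∖-⊆ allowed K q) e)
      z-right : ∀ {ρ} → ρ ∈ rows → ∑ cols (λ c → L ρ c * z c) ≡ 0ℤ
      z-right {ρ} p with ∈-++⁻ J (∈-resp-↭ whole p)
      ... | inj₂ q = z-S′ q
      ... | inj₁ q = ∑-zero cols λ {c} _ → entry-zero c (z c ≟0)
        where
        entry-zero : ∀ c → Dec (z c ≡ 0ℤ) → L ρ c * z c ≡ 0ℤ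
        entry-zero c (yes eq) = *-zero-cong (L ρ c) eq
        entry-zero c (no ≢0) = zero-*-cong (z c) (zero-entry G (Q-K q (z-supp ≢0)))

      -- A vertex of the digraph is a row `k` together with its column `m₀ k`. It lies on the cut if
      -- its column is on the side of `J` and its row on the side of `S′`.
      cut? : ∀ k → Dec (m₀ k ∈ K × k ∉ J)
      cut? k = (m₀ k ∈? K) ×-dec (k R.∉? J)
      cut : List R
      cut = filter cut? rows
      in-cut : ∀ {k} → k ∈ cut → k ∈ rows × m₀ k ∈ K × k ∉ J
      in-cut = ∈-filter⁻ cut? {xs = rows}
      opaque
        -- The images of `cut ++ J` under `m₀` and of `S′` under `μ` are disjoint: as many columns
        -- as `cut` and `rows` have elements together, out of only `r` more than there are rows.
        cut-≤ : length cut ≤ r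
        cut-≤ = +-cancelʳ-≤ (length rows) (length cut) r (≤-trans (≤-reflexive count)
            (≤-trans (⊆-length uall all⊆) (≤-reflexive (trans size (+-comm (length rows) r)))))
          where
          old all : List C
          old = map m₀ (cut ++ J)
          all = old ++ map μ S′
          old⊆ : cut ++ J ⊆ rows
          old⊆ p with ∈-++⁻ cut p
          ... | inj₁ q = proj₁ (in-cut q)
          ... | inj₂ q = J⊆ q
          uold : Unique old
          uold = map-unique (injectiveOn-⊆ old⊆ (injective M₀)) (Unique.++⁺ (Unique.filter⁺ cut? urows) uJ
            λ (p , q) → proj₂ (proj₂ (in-cut p)) q)
          disj : Disjoint old (map μ S′)
          disj (p , q) with k , k∈ , refl ← ∈-map⁻ m₀ p with ∈-++⁻ cut k∈
          ... | inj₁ k∈cut = proj₂ (∈-∖⁻ allowed {K} (map-⊆ MS′ q)) (proj₁ (proj₂ (in-cut k∈cut)))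
          ... | inj₂ k∈J = Q-K k∈J (map-⊆ MS′ q) (edge M₀ (J⊆ k∈J))
          uall : Unique all
          uall = Unique.++⁺ uold (map-unique (injective MS′) uS′) disj
          all⊆ : all ⊆ cols
          all⊆ p with ∈-++⁻ old p
          ... | inj₁ q = map-⊆ (matching-⊆ old⊆ id M₀) q
          ... | inj₂ q = Q⊆cols (map-⊆ MS′ q)
          count : length cut ℕ.+ length rows ≡ length all
          count = begin
            length cut ℕ.+ length rows ≡⟨ cong (length cut ℕ.+_) (trans (↭-length whole) (length-++ J)) ⟩
            length cut ℕ.+ (length J ℕ.+ length S′) ≡⟨ sym (+-assoc (length cut) _ _) ⟩
            length cut ℕ.+ length J ℕ.+ length S′
              ≡⟨ cong₂ ℕ._+_ (sym (trans (length-map m₀ (cut ++ J)) (length-++ cut))) (sym (length-map μ S′)) ⟩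
            length old ℕ.+ length (map μ S′) ≡⟨ sym (length-++ old) ⟩
            length all ∎
            where open ≡-Reasoning

    essential : Witness G m₀ P r i
    essential = record
      { y = y ; z = z
      ; y-left = λ c∈ c∉P → y-allowed (P-allowed c∈ c∉P)
      ; z-right = z-right
      ; j = proj₁ link ; j∈ = J⊆ (proj₁ (proj₂ link))
      ; edge-j = proj₁ (proj₂ (proj₂ link)) ; y≢0 = proj₂ (proj₂ (proj₂ link))
      ; w = w ; w∈ = Q⊆cols w∈Q ; edge-w = proj₁ (proj₂ (proj₂ exit)) ; z≢0 = z≢0
      ; cut = cut
      ; i∈cut = ∈-filter⁺ cut? i∈ (v∈K , i∉J)
      ; cut-≤ = cut-≤
      ; separates = λ k∈ m₀k∉P e e′ y≢0 z≢0 → ∈-filter⁺ cut? k∈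
          ( J-closed (y-supp y≢0) (P-allowed (into M₀ k∈) m₀k∉P) e
          , λ k∈J → Q-K k∈J (z-supp z≢0) e′ ) }

-- The dimension count.

module RankBound {n : ℕ} where

  open Sums
  open Scalars
  open import Data.Integer using (+_)
  open LinearDependence (Fin._≟_ {n})

  private
    ks : List (Fin n)
    ks = allFin n
    uks : Unique ks
    uks = Unique.allFin⁺ n
    q : Fin n → ℤ
    q k = + toℕ k
    q-injective : ∀ {i k} → q i ≡ q k → i ≡ k
    q-injective eq = toℕ-injective (ℤ.+-injective eq)
      where open import Data.Integer.Properties using (+-injective)

    pow : ℤ → ℕ → ℤ
    pow s zero = 1ℤ
    pow s (suc p) = s * pow s p

    vanishing : List (Fin n) → ℤ → ℤ
    vanishing [] s = 1ℤ
    vanishing (k ∷ roots) s = (s + - q k) * vanishing roots s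

    vanishing-∈ : ∀ {roots k} → k ∈ roots → vanishing roots (q k) ≡ 0ℤ
    vanishing-∈ {_ ∷ roots} {k} (here refl) = zero-*-cong _ (+-neg-inverse (q k))
    vanishing-∈ {_ ∷ roots} {k} (there p) = *-zero-cong _ (vanishing-∈ p)

    vanishing-∉ : ∀ {roots k} → k ∉ roots → vanishing roots (q k) ≢ 0ℤ
    vanishing-∉ {[]} _ = 1≢0
    vanishing-∉ {_ ∷ roots} k∉ = *-nonzero (+-neg≢0 (k∉ ∘ here ∘ q-injective)) (vanishing-∉ (k∉ ∘ there))

    -- Expanding the linear factors one at a time reduces the polynomial to monomials of degree
    -- below `r`.
    orthogonal : ∀ {r} (F : Fin n → ℤ) → (∀ p → p < r → ∑ ks (λ k → F k * pow (q k) p) ≡ 0ℤ) →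
                 ∀ roots p → p ℕ.+ length roots < r →
                 ∑ ks (λ k → F k * (pow (q k) p * vanishing roots (q k))) ≡ 0ℤ
    orthogonal {r} F h [] p lt = trans (∑-cong ks λ {k} _ → cong (F k *_) (*-identityʳ (pow (q k) p)))
      (h p (subst (_< r) (ℕ.+-identityʳ p) lt))
    orthogonal {r} F h (ρ ∷ roots) p lt = trans
      (∑-cong ks λ {k} _ → *-root (F k) (pow (q k) p) (q k) (q ρ) (vanishing roots (q k)))
      (trans (∑-+ ks _ _) (+-zero-cong (orthogonal F h roots (suc p) lt′)
        (trans (∑-* ks (- q ρ) _) (*-zero-cong (- q ρ) (orthogonal F h roots p (≤-trans (n≤1+n _) lt′))))))
      where
      lt′ : suc p ℕ.+ length roots < r
      lt′ = subst (_< r) (+-suc p (length roots)) lt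

    combine : ∀ {A : Set} xs (u : Fin n → A → ℤ) (a : A → ℤ) (W : Fin n → ℤ) →
              (∀ {x} → x ∈ xs → ∑ ks (λ k → u k x * W k) ≡ 0ℤ) →
              ∑ ks (λ k → ∑ xs (λ x → u k x * a x) * W k) ≡ 0ℤ
    combine xs u a W h = trans
      (∑-cong ks λ {k} _ → trans (*-comm _ (W k)) (trans (sym (∑-* xs (W k) _))
        (∑-cong xs λ {x} _ → trans (*-comm (W k) _) (*-exchangeˡ (u k x) (a x) (W k)))))
      (trans (∑-swap ks xs _) (∑-zero xs λ {x} p → trans (∑-* ks (a x) _) (*-zero-cong (a x) (h p))))

  module _ {A B : Set} {xs : List A} {ts : List B} {r : ℕ}
           (g : Fin n → A → ℤ) (h : Fin n → B → ℤ) (a : Fin n → A → ℤ) (b : Fin n → B → ℤ) where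

    private
      α β : Fin n → Fin n → ℤ
      α i k = ∑ xs (λ x → g k x * a i x)
      β i k = ∑ ts (λ t → h k t * b i t)

    -- The matrix α i k * β i k * (vanishing polynomial of cut i at k) is diagonal with nonzero diagonal
    -- entries, and it is a product of matrices through a space of dimension |xs| |ts| r.
    rank-bound : (cut : Fin n → List (Fin n)) → (∀ i → length (cut i) < r) → (∀ i → i ∉ cut i) →
                 (∀ i → α i i ≢ 0ℤ) → (∀ i → β i i ≢ 0ℤ) →
                 (∀ {i k} → k ≢ i → α i k ≢ 0ℤ → β i k ≢ 0ℤ → k ∈ cut i) →
                 n ≤ length xs ℕ.* (length ts ℕ.* r)
    -- Too many indices would give coefficients `c`, not all zero, orthogonal to every coordinate
    -- function. Summing `c` against row `i` of the diagonal matrix isolates `c i`.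
    rank-bound cut cut-< i∉cut α≢0 β≢0 sep = ≮⇒≥ λ lt → contradict (dependence equations uks
        (subst₂ _<_ (sym |equations|) (sym (length-tabulate id)) lt))
      where
      equation : A → B × ℕ → Fin n → ℤ
      equation x (t , p) k = g k x * (h k t * pow (q k) p)
      equations : List (Fin n → ℤ)
      equations = cartesianProductWith equation xs (cartesianProduct ts (upTo r))
      |equations| : length equations ≡ length xs ℕ.* (length ts ℕ.* r)
      |equations| = trans (length-cartesianProductWith equation xs _) (cong (length xs ℕ.*_)
        (trans (length-cartesianProductWith _,_ ts (upTo r)) (cong (length ts ℕ.*_) (length-upTo r))))
      contradict : Solution ks equations → ⊥
      contradict s = let i , _ , ≢0 = witness s in ≢0 (coefficient i)
        where
        c : Fin n → ℤ
        c = value s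
        module _ (i : Fin n) where
          π : Fin n → ℤ
          π k = vanishing (cut i) (q k)
          powers : ∀ {x t} → x ∈ xs → t ∈ ts → ∀ p → p < r →
                   ∑ ks (λ k → (h k t * (g k x * c k)) * pow (q k) p) ≡ 0ℤ
          powers {x} {t} x∈ t∈ p lt = trans
            (∑-cong ks λ {k} _ → sym (*-regroup (g k x) (h k t) (pow (q k) p) (c k)))
            (solves s (∈-cartesianProductWith⁺ equation x∈ (∈-cartesianProduct⁺ t∈ (∈-upTo⁺ lt))))
          step₁ : ∀ {x t} → x ∈ xs → t ∈ ts → ∑ ks (λ k → h k t * (g k x * (c k * π k))) ≡ 0ℤ
          step₁ {x} {t} x∈ t∈ = trans
            (∑-cong ks λ {k} _ → sym (*-reassoc (h k t) (g k x) (c k) (π k)))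
            (orthogonal (λ k → h k t * (g k x * c k)) (powers x∈ t∈) (cut i) 0 (cut-< i))
          step₂ : ∀ {x} → x ∈ xs → ∑ ks (λ k → g k x * (β i k * (c k * π k))) ≡ 0ℤ
          step₂ {x} x∈ = trans (∑-cong ks λ {k} _ → *-exchange (g k x) (β i k) (c k * π k))
            (combine ts h (b i) (λ k → g k x * (c k * π k)) (step₁ x∈))
          step₃ : ∑ ks (λ k → α i k * (β i k * (c k * π k))) ≡ 0ℤ
          step₃ = combine xs g (a i) (λ k → β i k * (c k * π k)) step₂
          off-diagonal : ∀ {k} → k ≢ i → α i k * (β i k * (c k * π k)) ≡ 0ℤ
          off-diagonal {k} k≢i with α i k ≟0 | β i k ≟0
          ... | yes eq | _ = zero-*-cong _ eq
          ... | no _ | yes eq = *-zero-cong _ (zero-*-cong _ eq)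
          ... | no α≢ | no β≢ = *-zero-cong _ (*-zero-cong _ (*-zero-cong _ (vanishing-∈ (sep k≢i α≢ β≢))))
          coefficient : c i ≡ 0ℤ
          coefficient = *-cancel-0 (vanishing-∉ (i∉cut i)) (trans (*-comm (π i) (c i))
            (*-cancel-0 (β≢0 i) (*-cancel-0 (α≢0 i)
              (trans (sym (∑-single uks (∈-allFin i) λ _ → off-diagonal)) step₃))))

-- Few rows are essential.

module Irrelevant {R C : Set} (_≟R_ : DecidableEquality R) (_≟C_ : DecidableEquality C) where

  open Sums
  open Scalars
  open FiniteSet _≟C_
  private module R = FiniteSet _≟R_
  open Bipartite _≟R_ _≟C_
  open Matchability _≟R_ _≟C_
  open GenericMatrix _≟R_ _≟C_
  open Generic
  open Duality _≟R_ _≟C_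
  open Bypass _≟R_ _≟C_

  module _ {N : R → C → Set} {rows cols} (urows : Unique rows) (ucols : Unique cols)
           {m₀ : R → C} (M₀ : Matching N rows cols m₀) {P : List C} {r : ℕ}
           (size : length cols ≡ length rows ℕ.+ r) (G : Generic N rows cols) where

    -- Up to nonzero factors, the value of `y i` at the in-neighbour chosen for `k` is linear in the
    -- products of `y i` with the columns in `P`, and the value of `z i` at the out-neighbour chosen
    -- for `k` is linear in its entries at the `r` unmatched columns. These are the two factors in
    -- `rank-bound`.
    witnesses-≤ : ∀ {ks} → Unique ks → ks ⊆ rows → (∀ {k} → k ∈ ks → m₀ k ∉ P) →
                  (∀ {k} → k ∈ ks → Witness G m₀ P r k) → length ks ≤ length P ℕ.* (r ℕ.* r)
    witnesses-≤ {ks} uks ks⊆ ∉P wit = ≤-trans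
      (rank-bound {xs = P∩cols} {ts = T} {r = r} (λ k → g k) (λ k → h k)
        (λ i x → ∑ rows (λ ρ → entry G ρ x * y i ρ)) z cut cut-< i∉cut diag-α diag-β sep)
      (*-mono-≤ (⊆-length uP∩cols P∩cols⊆P) (≤-reflexive (cong (ℕ._* r) |T|)))
      where
      open RankBound {length ks}
      image T P∩cols : List C
      image = map m₀ rows
      T = cols ∖ image
      P∩cols = filter (_∈? P) cols
      uP∩cols : Unique P∩cols
      uP∩cols = Unique.filter⁺ (_∈? P) ucols
      P∩cols⊆P : P∩cols ⊆ P
      P∩cols⊆P p = proj₂ (∈-filter⁻ (_∈? P) {xs = cols} p)
      |T| : length T ≡ r
      |T| = +-cancelˡ-≡ (length rows) (length T) r (trans
        (cong (ℕ._+ length T) (sym (length-map m₀ rows)))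
        (trans (∖-length ucols (map-unique (injective M₀) urows) (map-⊆ M₀)) size))
      κ : Fin (length ks) → R
      κ = lookup ks
      κ∈ : ∀ k → κ k ∈ ks
      κ∈ = ∈-lookup
      module W (k : Fin (length ks)) = Witness (wit (κ∈ k))
      y : Fin (length ks) → R → ℤ
      y = W.y
      z : Fin (length ks) → C → ℤ
      z = W.z
      ns : Nonsingular (entry G) cols rows m₀
      ns = nonsingular G id urows M₀
      module I (k : Fin (length ks)) = RightInverse (right-inverse ucols urows M₀ ns (W.j∈ k))
      module H (k : Fin (length ks)) = Coordinates (coordinates ucols urows M₀ ns (W.w∈ k))
      g h : Fin (length ks) → C → ℤ
      g = I.g
      h = H.h
      α-value : ∀ i k → y i (W.j k) * I.d k +
        ∑ P∩cols (λ x → g k x * ∑ rows (λ ρ → entry G ρ x * y i ρ)) ≡ 0ℤ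
      α-value i k = trans (cong (y i (W.j k) * I.d k +_) (sym (∑-support uP∩cols ucols
          (λ p → proj₁ (∈-filter⁻ (_∈? P) {xs = cols} p))
          λ {c} p q → *-zero-cong (g k c) (W.y-left i p λ c∈P → q (∈-filter⁺ (_∈? P) p c∈P)))))
        (I.inverse k (y i))
      β-value : ∀ i k → z i (W.w k) * H.d k ≡ ∑ T (λ t → h k t * z i t)
      β-value i k = H.coordinates k (z i) (W.z-right i)
      diag-α : ∀ i → ∑ P∩cols (λ x → g i x * ∑ rows (λ ρ → entry G ρ x * y i ρ)) ≢ 0ℤ
      diag-α i eq = *-nonzero (W.y≢0 i) (I.d≢0 i) (trans (sym (trans
        (cong (y i (W.j i) * I.d i +_) eq) (+-identityʳ _))) (α-value i i))
      diag-β : ∀ i → ∑ T (λ t → h i t * z i t) ≢ 0ℤ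
      diag-β i eq = *-nonzero (W.z≢0 i) (H.d≢0 i) (trans (β-value i i) eq)
      -- Leaving `i` itself out makes the number of roots strictly less than `r`.
      cut? : ∀ i k → Dec (κ k ∈ W.cut i × k ≢ i)
      cut? i k = (κ k R.∈? W.cut i) ×-dec ¬? (k Fin.≟ i)
      cut : Fin (length ks) → List (Fin (length ks))
      cut i = filter (cut? i) (allFin _)
      in-cut : ∀ i {k} → k ∈ cut i → κ k ∈ W.cut i × k ≢ i
      in-cut i p = proj₂ (∈-filter⁻ (cut? i) {xs = allFin _} p)
      i∉cut : ∀ i → i ∉ cut i
      i∉cut i p = proj₂ (in-cut i p) refl
      cut-< : ∀ i → length (cut i) < r
      cut-< i = ≤-trans (≤-reflexive (cong suc (sym (length-map κ (cut i))))) (≤-trans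
        (⊆-length (∷-unique κi∉ (map-unique (λ _ _ → lookup-injective uks) (Unique.filter⁺ (cut? i) (Unique.allFin⁺ _))))
          λ { (here refl) → W.i∈cut i
            ; (there p) → case ∈-map⁻ κ p of λ { (_ , k∈ , refl) → proj₁ (in-cut i k∈) } })
        (W.cut-≤ i))
        where
        κi∉ : κ i ∉ map κ (cut i)
        κi∉ p with k , k∈ , eq ← ∈-map⁻ κ p = proj₂ (in-cut i k∈) (sym (lookup-injective uks eq))
      sep : ∀ {i k} → k ≢ i → ∑ P∩cols (λ x → g k x * ∑ rows (λ ρ → entry G ρ x * y i ρ)) ≢ 0ℤ →
            ∑ T (λ t → h k t * z i t) ≢ 0ℤ → k ∈ cut i
      sep {i} {k} k≢i α≢ β≢ = ∈-filter⁺ (cut? i) (∈-allFin k)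
        ( W.separates i (ks⊆ (κ∈ k)) (∉P (κ∈ k)) (W.edge-j k) (W.edge-w k)
            (λ eq → α≢ (trans (sym (+-identityˡ _)) (trans (cong (_+ ∑ P∩cols (λ x → g k x * ∑ rows (λ ρ → entry G ρ x * y i ρ))) (sym (zero-*-cong (I.d k) eq))) (α-value i k))))
            (λ eq → β≢ (trans (sym (β-value i k)) (zero-*-cong (H.d k) eq)))
        , k≢i )

  module _ {N : R → C → Set} (N? : ∀ ρ c → Dec (N ρ c)) {rows cols} (urows : Unique rows) (ucols : Unique cols)
           {m₀ : R → C} (M₀ : Matching N rows cols m₀) {P : List C} {r : ℕ}
           (size : length cols ≡ length rows ℕ.+ r) where

    private
      Free : List C → Set
      Free X = Matchable N rows (cols ∖ X)

      Free? : ∀ X → Dec (Free X)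
      Free? X = matchable? N? m₀ urows (cols ∖ X)

      Free′ : R → List C → Set
      Free′ i X = Matchable (bypass N i (m₀ i)) (rows R.∖ [ i ]) ((cols ∖ X) ∖ [ m₀ i ])

      Free′? : ∀ i X → Dec (Free′ i X)
      Free′? i X = matchable? (λ ρ c → N? ρ c ⊎-dec (N? ρ (m₀ i) ×-dec N? i c)) m₀
        (R.∖-unique [ i ] urows) ((cols ∖ X) ∖ [ m₀ i ])

      free-⊆ : ∀ {X Y} → X ⊆ Y → Free Y → Free X
      free-⊆ {X} {Y} sub (f , m) = f , matching-⊆ id (∖-mono cols Y id sub) m

      free′-⊆ : ∀ {i X Y} → X ⊆ Y → Free′ i Y → Free′ i X
      free′-⊆ {i} {X} {Y} sub (f , m) =
        f , matching-⊆ id (∖-mono (cols ∖ Y) [ m₀ i ] (∖-mono cols Y id sub) id) m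

      -- Elements are dropped from `X` until the rest is free, which happens at the empty set at the
      -- latest; being free after the bypass passes to the smaller sets.
      minimal : ∀ {i} X → X ⊆ P → Free′ i X → ¬ Free X →
                ∃[ x ] ∃[ X′ ] x ∷ X′ ⊆ P × Free X′ × Free′ i (x ∷ X′) × ¬ Free (x ∷ X′)
      minimal [] _ _ ¬f = contradiction (m₀ , matching-⊆ id (λ p → ∈-∖⁺ p λ ()) M₀) ¬f
      minimal (x ∷ X) sub f′ ¬f with Free? X
      ... | yes f = x , X , sub , f , f′ , ¬f
      ... | no ¬fX = minimal X (sub ∘ there) (free′-⊆ there f′) ¬fX

    -- For a row `i` the converse implication is `bypass-matchable`, so bypassing a redundant row
    -- preserves which subsets of `P` are free.
    Redundant : R → Set
    Redundant i = ∀ {X} → X ⊆ P → Free′ i X → Free X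

    -- Both conditions are decidable and depend on `X` only through its members, so `powerset P` can
    -- be searched. If no candidate is redundant, each of them has a `Witness`, and there are too
    -- many.
    redundant : length P ℕ.* (r ℕ.* r) < length (filter (λ k → m₀ k ∉? P) rows) →
                ∃[ i ] i ∈ rows × m₀ i ∉ P × Redundant i
    redundant lt with any? (λ i → All.all? (λ X → Free′? i X →-dec Free? X) (powerset P)) (filter (λ k → m₀ k ∉? P) rows)
    ... | yes found = let i , p , all = find found
                          i∈ , ∉P = ∈-filter⁻ (λ k → m₀ k ∉? P) {xs = rows} p
                      in i , i∈ , ∉P , λ {X} sub f′ →
                        free-⊆ (λ {x} q → ∈-filter⁺ (_∈? X) (sub q) q)
                          (All.lookup all (filter-∈-powerset (_∈? X) P)
                            (free′-⊆ (λ q → proj₂ (∈-filter⁻ (_∈? X) {xs = P} q)) f′))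
    ... | no none = ⊥-elim (<⇒≱ lt (witnesses-≤ urows ucols M₀ size G (Unique.filter⁺ _ urows)
                      (λ p → proj₁ (candidate p)) (λ p → proj₂ (candidate p)) witness))
      where
      G : Generic N rows cols
      G = generic N? ucols urows
      candidate : ∀ {k} → k ∈ filter (λ k → m₀ k ∉? P) rows → k ∈ rows × m₀ k ∉ P
      candidate = ∈-filter⁻ (λ k → m₀ k ∉? P) {xs = rows}
      witness : ∀ {k} → k ∈ filter (λ k → m₀ k ∉? P) rows → Witness G m₀ P r k
      witness {k} p with find (All.¬All⇒Any¬ (λ X → Free′? k X →-dec Free? X) (powerset P) (λ all → none (lose p all)))
      ... | X , X∈ , ¬imp with x , X′ , sub , f , f′ , ¬f ← minimal {k} X (powerset-⊆ P X∈)
              (decidable-stable (Free′? k X) (λ ¬f′ → ¬imp (λ f′ → contradiction f′ ¬f′)))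
              (λ f → ¬imp (λ _ → f)) =
        essential N? urows ucols M₀ size G (proj₁ (candidate p)) (proj₂ (candidate p)) sub
          (proj₂ f) (proj₂ f′) ¬f

-- Routings as matchings.

module Linkage (U : Set) (_≟_ : DecidableEquality U) where

  open Matroids U _≟_
  open FiniteSet _≟_ using (_∈?_; ∈-∖⁺; ∈-∖⁻)
  open Bipartite _≟_ _≟_

  Step : Digraph → U → U → Set
  Step D u v = v ≡ u ⊎ (u , v) ∈ A D

  private
    infix 4 _≟⁺_
    _≟⁺_ : DecidableEquality (List⁺ U)
    (x ∷ xs) ≟⁺ (y ∷ ys) with x ≟ y | List.≡-dec _≟_ xs ys
    ... | yes refl | yes refl = yes refl
    ... | no x≢y | _ = no λ { refl → x≢y refl }
    ... | _ | no xs≢ys = no λ { refl → xs≢ys refl }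

    next : U → List U → U → U
    next x [] u = u
    next x (y ∷ ys) u with u ≟ x
    ... | yes _ = y
    ... | no _ = next y ys u

    next-step : ∀ {E : U → U → Set} x xs {u} → Linked E (x ∷ xs) → u ∈ x ∷ xs → u ≢ List⁺.last (x ∷ xs) →
                E u (next x xs u) × next x xs u ∈ xs
    next-step x [] _ (here refl) ≢last = contradiction refl ≢last
    next-step x (y ∷ ys) {u} (e ∷ es) p ≢last with u ≟ x
    ... | yes refl = e , here refl
    ... | no u≢x with p
    ...   | here u≡x = contradiction u≡x u≢x
    ...   | there q = let e′ , r = next-step y ys es q (λ eq → ≢last (trans eq (sym (last-∷ x y ys))))
                      in e′ , there r

    next-injective : ∀ {E : U → U → Set} x xs → Linked E (x ∷ xs) → Unique (x ∷ xs) →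
                     ∀ {u v} → u ∈ x ∷ xs → v ∈ x ∷ xs → u ≢ List⁺.last (x ∷ xs) → v ≢ List⁺.last (x ∷ xs) →
                     next x xs u ≡ next x xs v → u ≡ v
    next-injective x [] _ _ (here refl) _ ≢last _ _ = contradiction refl ≢last
    next-injective x (y ∷ ys) (e ∷ es) (x∉ ∷ us) {u} {v} p q ≢p ≢q eq with u ≟ x | v ≟ x
    ... | yes refl | yes refl = refl
    ... | no u≢x | no v≢x = next-injective y ys es us (tail p u≢x) (tail q v≢x) (≢last ≢p) (≢last ≢q) eq
      where
      tail : ∀ {u} → u ∈ x ∷ y ∷ ys → u ≢ x → u ∈ y ∷ ys
      tail (here eq) u≢x = contradiction eq u≢x
      tail (there p) _ = p
      ≢last : ∀ {u} → u ≢ List⁺.last (x ∷ y ∷ ys) → u ≢ List⁺.last (y ∷ ys)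
      ≢last ≢ eq = ≢ (trans eq (sym (last-∷ x y ys)))
    ... | yes refl | no v≢x with q
    ...   | here v≡x = contradiction v≡x v≢x
    ...   | there q′ = contradiction (subst (_∈ ys) (sym eq) (proj₂ (next-step y ys es q′
                         λ eq′ → ≢q (trans eq′ (sym (last-∷ x y ys)))))) (∉-∷ us)
    next-injective x (y ∷ ys) (e ∷ es) (x∉ ∷ us) p q ≢p ≢q eq | no u≢x | yes refl with p
    ...   | here u≡x = contradiction u≡x u≢x
    ...   | there p′ = contradiction (subst (_∈ ys) eq (proj₂ (next-step y ys es p′
                         λ eq′ → ≢p (trans eq′ (sym (last-∷ x y ys)))))) (∉-∷ us)

  module _ (D : Digraph) (T : List U) where

    vertices inner : List U
    vertices = deduplicate _≟_ (V D)
    inner = vertices ∖ T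

    private
      ∈vertices : ∀ {u} → u ∈ V D → u ∈ vertices
      ∈vertices = ∈-deduplicate⁺ _≟_
      ∈V : ∀ {u} → u ∈ vertices → u ∈ V D
      ∈V = ∈-deduplicate⁻ _≟_ (V D)

    -- A routing gives the matching that moves every vertex to its successor on its path.
    routing⇒matchable : ∀ {X R} → IsRouting D X T R → Matchable (Step D) inner (vertices ∖ X)
    routing⇒matchable {X} {R} routing = succ R , record
      { edge = λ p → edge′ (locate R _) (inner⁻ p)
      ; into = λ p → into′ (locate R _) (inner⁻ p)
      ; injective = λ p q → injective′ (locate R _) (locate R _) (inner⁻ p) (inner⁻ q) }
      where
      open IsRouting routing
      succ : List (List⁺ U) → U → U
      succ [] u = u
      succ ((x ∷ xs) ∷ ps) u with u ∈? (x ∷ xs)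
      ... | yes _ = next x xs u
      ... | no _ = succ ps u
      data Located (ps : List (List⁺ U)) (u : U) : Set where
        off : (∀ {p} → p ∈ ps → u ∉ List⁺.toList p) → succ ps u ≡ u → Located ps u
        on  : ∀ {x xs} → (x ∷ xs) ∈ ps → u ∈ x ∷ xs → succ ps u ≡ next x xs u → Located ps u
      locate : ∀ ps u → Located ps u
      locate [] u = off (λ ()) refl
      locate ((x ∷ xs) ∷ ps) u with u ∈? (x ∷ xs) in eq
      ... | yes u∈ = on (here refl) u∈ (lemma eq)
        where
        lemma : (u ∈? (x ∷ xs)) ≡ yes u∈ → succ ((x ∷ xs) ∷ ps) u ≡ next x xs u
        lemma eq rewrite eq = refl
      ... | no u∉ with locate ps u
      ...   | off h e = off (λ { (here refl) → u∉ ; (there p) → h p }) (trans (lemma eq) e)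
        where
        lemma : (u ∈? (x ∷ xs)) ≡ no u∉ → succ ((x ∷ xs) ∷ ps) u ≡ succ ps u
        lemma eq rewrite eq = refl
      ...   | on p q e = on (there p) q (trans (lemma eq) e)
        where
        lemma : (u ∈? (x ∷ xs)) ≡ no u∉ → succ ((x ∷ xs) ∷ ps) u ≡ succ ps u
        lemma eq rewrite eq = refl
      inner⁻ : ∀ {u} → u ∈ inner → u ∈ V D × u ∉ T
      inner⁻ p = let q , r = ∈-∖⁻ vertices p in ∈V q , r
      not-last : ∀ {x xs u} → (x ∷ xs) ∈ R → u ∉ T → u ≢ List⁺.last (x ∷ xs)
      not-last p u∉T refl = u∉T (ends p)
      step : ∀ {x xs u} → (x ∷ xs) ∈ R → u ∈ x ∷ xs → u ∉ T → (u , next x xs u) ∈ A D × next x xs u ∈ xs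
      step p u∈ u∉T = next-step _ _ (IsPath.arcs (paths p)) u∈ (not-last p u∉T)
      -- Disjointness is given for distinct paths only; as equality of paths is decidable, two paths
      -- through a common vertex coincide.
      same : ∀ {p q u} → p ∈ R → q ∈ R → u ∈ List⁺.toList p → u ∈ List⁺.toList q → p ≡ q
      same {p} {q} p∈ q∈ u∈p u∈q = decidable-stable (p ≟⁺ q) λ p≢q → disjoint p∈ q∈ p≢q (u∈p , u∈q)
      edge′ : ∀ {u} → Located R u → u ∈ V D × u ∉ T → Step D u (succ R u)
      edge′ (off _ eq) _ = inj₁ eq
      edge′ (on p u∈ eq) (_ , u∉T) rewrite eq = inj₂ (proj₁ (step p u∈ u∉T))
      into′ : ∀ {u} → Located R u → u ∈ V D × u ∉ T → succ R u ∈ vertices ∖ X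
      into′ (off h eq) (u∈V , _) rewrite eq = ∈-∖⁺ (∈vertices u∈V) λ u∈X →
        case starts u∈X of λ { ((_ ∷ _) , p∈ , refl) → h p∈ (here refl) }
      into′ {u} (on {x} {xs} p u∈ eq) (u∈V , u∉T) rewrite eq =
        ∈-∖⁺ (∈vertices (All.lookup (IsPath.vertices (paths p)) (there next∈))) λ ∈X →
          case starts ∈X of λ { ((y ∷ ys) , q∈ , y≡) →
            case same q∈ p (here (sym y≡)) (there next∈) of λ { refl →
              ∉-∷ (IsPath.unique (paths p)) (subst (_∈ xs) (sym y≡) next∈) } }
        where
        next∈ : next x xs u ∈ xs
        next∈ = proj₂ (step p u∈ u∉T)
      injective′ : ∀ {u v} → Located R u → Located R v → u ∈ V D × u ∉ T → v ∈ V D × v ∉ T →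
                   succ R u ≡ succ R v → u ≡ v
      injective′ (off _ e) (off _ e′) _ _ eq = trans (sym e) (trans eq e′)
      injective′ (off h e) (on p v∈ e′) _ (_ , v∉T) eq = ⊥-elim (h p (there (subst (_∈ _)
        (trans (sym e′) (trans (sym eq) e)) (proj₂ (step p v∈ v∉T)))))
      injective′ (on p u∈ e) (off h e′) (_ , u∉T) _ eq = ⊥-elim (h p (there (subst (_∈ _)
        (trans (sym e) (trans eq e′)) (proj₂ (step p u∈ u∉T)))))
      injective′ (on p u∈ e) (on q v∈ e′) (_ , u∉T) (_ , v∉T) eq
        with refl ← same p q (there (proj₂ (step p u∈ u∉T)))
                    (there (subst (_∈ _) (trans (sym e′) (trans (sym eq) e)) (proj₂ (step q v∈ v∉T)))) =
        next-injective _ _ (IsPath.arcs (paths p)) (IsPath.unique (paths p)) u∈ v∈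
          (not-last p u∉T) (not-last p v∉T) (trans (sym e) (trans eq e′))

    -- The paths of the routing are the orbits of the matching, which never return to X.
    matchable⇒routing : ∀ {X} → X ⊆ V D → Matchable (Step D) inner (vertices ∖ X) → ∃ (IsRouting D X T)
    matchable⇒routing {X} X⊆V (g , m) = map path X , record
      { paths = λ p∈ → case ∈-map⁻ path p∈ of λ { (x , x∈ , refl) → record
          { vertices = All.tabulate λ v∈ → case ∈-applyUpTo⁻ (orbit x) v∈ of λ
              { (i , i≤ , refl) → orbit∈V x∈ i (alive-≤ (≤-pred i≤) (alive x)) }
          ; arcs = Linked.applyUpTo⁺₁ (orbit x) (suc (len x)) λ {i} lt →
              orbit-arc x∈ i (alive-≤ (≤-pred lt) (alive x))
          ; unique = Unique.applyUpTo⁺₁ (orbit x) (suc (len x)) λ {i} {j} i<j j< eq →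
              ℕ.<⇒≢ i<j (proj₁ (orbit-injective i j x∈ x∈
                (alive-≤ (≤-trans (ℕ.<⇒≤ i<j) (≤-pred j<)) (alive x))
                (alive-≤ (≤-pred j<) (alive x)) eq)) } }
      ; starts = λ x∈ → path _ , ∈-map⁺ path x∈ , refl
      ; ends = λ p∈ → case ∈-map⁻ path p∈ of λ { (x , x∈ , refl) →
          subst (_∈ T) (sym (last-applyUpTo (orbit x) (len x))) (hits x∈) }
      ; disjoint = λ p∈ q∈ p≢q (v∈p , v∈q) → case ∈-map⁻ path p∈ , ∈-map⁻ path q∈ of λ
          { ((x , x∈ , refl) , (y , y∈ , refl)) →
            case ∈-applyUpTo⁻ (orbit x) v∈p , ∈-applyUpTo⁻ (orbit y) v∈q of λ
              { ((i , i< , eq) , (j , j< , eq′)) → p≢q (cong path (proj₂ (orbit-injective i j x∈ y∈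
                  (alive-≤ (≤-pred i<) (alive x)) (alive-≤ (≤-pred j<) (alive y)) (trans (sym eq) eq′)))) } } }
      where
      orbit : U → ℕ → U
      orbit x zero = x
      orbit x (suc i) = g (orbit x i)
      Alive : U → ℕ → Set
      Alive x n = ∀ i → i < n → orbit x i ∉ T
      alive-≤ : ∀ {x i n} → i ≤ n → Alive x n → Alive x i
      alive-≤ i≤n a j j<i = a j (≤-trans j<i i≤n)
      orbit∈V : ∀ {x} → x ∈ X → ∀ i → Alive x i → orbit x i ∈ V D
      orbit-inner : ∀ {x} → x ∈ X → ∀ i → Alive x (suc i) → orbit x i ∈ inner
      orbit∈V x∈ zero _ = X⊆V x∈
      orbit∈V x∈ (suc i) a = ∈V (proj₁ (∈-∖⁻ vertices (into m (orbit-inner x∈ i a))))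
      orbit-inner x∈ i a = ∈-∖⁺ (∈vertices (orbit∈V x∈ i (alive-≤ (n≤1+n i) a))) (a i ≤-refl)
      orbit-∉X : ∀ {x} → x ∈ X → ∀ i → Alive x (suc i) → orbit x (suc i) ∉ X
      orbit-∉X x∈ i a = proj₂ (∈-∖⁻ vertices (into m (orbit-inner x∈ i a)))
      -- Orbits that meet are traced back in step by injectivity until one of them is at its start.
      -- That start lies in `X`, which the matching avoids, so the other orbit is at its start too.
      orbit-injective : ∀ {x y} i j → x ∈ X → y ∈ X → Alive x i → Alive y j → orbit x i ≡ orbit y j → i ≡ j × x ≡ y
      orbit-injective zero zero _ _ _ _ eq = refl , eq
      orbit-injective zero (suc j) x∈ y∈ _ b eq = contradiction (subst (_∈ X) eq x∈) (orbit-∉X y∈ j b)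
      orbit-injective (suc i) zero x∈ y∈ a _ eq = contradiction (subst (_∈ X) (sym eq) y∈) (orbit-∉X x∈ i a)
      orbit-injective (suc i) (suc j) x∈ y∈ a b eq = let i≡j , x≡y = orbit-injective i j x∈ y∈
                                                           (alive-≤ (n≤1+n i) a) (alive-≤ (n≤1+n j) b)
                                                           (injective m (orbit-inner x∈ i a) (orbit-inner y∈ j b) eq)
                                                     in cong suc i≡j , x≡y
      orbit-arc : ∀ {x} → x ∈ X → ∀ i → Alive x (suc i) → (orbit x i , orbit x (suc i)) ∈ A D
      orbit-arc x∈ i a with edge m (orbit-inner x∈ i a)
      ... | inj₂ arc = arc
      -- A fixed point of the matching would repeat a vertex of the orbit.
      ... | inj₁ eq = contradiction (proj₁ (orbit-injective (suc i) i x∈ x∈ a (alive-≤ (n≤1+n i) a) eq))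
                        ℕ.1+n≢n
      firstHit : ∀ x n → ∃[ k ] Alive x k × (orbit x k ∈ T ⊎ k ≡ n)
      firstHit x zero = zero , (λ _ ()) , inj₂ refl
      firstHit x (suc n) with firstHit x n
      ... | k , a , inj₁ hit = k , a , inj₁ hit
      ... | k , a , inj₂ refl with orbit x k ∈? T
      ...   | yes hit = k , a , inj₁ hit
      ...   | no ¬hit = suc k , (λ i i≤k → case ℕ.m<1+n⇒m<n∨m≡n i≤k of λ
                { (inj₁ i<k) → a i i<k ; (inj₂ refl) → ¬hit }) , inj₂ refl
      -- An orbit that avoids `T` for this many steps would have more distinct vertices than the
      -- digraph.
      fuel = suc (length vertices)
      len : U → ℕ
      len x = proj₁ (firstHit x fuel)
      alive : ∀ x → Alive x (len x)
      alive x = proj₁ (proj₂ (firstHit x fuel))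
      hits : ∀ {x} → x ∈ X → orbit x (len x) ∈ T
      hits {x} x∈ with firstHit x fuel
      ... | k , a , inj₁ hit = hit
      ... | k , a , inj₂ refl = contradiction (⊆-length
              (Unique.applyUpTo⁺₁ (orbit x) fuel λ {i} {j} i<j j< eq → ℕ.<⇒≢ i<j
                (proj₁ (orbit-injective i j x∈ x∈ (alive-≤ (ℕ.<⇒≤ (ℕ.<-trans i<j j<)) a)
                  (alive-≤ (ℕ.<⇒≤ j<) a) eq)))
              λ v∈ → case ∈-applyUpTo⁻ (orbit x) v∈ of λ
                { (i , i< , refl) → ∈vertices (orbit∈V x∈ i (alive-≤ (ℕ.<⇒≤ i<) a)) })
            (<⇒≱ (≤-reflexive (sym (length-applyUpTo (orbit x) fuel))))
      path : U → List⁺ U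
      path x = x ∷ applyUpTo (orbit x ∘ suc) (len x)

-- Gammoids as bipartite models.

module Models (U : Set) (_≟_ : DecidableEquality U) (infinite : Infinite U) where

  open Matroids U _≟_
  open FiniteSet _≟_ using (_∈?_; ∈-∖⁺; ∈-∖⁻; ∖-mono; ∖-⊆; ∖-unique; ∖-length; ∖-length₁; filter-∈-powerset; powerset-⊆)
  open Linkage U _≟_
  open Equivalence using (to; from)

  private module Bip {R : Set} (_≟R_ : DecidableEquality R) where
    open Bipartite _≟R_ _≟_ public
    open Matchability _≟R_ _≟_ public

  -- The independent sets are those which some matching of all the rows avoids. Given D and T, the rows
  -- are the vertices outside T, and row u may be matched to u and to its out-neighbours.
  record Model (S : SetSystem) : Set₁ where
    field
      {R}     : Set
      _≟R_    : DecidableEquality R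
      rows    : List R
      cols    : List U
      N       : R → U → Set
      N?      : ∀ ρ c → Dec (N ρ c)
      urows   : Unique rows
      ucols   : Unique cols
      ground⊆ : ground S ⊆ cols

    open Bip _≟R_ public using (Matchable; Matching; module Matching; edge; into; injective; matchable?; matching-⊆; map-⊆)

    Free : List U → Set
    Free X = Matchable N rows (cols ∖ X)

    field
      free  : ∀ {X} → Indep S X → Free X
      indep : ∀ {X} → X ⊆ ground S → Free X → Indep S X

    Tight : Set
    Tight = cols ⊆ ground S

  deduplicate-unique : ∀ X → Unique (deduplicate _≟_ X)
  deduplicate-unique = deduplicate-! _≟_

  step? : ∀ D u v → Dec (Step D u v)
  step? D u v = (v ≟ u) ⊎-dec (DecMembership._∈?_ (×-≡-dec _≟_ _≟_) (u , v) (A D))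

  representation⇒model : ∀ {S D T} → ground S ⊆ V D → S ≋ Γ D T (ground S) → Model S
  representation⇒model {S} {D} {T} E⊆V (_ , iff) = record
    { _≟R_ = _≟_ ; rows = inner D T ; cols = vertices D T ; N = Step D ; N? = step? D
    ; urows = ∖-unique T (deduplicate-unique (V D)) ; ucols = deduplicate-! _≟_ (V D)
    ; ground⊆ = ∈-deduplicate⁺ _≟_ ∘ E⊆V
    ; free = λ {X} i → let _ , _ , routing = to (iff X) i in routing⇒matchable D T routing
    ; indep = λ {X} X⊆E f → from (iff X) (X⊆E , matchable⇒routing D T (E⊆V ∘ X⊆E) f) }

  module _ {S : SetSystem} (𝑀 : Model S) (∅-free : Model.Free 𝑀 []) where

    open Model 𝑀
    private module R = FiniteSet _≟R_

    private
      m₀ : R → U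
      m₀ = proj₁ ∅-free
      M₀ : Matching N rows cols m₀
      M₀ = matching-⊆ id (∖-⊆ cols []) (proj₂ ∅-free)
      image : List U
      image = map m₀ rows

      arc? : (p : R × U) → Dec (N (proj₁ p) (proj₂ p))
      arc? (ρ , c) = N? ρ c
      arcs : List (R × U)
      arcs = filter arc? (cartesianProduct rows cols)
      arc : R × U → U × U
      arc (ρ , c) = m₀ ρ , c
      arc⁻ : ∀ {u v} → (u , v) ∈ map arc arcs → ∃[ ρ ] ρ ∈ rows × u ≡ m₀ ρ × v ∈ cols × N ρ v
      arc⁻ p with (ρ , c) , q , refl ← ∈-map⁻ arc p with r , n ← ∈-filter⁻ arc? {xs = cartesianProduct rows cols} q
        with ρ∈ , c∈ ← ∈-cartesianProduct⁻ rows cols r = ρ , ρ∈ , refl , c∈ , n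
      arc⁺ : ∀ {ρ c} → ρ ∈ rows → c ∈ cols → N ρ c → (m₀ ρ , c) ∈ map arc arcs
      arc⁺ p q n = ∈-map⁺ arc (∈-filter⁺ arc? (∈-cartesianProduct⁺ p q) n)

    -- The matching `m₀` identifies each row with a column, so that `N` becomes a relation between
    -- vertices; the columns that `m₀` leaves over become the terminals.
    digraph : Digraph
    digraph = record
      { V = cols ; A = map arc arcs
      ; A⊆V×V = λ p → case arc⁻ p of λ { (ρ , ρ∈ , refl , v∈ , _) → into M₀ ρ∈ , v∈ } }

    terminals : List U
    terminals = cols ∖ image

    private
      D T : _
      D = digraph
      T = terminals
      ∈vertices : ∀ {u} → u ∈ cols → u ∈ vertices D T
      ∈vertices = ∈-deduplicate⁺ _≟_
      vertices⊆ : vertices D T ⊆ cols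
      vertices⊆ = ∈-deduplicate⁻ _≟_ cols
      open Bip _≟_ using () renaming (Matchable to Matchable′)

      m₀-inner : ∀ {ρ} → ρ ∈ rows → m₀ ρ ∈ inner D T
      m₀-inner p = ∈-∖⁺ (∈vertices (into M₀ p)) λ q → proj₂ (∈-∖⁻ cols {image} q) (∈-map⁺ m₀ p)

      inner⊆ : ∀ {u} → u ∈ inner D T → u ∈ image
      inner⊆ {u} p with q , r ← ∈-∖⁻ (vertices D T) {T} p =
        decidable-stable (u ∈? image) λ ¬i → r (∈-∖⁺ (vertices⊆ q) ¬i)

      step⇒N : ∀ {ρ v} → ρ ∈ rows → Step D (m₀ ρ) v → N ρ v
      step⇒N ρ∈ (inj₁ refl) = edge M₀ ρ∈
      step⇒N ρ∈ (inj₂ a) with ρ′ , ρ′∈ , eq , _ , n ← arc⁻ a with refl ← injective M₀ ρ∈ ρ′∈ eq = n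

      fromDigraph : ∀ {X} → Matchable′ (Step D) (inner D T) (vertices D T ∖ X) → Free X
      fromDigraph {X} (g , m) = g ∘ m₀ , record
        { edge = λ p → step⇒N p (B.edge m (m₀-inner p))
        ; into = λ p → ∖-mono (vertices D T) X vertices⊆ id (B.into m (m₀-inner p))
        ; injective = λ p q eq → injective M₀ p q (B.injective m (m₀-inner p) (m₀-inner q) eq) }
        where module B = Bip _≟_

      toDigraph : ∀ {X} → Free X → Matchable′ (Step D) (inner D T) (vertices D T ∖ X)
      toDigraph {X} (f , m) = g , record
        { edge = λ p → case source p of λ { (ρ , ρ∈ , refl , eq) →
            inj₂ (subst (λ v → (m₀ ρ , v) ∈ A D) (sym eq) (arc⁺ ρ∈ (proj₁ (∈-∖⁻ cols (into m ρ∈))) (edge m ρ∈))) }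
        ; into = λ p → case source p of λ { (ρ , ρ∈ , refl , eq) →
            subst (_∈ vertices D T ∖ X) (sym eq) (∖-mono cols X ∈vertices id (into m ρ∈)) }
        ; injective = λ p q eq → case source p , source q of λ
            { ((ρ , ρ∈ , refl , e) , (ρ′ , ρ′∈ , refl , e′)) →
              cong m₀ (injective m ρ∈ ρ′∈ (trans (sym e) (trans eq e′))) } }
        where
        g : U → U
        g u with u ∈? image
        ... | yes p = f (proj₁ (∈-map⁻ m₀ p))
        ... | no _ = u
        source : ∀ {u} → u ∈ inner D T → ∃[ ρ ] ρ ∈ rows × u ≡ m₀ ρ × g u ≡ f ρ
        source {u} p with u ∈? image
        ... | no ¬i = contradiction (inner⊆ p) ¬i
        ... | yes q with ρ , ρ∈ , eq ← ∈-map⁻ m₀ q = ρ , ρ∈ , eq , refl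

    linked⇔free : ∀ {X} → X ⊆ cols → ∃ (IsRouting digraph X terminals) ⇔ Free X
    linked⇔free X⊆ = mk⇔ (λ (_ , routing) → fromDigraph (routing⇒matchable D T routing))
                         (λ f → matchable⇒routing D T X⊆ (toDigraph f))

    represents : (∀ {X} → Indep S X → X ⊆ ground S) → S ≋ Γ digraph terminals (ground S)
    represents ⊆E = mk⇔ id id , λ X → mk⇔
      (λ i → (λ {_} → ⊆E i) , from (linked⇔free {X} (λ {_} p → ground⊆ (⊆E i p))) (free i))
      (λ (X⊆E , r) → indep {X} X⊆E (to (linked⇔free {X} (λ {_} p → ground⊆ (X⊆E p))) r))

  module _ (M : Matroid) (𝑀 : Model (system M)) where

    open Model 𝑀

    ∅-free : Free []
    ∅-free = free (IsMatroid.∅-indep (isMatroid M))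

    private
      eq : system M ≋ Γ (digraph 𝑀 ∅-free) (terminals 𝑀 ∅-free) (E M)
      eq = represents 𝑀 ∅-free (IsMatroid.indep⊆ground (isMatroid M))

    model⇒gammoid : IsGammoid M
    model⇒gammoid = digraph 𝑀 ∅-free , terminals 𝑀 ∅-free , ground⊆ , ∖-⊆ cols _ , eq

    tight-model⇒strict : Tight → IsStrictGammoid M
    tight-model⇒strict tight = digraph 𝑀 ∅-free , terminals 𝑀 ∅-free , mk⇔ tight ground⊆ , ∖-⊆ cols _ , eq

  gammoid⇒model : ∀ M → IsGammoid M → Model (system M)
  gammoid⇒model M (_ , _ , E⊆V , _ , eq) = representation⇒model E⊆V eq

  strict⇒tight-model : ∀ M → IsStrictGammoid M → Σ (Model (system M)) Model.Tight
  strict⇒tight-model M (D , T , V∼E , _ , eq) =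
    representation⇒model {system M} (from V∼E) eq , to V∼E ∘ ∈-deduplicate⁻ _≟_ (V D)

  strict-gammoid-isMatroid : ∀ D T → IsMatroid (Γ D T (V D))
  strict-gammoid-isMatroid D T = record
    { indep⊆ground = proj₁
    ; indep? = λ X → map′ (link X) (unlink X)
        (⊆-dec X ×-dec matchable? (step? D) id uinner (vs ∖ X))
    ; ∅-indep = link [] ((λ ()) , id , record
        { edge = λ _ → inj₁ refl ; into = λ p → ∈-∖⁺ (∖-⊆ vs T p) λ () ; injective = λ _ _ eq → eq })
    ; hereditary = λ {X} {Y} X⊆Y i → let Y⊆ , f , m = unlink Y i in
        link X ((λ {_} p → Y⊆ (X⊆Y p)) , f , matching-⊆ id (∖-mono vs Y id X⊆Y) m)
    ; augmentation = augmentation }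
    where
    open Bip _≟_
    open import Data.Nat using (_+_)
    vs : List U
    vs = vertices D T
    link : ∀ X → X ⊆ V D × Matchable (Step D) (inner D T) (vs ∖ X) → Indep (Γ D T (V D)) X
    link X (X⊆ , f) = (λ {_} → X⊆) , matchable⇒routing D T (λ {_} → X⊆) f
    unlink : ∀ X → Indep (Γ D T (V D)) X → X ⊆ V D × Matchable (Step D) (inner D T) (vs ∖ X)
    unlink X (X⊆ , _ , routing) = (λ {_} → X⊆) , routing⇒matchable D T routing
    uinner : Unique (inner D T)
    uinner = ∖-unique T (deduplicate-unique (V D))
    ⊆-dec : ∀ X → Dec (X ⊆ V D)
    ⊆-dec X = map′ (λ all {_} p → All.lookup all p) (λ sub → All.tabulate λ {_} → sub) (All.all? (_∈? V D) X)
    augmentation : ∀ {X Y} → Indep (Γ D T (V D)) X → Indep (Γ D T (V D)) Y → ∣ X ∣ < ∣ Y ∣ →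
                   ∃[ y ] y ∈ Y × y ∉ X × Indep (Γ D T (V D)) (y ∷ X)
    augmentation {X} {Y} (X⊆ , _ , rX) (Y⊆ , _ , rY) lt
      with f , mf ← routing⇒matchable D T rX | h , mh ← routing⇒matchable D T rY
      -- The neighbourhood of the extra row is `Y`: a column kept for it can be added to `X`.
      with augment (step? D) {N₀ = _∈ Y} (_∈? Y) uinner mf
    ... | inj₁ (y , g , y∈Y , y∈ , m) = y , y∈Y , proj₂ (∈-∖⁻ vs {X} y∈) ,
            link (y ∷ X) ((λ {_} → yX⊆) , g , matching-⊆ id sub m)
      where
      yX⊆ : y ∷ X ⊆ V D
      yX⊆ (here refl) = Y⊆ y∈Y
      yX⊆ (there p) = X⊆ p
      sub : (vs ∖ X) ∖ [ y ] ⊆ vs ∖ (y ∷ X)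
      sub p with q , p≢y ← ∈-∖⁻ (vs ∖ X) {[ y ]} p with p∈ , p∉X ← ∈-∖⁻ vs {X} q =
        ∈-∖⁺ p∈ λ { (here eq) → p≢y (here eq) ; (there r) → p∉X r }
    ... | inj₂ (blocked S S′ split cl₀ cl) = contradiction count (<⇒≱ lt)
      where
      S⊆ : S ⊆ inner D T
      S⊆ = ∈-resp-↭ (↭-sym split) ∘ ∈-++⁺ˡ
      uS : Unique S
      uS = proj₁ (unique-++⁻ S (unique-resp-↭ split uinner))
      mS : Matching (Step D) S (vs ∖ Y) h
      mS = matching-⊆ S⊆ id mh
      dX dY : List U
      dX = deduplicate _≟_ X
      dY = deduplicate _≟_ Y
      uleft : Unique (map h S ++ dY)
      uleft = Unique.++⁺ (map-unique (injective mS) uS) (deduplicate-unique Y)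
        λ (p , q) → proj₂ (∈-∖⁻ vs {Y} (map-⊆ mS p)) (∈-deduplicate⁻ _≟_ Y q)
      right : ∀ {c} → c ∈ vs → (c ∈ vs ∖ X → c ∈ map f S) → c ∈ map f S ++ dX
      right {c} c∈ k with c ∈? X
      ... | yes p = ∈-++⁺ʳ (map f S) (∈-deduplicate⁺ _≟_ p)
      ... | no p = ∈-++⁺ˡ (k (∈-∖⁺ c∈ p))
      sub : map h S ++ dY ⊆ map f S ++ dX
      sub p with ∈-++⁻ (map h S) p
      ... | inj₂ q = let q′ = ∈-deduplicate⁻ _≟_ Y q in
                     right (∈-deduplicate⁺ _≟_ (Y⊆ q′)) λ r → cl₀ r r q′
      ... | inj₁ q with ρ , ρ∈ , refl ← ∈-map⁻ h q =
                     right (∖-⊆ vs Y (into mS ρ∈)) λ r → cl ρ∈ r (edge mS ρ∈)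
      -- The set `Y` is disjoint from `map h S`, because `h` avoids it, and both lie in the union of
      -- `map f S` and `X`; the two images of `S` cancel.
      count : ∣ Y ∣ ≤ ∣ X ∣
      count = +-cancelˡ-≤ (length S) _ _ (subst₂ _≤_
        (trans (length-++ (map h S)) (cong (_+ ∣ Y ∣) (length-map h S)))
        (trans (length-++ (map f S)) (cong (_+ ∣ X ∣) (length-map f S)))
        (⊆-length uleft sub))

-- Minors and isomorphic copies of gammoids.

module MinorsAndIsomorphisms (U : Set) (_≟_ : DecidableEquality U) (infinite : Infinite U) where

  open Matroids U _≟_
  open FiniteSet _≟_ using (_∈?_; merge; merge-∈; merge-∉; ∈-∖⁺; ∈-∖⁻; ∖-mono; ∖-⊆; ∖-unique; ∖-length₁)
  open Models U _≟_ infinite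
  open Equivalence using (to; from)

  module _ (M M′ : Matroid) (iso : M ≅ M′) where

    private
      module I = _≅_ iso

      record Naming (cs : List U) : Set where
        field
          name     : U → U
          name-inj : InjectiveOn cs name
          origin   : ∀ {c} → c ∈ cs → (∃[ x ] x ∈ E M × I.to x ≡ c × name c ≡ x) ⊎ name c ∉ E M
          name-to  : ∀ {x} → x ∈ E M → I.to x ∈ cs → name (I.to x) ≡ x

      naming : ∀ {cs} → Unique cs → Naming cs
      naming {[]} _ = record { name = id ; name-inj = λ () ; origin = λ () ; name-to = λ _ () }
      naming {c ∷ cs} u = extend (any? (λ x → I.to x ≟ c) (E M))
        where
        open Naming (naming (unique-tail u))
        module Extend (x₀ : U) (x₀∉ : x₀ ∉ map name cs)
                 (origin₀ : (∃[ x ] x ∈ E M × I.to x ≡ c × x₀ ≡ x) ⊎ x₀ ∉ E M)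
                 (to₀ : ∀ {x} → x ∈ E M → I.to x ≡ c → x₀ ≡ x) where
          name′ : U → U
          name′ = merge [ c ] (λ _ → x₀) name
          name-c : name′ c ≡ x₀
          name-c = merge-∈ [ c ] (λ _ → x₀) name (here refl)
          name-other : ∀ {d} → d ∈ cs → name′ d ≡ name d
          name-other d∈ = merge-∉ [ c ] (λ _ → x₀) name λ { (here refl) → ∉-∷ u d∈ }
          result : Naming (c ∷ cs)
          result = record
            { name = name′
            ; name-inj = λ
                { (here refl) (here refl) _ → refl
                ; (here refl) (there q) eq → contradiction (subst (_∈ map name cs)
                    (trans (sym (name-other q)) (trans (sym eq) name-c)) (∈-map⁺ name q)) x₀∉
                ; (there p) (here refl) eq → contradiction (subst (_∈ map name cs)
                    (trans (sym (name-other p)) (trans eq name-c)) (∈-map⁺ name p)) x₀∉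
                ; (there p) (there q) eq → name-inj p q (trans (sym (name-other p)) (trans eq (name-other q))) }
            ; origin = λ
                { (here refl) → subst (λ v → (∃[ x ] x ∈ E M × I.to x ≡ c × v ≡ x) ⊎ v ∉ E M) (sym name-c) origin₀
                ; {d} (there p) → subst (λ v → (∃[ x ] x ∈ E M × I.to x ≡ d × v ≡ x) ⊎ v ∉ E M)
                    (sym (name-other p)) (origin p) }
            ; name-to = λ x∈ p → name-to′ x∈ p }
            where
            name-to′ : ∀ {x} → x ∈ E M → I.to x ∈ c ∷ cs → name′ (I.to x) ≡ x
            name-to′ x∈ (here eq) = trans (cong name′ eq) (trans name-c (to₀ x∈ eq))
            name-to′ x∈ (there p) = trans (name-other p) (name-to x∈ p)
        extend : Dec (Any (λ x → I.to x ≡ c) (E M)) → Naming (c ∷ cs)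
        extend (yes found) with x , x∈ , refl ← find found = Extend.result x x∉ (inj₁ (x , x∈ , refl , refl))
                              λ y∈ eq → I.injective x∈ y∈ (sym eq)
          where
          x∉ : x ∉ map name cs
          x∉ p with d , d∈ , eq ← ∈-map⁻ name p with origin d∈
          ... | inj₁ (y , y∈ , refl , eq′) = ∉-∷ u (subst (λ v → I.to v ∈ cs) (sym (trans eq eq′)) d∈)
          ... | inj₂ ∉E = ∉E (subst (_∈ E M) eq x∈)
        extend (no none) with x , x∉ ← infinite (E M ++ map name cs) =
          Extend.result x (x∉ ∘ ∈-++⁺ʳ (E M)) (inj₂ (x∉ ∘ ∈-++⁺ˡ))
            λ y∈ eq → contradiction (lose y∈ eq) none

    transport : (𝑁 : Model (system M′)) → Σ (Model (system M)) λ 𝑀 → Model.Tight 𝑁 → Model.Tight 𝑀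
    transport 𝑁 = 𝑀 , tight
      where
      open Model 𝑁
      open Naming (naming ucols)
      unname : U → U
      unname u with any? (λ c → name c ≟ u) cols
      ... | yes found = proj₁ (find found)
      ... | no _ = u
      unname-name : ∀ {c} → c ∈ cols → unname (name c) ≡ c
      unname-name {c} c∈ with any? (λ d → name d ≟ name c) cols
      ... | yes found = let d , d∈ , eq = find found in name-inj d∈ c∈ eq
      ... | no none = contradiction (lose c∈ refl) none
      E⊆ : E M ⊆ map name cols
      E⊆ x∈ = subst (_∈ map name cols) (name-to x∈ (ground⊆ (I.to-ground x∈))) (∈-map⁺ name (ground⊆ (I.to-ground x∈)))
      free⁺ : ∀ X → X ⊆ E M → Free (map I.to X) → ∃ (Matching (λ ρ u → N ρ (unname u)) rows (map name cols ∖ X))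
      free⁺ X X⊆E (f , m) = name ∘ f , record
        { edge = λ p → subst (N _) (sym (unname-name (f∈ p))) (edge m p)
        ; into = λ p → ∈-∖⁺ (∈-map⁺ name (f∈ p)) λ q → proj₂ (∈-∖⁻ cols (into m p))
            (subst (_∈ map I.to X) (name-inj (ground⊆ (I.to-ground (X⊆E q))) (f∈ p)
              (name-to (X⊆E q) (ground⊆ (I.to-ground (X⊆E q))))) (∈-map⁺ I.to q))
        ; injective = λ p q eq → injective m p q (name-inj (f∈ p) (f∈ q) eq) }
        where
        f∈ : ∀ {ρ} → ρ ∈ rows → f ρ ∈ cols
        f∈ p = proj₁ (∈-∖⁻ cols (into m p))
      free⁻ : ∀ X → X ⊆ E M → ∃ (Matching (λ ρ u → N ρ (unname u)) rows (map name cols ∖ X)) → Free (map I.to X)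
      free⁻ X X⊆E (f , m) = unname ∘ f , record
        { edge = edge m
        ; into = into⁻
        ; injective = λ p q eq → let c , c∈ , e = named p
                                     d , d∈ , e′ = named q
                                     c≡d = trans (sym (unnamed c∈ e)) (trans eq (unnamed d∈ e′))
                                 in injective m p q (trans e (trans (cong name c≡d) (sym e′))) }
        where
        named : ∀ {ρ} → ρ ∈ rows → ∃[ c ] c ∈ cols × f ρ ≡ name c
        named p = ∈-map⁻ name (proj₁ (∈-∖⁻ (map name cols) (into m p)))
        unnamed : ∀ {ρ c} → c ∈ cols → f ρ ≡ name c → unname (f ρ) ≡ c
        unnamed c∈ eq = trans (cong unname eq) (unname-name c∈)
        into⁻ : ∀ {ρ} → ρ ∈ rows → unname (f ρ) ∈ cols ∖ map I.to X
        into⁻ p with c , c∈ , eq ← named p = subst (_∈ cols ∖ map I.to X) (sym (unnamed c∈ eq))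
          (∈-∖⁺ c∈ λ q → case ∈-map⁻ I.to q of λ { (x , x∈ , refl) → proj₂ (∈-∖⁻ (map name cols) (into m p))
            (subst (_∈ X) (sym (trans eq (name-to (X⊆E x∈) c∈))) x∈) })
      to-⊆ : ∀ X → X ⊆ E M → map I.to X ⊆ E M′
      to-⊆ X X⊆E p = case ∈-map⁻ I.to p of λ { (x , x∈ , refl) → I.to-ground (X⊆E x∈) }
      𝑀 : Model (system M)
      𝑀 = record
        { _≟R_ = _≟R_ ; rows = rows ; cols = map name cols
        ; N = λ ρ u → N ρ (unname u) ; N? = λ ρ u → N? ρ (unname u)
        ; urows = urows ; ucols = map-unique name-inj ucols ; ground⊆ = E⊆
        ; free = λ {X} i → free⁺ X (indep⊆ i) (free (to (I.to-indep (indep⊆ i)) i))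
        ; indep = λ {X} X⊆E f → from (I.to-indep X⊆E) (indep (to-⊆ X X⊆E) (free⁻ X X⊆E f)) }
        where
        indep⊆ : ∀ {X} → Indep (system M) X → X ⊆ E M
        indep⊆ = IsMatroid.indep⊆ground (isMatroid M)
      tight : Tight → map name cols ⊆ E M
      tight t p with c , c∈ , refl ← ∈-map⁻ name p with x , x∈ , refl ← I.surjective (t c∈) =
        subst (_∈ E M) (sym (name-to x∈ c∈)) x∈

  model-resp-≋ : ∀ {S S′} → S′ ≋ S → Model S → Model S′
  model-resp-≋ (E∼E′ , iff) 𝑀 = record
    { _≟R_ = _≟R_ ; rows = rows ; cols = cols ; N = N ; N? = N? ; urows = urows ; ucols = ucols
    ; ground⊆ = ground⊆ ∘ to E∼E′
    ; free = λ {X} i → free (to (iff X) i)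
    ; indep = λ {X} X⊆ f → from (iff X) (indep (to E∼E′ ∘ X⊆) f) }
    where open Model 𝑀

  module _ (M : Matroid) where

    open IsMatroid (isMatroid M) using (indep⊆ground; ∅-indep; hereditary; augmentation)

    private
      I : List U → Set
      I = Indep (system M)

    maximal-extension : ∀ {B₀} → I B₀ → ∀ C → ∃[ B ] B₀ ⊆ B × B ⊆ B₀ ++ C × I B ×
                        (∀ {x} → x ∈ C → I (x ∷ B) → x ∈ B)
    maximal-extension {B₀} i [] = B₀ , id , ∈-++⁺ˡ , i , λ ()
    maximal-extension {B₀} i (c ∷ C) with B , sup , sub , iB , mx ← maximal-extension i C
      with indep? M (c ∷ B)
    ... | yes icB = c ∷ B , (λ {_} p → there (sup p)) ,
          (λ { (here refl) → ∈-++⁺ʳ B₀ (here refl) ; (there p) → widen (sub p) }) , icB ,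
          λ { (here refl) _ → here refl
            ; (there p) ix → there (mx p (hereditary (λ { (here e) → here e ; (there q) → there (there q) }) ix)) }
      where
      widen : ∀ {x} → x ∈ B₀ ++ C → x ∈ B₀ ++ c ∷ C
      widen p with ∈-++⁻ B₀ p
      ... | inj₁ q = ∈-++⁺ˡ q
      ... | inj₂ q = ∈-++⁺ʳ B₀ (there q)
    ... | no ¬icB = B , (λ {_} → sup) , (λ {_} p → widen (sub p)) , iB ,
          λ { (here refl) ix → contradiction ix ¬icB ; (there p) → mx p }
      where
      widen : ∀ {x} → x ∈ B₀ ++ C → x ∈ B₀ ++ c ∷ C
      widen p with ∈-++⁻ B₀ p
      ... | inj₁ q = ∈-++⁺ˡ q
      ... | inj₂ q = ∈-++⁺ʳ B₀ (there q)

    basis-≤ : ∀ {C B B′} → IsBasisOf (system M) B C → IsBasisOf (system M) B′ C → ∣ B ∣ ≤ ∣ B′ ∣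
    basis-≤ (B⊆C , iB , _) (_ , iB′ , mx) = ℕ.≮⇒≥ λ lt →
      let y , y∈B , y∉B′ , i = augmentation iB′ iB lt in y∉B′ (mx (B⊆C y∈B) i)

    -- Contraction does not depend on the basis. Extend `B` by elements of `X` to a maximal
    -- independent `Z`: by augmentation `Z` is at least as large as `X ++ B′`, whereas an element of
    -- `X` missing from `Z` would leave it too small.
    basis-exchange : ∀ {C X B B′} → Disjoint X C → IsBasisOf (system M) B C → IsBasisOf (system M) B′ C →
                     I (X ++ B′) → I (X ++ B)
    basis-exchange {C} {X} {B} {B′} disj basis@(B⊆C , iB , mx) basis′@(B′⊆C , _) i
      with Z , B⊆Z , Z⊆ , iZ , mxZ ← maximal-extension iB X = hereditary sub iZ
      where
      open import Data.Nat using (_+_)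
      dX dB dB′ : List U
      dX = deduplicate _≟_ X
      dB = deduplicate _≟_ B
      dB′ = deduplicate _≟_ B′
      large : ∣ X ++ B′ ∣ ≤ ∣ Z ∣
      large = ℕ.≮⇒≥ λ lt → let y , y∈ , y∉Z , iy = augmentation iZ i lt in
        case ∈-++⁻ X y∈ of λ
          { (inj₁ y∈X) → y∉Z (mxZ y∈X iy)
          ; (inj₂ y∈B′) → y∉Z (B⊆Z (mx (B′⊆C y∈B′)
              (hereditary (λ { (here e) → here e ; (there q) → there (B⊆Z q) }) iy))) }
      total : ∣ X ∣ + ∣ B′ ∣ ≤ ∣ X ++ B′ ∣
      total = subst (_≤ ∣ X ++ B′ ∣) (length-++ dX) (⊆-length
        (Unique.++⁺ (deduplicate-unique X) (deduplicate-unique B′)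
          λ (p , q) → disj (∈-deduplicate⁻ _≟_ X p , B′⊆C (∈-deduplicate⁻ _≟_ B′ q)))
        λ p → ∈-deduplicate⁺ _≟_ (case ∈-++⁻ dX p of λ
          { (inj₁ q) → ∈-++⁺ˡ (∈-deduplicate⁻ _≟_ X q)
          ; (inj₂ q) → ∈-++⁺ʳ X (∈-deduplicate⁻ _≟_ B′ q) }))
      small : ∀ {x} → x ∈ X → x ∉ Z → ∣ Z ∣ < ∣ X ∣ + ∣ B ∣
      small {x} x∈ x∉Z = ≤-trans (s≤s (⊆-length (deduplicate-unique Z) Z⊆′)) (≤-reflexive (trans
          (cong suc (length-++ (dX ∖ [ x ])))
          (cong (_+ ∣ B ∣) (∖-length₁ (deduplicate-unique X) (∈-deduplicate⁺ _≟_ x∈)))))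
        where
        Z⊆′ : deduplicate _≟_ Z ⊆ (dX ∖ [ x ]) ++ dB
        Z⊆′ p with q ← ∈-deduplicate⁻ _≟_ Z p with ∈-++⁻ B (Z⊆ q)
        ... | inj₁ r = ∈-++⁺ʳ (dX ∖ [ x ]) (∈-deduplicate⁺ _≟_ r)
        ... | inj₂ r = ∈-++⁺ˡ (∈-∖⁺ (∈-deduplicate⁺ _≟_ r) λ { (here refl) → x∉Z q })
      X⊆Z : X ⊆ Z
      X⊆Z {x} x∈ = decidable-stable (x ∈? Z) λ x∉Z → <⇒≱ (small x∈ x∉Z)
        (≤-trans (ℕ.+-monoʳ-≤ ∣ X ∣ (basis-≤ basis basis′)) (≤-trans total large))
      sub : X ++ B ⊆ Z
      sub p with ∈-++⁻ X p
      ... | inj₁ q = X⊆Z q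
      ... | inj₂ q = B⊆Z q

    -- Contracting `C` deletes the columns of one basis of `C`. The other columns of `C` and those
    -- of `D` remain as columns and merely leave the ground set.
    minor-model : ∀ {C D} → C ⊆ E M → Model (system M) → Model (delete (contract (system M) C) D)
    minor-model {C} {D} C⊆E 𝑀 with B , _ , B⊆C , iB , mx ← maximal-extension ∅-indep C = record
      { _≟R_ = _≟R_ ; rows = rows ; cols = cols ∖ B ; N = N ; N? = N? ; urows = urows ; ucols = ∖-unique B ucols
      ; ground⊆ = λ p → let q , x∉C = ∈-∖⁻ (E M) (∖-⊆ (E M ∖ C) D p) in ∈-∖⁺ (ground⊆ q) (x∉C ∘ B⊆C)
      ; free = λ {X} ((X⊆ , B′ , basis′ , i) , _) →
          let f , m = free (basis-exchange (disj X⊆) ((λ {_} → B⊆C) , iB , (λ {_} → mx)) basis′ i) in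
          f , matching-⊆ id (shrink X) m
      ; indep = λ {X} X⊆ (f , m) →
          (( λ {_} p → ∖-⊆ (E M ∖ C) D (X⊆ p)) , B , ((λ {_} → B⊆C) , iB , (λ {_} → mx)) ,
            indep (λ p → within X X⊆ (∈-++⁻ X p)) (f , matching-⊆ id (grow X) m)) , (λ {_} → X⊆) }
      where
      open Model 𝑀
      disj : ∀ {X} → X ⊆ E M ∖ C → Disjoint X C
      disj X⊆ (p , q) = proj₂ (∈-∖⁻ (E M) (X⊆ p)) q
      shrink : ∀ X → cols ∖ (X ++ B) ⊆ (cols ∖ B) ∖ X
      shrink X p with q , r ← ∈-∖⁻ cols {X ++ B} p = ∈-∖⁺ (∈-∖⁺ q (r ∘ ∈-++⁺ʳ X)) (r ∘ ∈-++⁺ˡ)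
      grow : ∀ X → (cols ∖ B) ∖ X ⊆ cols ∖ (X ++ B)
      grow X p with q , r ← ∈-∖⁻ (cols ∖ B) {X} p with q′ , r′ ← ∈-∖⁻ cols {B} q =
        ∈-∖⁺ q′ λ s → case ∈-++⁻ X s of λ { (inj₁ t) → r t ; (inj₂ t) → r′ t }
      within : ∀ X → X ⊆ (E M ∖ C) ∖ D → ∀ {x} → x ∈ X ⊎ x ∈ B → x ∈ E M
      within X X⊆ (inj₁ p) = ∖-⊆ (E M) C (∖-⊆ (E M ∖ C) D (X⊆ p))
      within X X⊆ (inj₂ p) = C⊆E (B⊆C p)

  minor-gammoid : ∀ M N → N IsMinorOf M → IsGammoid M → IsGammoid N
  minor-gammoid M N (C , D , C⊆E , _ , _ , eq) γ =
    model⇒gammoid N (model-resp-≋ eq (minor-model M C⊆E (gammoid⇒model M γ)))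

  isomorphic-gammoid : ∀ M N → M ≅ N → IsGammoid N → IsGammoid M
  isomorphic-gammoid M N iso γ = model⇒gammoid M (proj₁ (transport M N iso (gammoid⇒model N γ)))

  isomorphic-strict-gammoid : ∀ M N → M ≅ N → IsStrictGammoid N → IsStrictGammoid M
  isomorphic-strict-gammoid M N iso γ with 𝑁 , tight ← strict⇒tight-model N γ =
    tight-model⇒strict M (proj₁ (transport M N iso 𝑁)) (proj₂ (transport M N iso 𝑁) tight)

-- Strict extensions of prescribed size.

module Resizing (U : Set) (_≟_ : DecidableEquality U) (infinite : Infinite U) where

  open Matroids U _≟_
  open FiniteSet _≟_ using (_∈?_; _∉?_; ∈-∖⁺; ∈-∖⁻; ∖-mono; ∖-⊆; ∖-unique; ∖-length₁; filter-∈-powerset; powerset-⊆)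
  open Models U _≟_ infinite
  open import Data.Nat using (_+_; _*_; _^_; _∸_)
  open Equivalence using (to; from)

  ∣∣-mono : ∀ {X Y} → X ⊆ Y → ∣ X ∣ ≤ ∣ Y ∣
  ∣∣-mono {X} {Y} X⊆Y = ⊆-length (deduplicate-unique X) (∈-deduplicate⁺ _≟_ ∘ X⊆Y ∘ ∈-deduplicate⁻ _≟_ X)

  unique⇒∣∣ : ∀ {X} → Unique X → ∣ X ∣ ≡ length X
  unique⇒∣∣ {X} u = ≤-antisym (⊆-length (deduplicate-unique X) (∈-deduplicate⁻ _≟_ X))
                              (⊆-length u (∈-deduplicate⁺ _≟_))

  module _ (M : Matroid) where

    open IsMatroid (isMatroid M) using (indep⊆ground; ∅-indep; hereditary)

    private
      r e : ℕ
      r = rk M (E M)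
      e = ∣ E M ∣
      ranks : List ℕ
      ranks = map ∣_∣ (filter (indep? M) (powerset (E M)))

    indep-≤-rk : ∀ {X} → Indep (system M) X → ∣ X ∣ ≤ r
    indep-≤-rk {X} i = ≤-trans (∣∣-mono X⊆X′) (All.lookup (xs≤max 0 ranks)
      (∈-map⁺ ∣_∣ (∈-filter⁺ (indep? M) (filter-∈-powerset (_∈? X) (E M))
        (hereditary (λ p → proj₂ (∈-filter⁻ (_∈? X) {xs = E M} p)) i))))
      where
      X⊆X′ : X ⊆ filter (_∈? X) (E M)
      X⊆X′ p = ∈-filter⁺ (_∈? X) (indep⊆ground i p) p

    basis : ∃[ B ] Indep (system M) B × r ≡ ∣ B ∣
    basis with max-sel id 0 ranks
    ... | inj₁ r≡0 = [] , ∅-indep , r≡0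
    ... | inj₂ r∈ with B , B∈ , eq ← ∈-map⁻ ∣_∣ r∈ =
      B , proj₂ (∈-filter⁻ (indep? M) {xs = powerset (E M)} B∈) , eq

    module _ (𝑀 : Model (system M)) where

      open Model 𝑀

      -- The new row `nothing` is joined to every column, while the old rows keep to the old
      -- columns. Forgetting it gives a matching of the old model; conversely, `spare` supplies its
      -- column.
      extend : ∀ {cols′} → Unique cols′ → cols ⊆ cols′ →
               (∀ {X f} → X ⊆ E M → Indep (system M) X → Matching N rows (cols ∖ X) f →
                  ∃[ c ] c ∈ cols′ ∖ X × c ∉ map f rows) → Model (system M)
      extend {cols′} u cols⊆ spare = record
        { _≟R_ = ≡-dec _≟R_ ; rows = nothing ∷ map just rows ; cols = cols′ ; N = N⁺ ; N? = N⁺?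
        ; urows = ∷-unique (λ p → case ∈-map⁻ just p of λ ()) (map-unique (λ _ _ → just-injective) urows)
        ; ucols = u ; ground⊆ = cols⊆ ∘ ground⊆
        ; free = λ {X} i → let f , m = free i
                               c , c∈ , c∉ = spare (indep⊆ground i) i m in free⁺ X f m c c∈ c∉
        ; indep = λ {X} X⊆E (f , m) → indep X⊆E (f ∘ just , free⁻ X f m) }
        where
        N⁺ : Maybe R → U → Set
        N⁺ nothing _ = ⊤
        N⁺ (just ρ) c = N ρ c × c ∈ cols
        N⁺? : ∀ ρ c → Dec (N⁺ ρ c)
        N⁺? nothing _ = yes tt
        N⁺? (just ρ) c = N? ρ c ×-dec (c ∈? cols)
        module B⁺ = Bipartite (≡-dec _≟R_) _≟_
        free⁻ : ∀ X f → B⁺.Matching N⁺ (nothing ∷ map just rows) (cols′ ∖ X) f → Matching N rows (cols ∖ X) (f ∘ just)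
        free⁻ X f m = record
          { edge = λ p → proj₁ (B⁺.edge m (old p))
          ; into = λ p → ∈-∖⁺ (proj₂ (B⁺.edge m (old p))) (proj₂ (∈-∖⁻ cols′ (B⁺.into m (old p))))
          ; injective = λ p q eq → just-injective (B⁺.injective m (old p) (old q) eq) }
          where
          old : ∀ {ρ} → ρ ∈ rows → just ρ ∈ nothing ∷ map just rows
          old p = there (∈-map⁺ just p)
        free⁺ : ∀ X f → Matching N rows (cols ∖ X) f → ∀ c → c ∈ cols′ ∖ X → c ∉ map f rows →
                ∃ λ f⁺ → B⁺.Matching N⁺ (nothing ∷ map just rows) (cols′ ∖ X) f⁺
        free⁺ X f m c c∈ c∉ = f⁺ , record { edge = edge⁺ ; into = into⁺ ; injective = inj⁺ }
          where
          f⁺ : Maybe R → U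
          f⁺ nothing = c
          f⁺ (just ρ) = f ρ
          row : ∀ {ρ} → just ρ ∈ nothing ∷ map just rows → ρ ∈ rows
          row (there p) with _ , q , refl ← ∈-map⁻ just p = q
          edge⁺ : ∀ {ρ} → ρ ∈ nothing ∷ map just rows → N⁺ ρ (f⁺ ρ)
          edge⁺ {nothing} _ = tt
          edge⁺ {just ρ} p = edge m (row p) , proj₁ (∈-∖⁻ cols (into m (row p)))
          into⁺ : ∀ {ρ} → ρ ∈ nothing ∷ map just rows → f⁺ ρ ∈ cols′ ∖ X
          into⁺ {nothing} _ = c∈
          into⁺ {just ρ} p = ∖-mono cols X cols⊆ id (into m (row p))
          inj⁺ : InjectiveOn (nothing ∷ map just rows) f⁺
          inj⁺ {nothing} {nothing} _ _ _ = refl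
          inj⁺ {nothing} {just _} _ q eq = contradiction (subst (_∈ map f rows) (sym eq) (∈-map⁺ f (row q))) c∉
          inj⁺ {just _} {nothing} p _ eq = contradiction (subst (_∈ map f rows) eq (∈-map⁺ f (row p))) c∉
          inj⁺ {just _} {just _} p q eq = cong just (injective m (row p) (row q) eq)

      -- A row joined to every column truncates the rank, harmlessly as long as it stays at least r.
      add-row : length rows + r < length cols →
                Σ (Model (system M)) λ 𝑀′ → Model.cols 𝑀′ ≡ cols × length (Model.rows 𝑀′) ≡ suc (length rows)
      add-row lt = extend ucols id spare , refl , cong suc (length-map just rows)
        where
        spare : ∀ {X f} → X ⊆ E M → Indep (system M) X → Matching N rows (cols ∖ X) f →
                ∃[ c ] c ∈ cols ∖ X × c ∉ map f rows
        spare {X} {f} _ i m with any? (_∉? map f rows) (cols ∖ X)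
        ... | yes found = find found
        ... | no none = contradiction (⊆-length ucols cover) (<⇒≱ (≤-trans (s≤s (≤-trans
              (≤-reflexive (trans (length-++ (map f rows)) (cong (_+ ∣ X ∣) (length-map f rows))))
              (+-monoʳ-≤ (length rows) (indep-≤-rk i)))) lt))
          where
          cover : cols ⊆ map f rows ++ deduplicate _≟_ X
          cover {c} c∈ with c ∈? X
          ... | yes p = ∈-++⁺ʳ (map f rows) (∈-deduplicate⁺ _≟_ p)
          ... | no p = ∈-++⁺ˡ (decidable-stable (c ∈? map f rows) λ ∉f → none (lose (∈-∖⁺ c∈ p) ∉f))

      add-column : Σ (Model (system M)) λ 𝑀′ → length (Model.cols 𝑀′) ≡ suc (length cols)
      add-column with u , u∉ ← infinite cols = extend (∷-unique u∉ ucols) there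
        (λ X⊆E _ m → u , ∈-∖⁺ (here refl) (u∉ ∘ ground⊆ ∘ X⊆E) ,
          λ p → u∉ (∖-⊆ cols _ (map-⊆ m p))) , refl

      -- Some matching of all the rows avoids a basis, which has `r` elements.
      rows-≤ : length rows + r ≤ length cols
      rows-≤ with B , iB , r≡ ← basis with f , m ← free iB = subst (_≤ length cols)
        (trans (length-++ (map f rows)) (cong₂ _+_ (length-map f rows) (sym r≡)))
        (⊆-length (Unique.++⁺ (map-unique (injective m) urows) (deduplicate-unique B)
            λ (p , q) → proj₂ (∈-∖⁻ cols {B} (map-⊆ m p)) (∈-deduplicate⁻ _≟_ B q))
          λ p → case ∈-++⁻ (map f rows) p of λ
            { (inj₁ q) → ∖-⊆ cols B (map-⊆ m q)
            ; (inj₂ q) → ground⊆ (indep⊆ground iB (∈-deduplicate⁻ _≟_ B q)) })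

      private
        open Irrelevant _≟R_ _≟_
        open Bypass _≟R_ _≟_ using (bypass; bypass-matchable)
        module R = FiniteSet _≟R_
        P : List U
        P = deduplicate _≟_ (E M)
        m₀ : R → U
        m₀ = proj₁ (free ∅-indep)
        M₀ : Matching N rows cols m₀
        M₀ = matching-⊆ id (∖-⊆ cols []) (proj₂ (free ∅-indep))

        opaque
          redundant-row : (size : length cols ≡ length rows + r) → r ^ 2 * e + r + e < length cols →
                          ∃[ i ] i ∈ rows × m₀ i ∉ P × Redundant N? urows ucols M₀ {P = P} {r = r} size i
          redundant-row size big = redundant N? urows ucols M₀ {P = P} {r = r} size many
            where
            candidates : List R
            candidates = filter (λ k → m₀ k ∉? P) rows
            image⊆ : map m₀ rows ⊆ map m₀ candidates ++ P
            image⊆ p with k , k∈ , refl ← ∈-map⁻ m₀ p with m₀ k ∈? P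
            ... | yes q = ∈-++⁺ʳ (map m₀ candidates) q
            ... | no q = ∈-++⁺ˡ (∈-map⁺ m₀ (∈-filter⁺ (λ k → m₀ k ∉? P) k∈ q))
            rows-few : length rows ≤ length candidates + e
            rows-few = subst₂ _≤_ (length-map m₀ rows)
              (trans (length-++ (map m₀ candidates)) (cong (_+ e) (length-map m₀ candidates)))
              (⊆-length (map-unique (injective M₀) urows) image⊆)
            many : e * (r * r) < length candidates
            many = subst (_< length candidates)
              (trans (ℕ.*-comm (r ^ 2) e) (cong (λ x → e * (r * x)) (ℕ.*-identityʳ r)))
              (+-cancelʳ-< (r + e) (r ^ 2 * e) (length candidates) (≤-trans
                (≤-reflexive (cong suc (sym (+-assoc (r ^ 2 * e) r e))))
                (≤-trans big (≤-trans (≤-reflexive size) (≤-trans (+-monoˡ-≤ r rows-few) (≤-reflexive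
                  (trans (+-assoc (length candidates) e r) (cong (length candidates +_) (+-comm e r)))))))))

      remove : length cols ≡ length rows + r → r ^ 2 * e + r + e < length cols →
               Σ (Model (system M)) λ 𝑀′ → suc (length (Model.cols 𝑀′)) ≡ length cols ×
                                           suc (length (Model.rows 𝑀′)) ≡ length rows
      remove size big = 𝑀′ , ∖-length₁ ucols (into M₀ i∈) , R.∖-length₁ urows i∈
        where
        chosen = redundant-row size big
        i : R
        i = proj₁ chosen
        i∈ : i ∈ rows
        i∈ = proj₁ (proj₂ chosen)
        v : U
        v = m₀ i
        v∉P : v ∉ P
        v∉P = proj₁ (proj₂ (proj₂ chosen))
        swap-∖ : ∀ X Y → (cols ∖ X) ∖ Y ⊆ (cols ∖ Y) ∖ X
        swap-∖ X Y p with q , ∉Y ← ∈-∖⁻ (cols ∖ X) {Y} p with c∈ , ∉X ← ∈-∖⁻ cols {X} q = ∈-∖⁺ (∈-∖⁺ c∈ ∉Y) ∉X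
        𝑀′ : Model (system M)
        𝑀′ = record
          { _≟R_ = _≟R_ ; rows = rows R.∖ [ i ] ; cols = cols ∖ [ v ] ; N = bypass N i v
          ; N? = λ ρ c → N? ρ c ⊎-dec (N? ρ v ×-dec N? i c)
          ; urows = R.∖-unique [ i ] urows ; ucols = ∖-unique [ v ] ucols
          ; ground⊆ = λ p → ∈-∖⁺ (ground⊆ p) λ { (here refl) → v∉P (∈-deduplicate⁺ _≟_ p) }
          ; free = λ {X} j → let f , m = bypass-matchable i∈ (free j) in f , matching-⊆ id (swap-∖ X [ v ]) m
          ; indep = λ {X} X⊆E (f , m) → indep X⊆E (proj₂ (proj₂ (proj₂ chosen)) {X}
              (∈-deduplicate⁺ _≟_ ∘ X⊆E) (f , matching-⊆ id (swap-∖ [ v ] X) m)) }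

    private
      nrows ncols : Model (system M) → ℕ
      nrows 𝑀 = length (Model.rows 𝑀)
      ncols 𝑀 = length (Model.cols 𝑀)
      bound : ℕ
      bound = r ^ 2 * e + r + e

    fill-rows : ∀ k 𝑀 → k + (nrows 𝑀 + r) ≡ ncols 𝑀 → Σ (Model (system M)) λ 𝑀′ → ncols 𝑀′ ≡ nrows 𝑀′ + r
    fill-rows zero 𝑀 eq = 𝑀 , sym eq
    fill-rows (suc k) 𝑀 eq
      with 𝑀′ , eqc , eqr ← add-row 𝑀 (subst (nrows 𝑀 + r <_) eq (s≤s (m≤n+m _ k))) =
      fill-rows k 𝑀′ (trans (cong (λ x → k + (x + r)) eqr) (trans (+-suc k _) (trans eq (cong length (sym eqc)))))

    shrink : ∀ n 𝑀 → ncols 𝑀 ≡ n → ncols 𝑀 ≡ nrows 𝑀 + r → Σ (Model (system M)) λ 𝑀′ → ncols 𝑀′ ≤ bound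
    shrink zero 𝑀 eq _ = 𝑀 , subst (_≤ bound) (sym eq) z≤n
    shrink (suc n) 𝑀 eq size with ncols 𝑀 ≤? bound
    ... | yes le = 𝑀 , le
    ... | no ¬le with 𝑀′ , eqc , eqr ← remove 𝑀 size (≰⇒> ¬le) =
      shrink n 𝑀′ (suc-injective (trans eqc eq)) (suc-injective (trans eqc (trans size (cong (_+ r) (sym eqr)))))

    pad : ∀ k 𝑀 {n} → k + ncols 𝑀 ≡ n → Σ (Model (system M)) λ 𝑀′ → ncols 𝑀′ ≡ n
    pad zero 𝑀 eq = 𝑀 , eq
    pad (suc k) 𝑀 eq with 𝑀′ , eqc ← add-column 𝑀 =
      pad k 𝑀′ (trans (cong (k +_) eqc) (trans (+-suc k _) eq))

    ≤⇒∃+ : ∀ {m n} → m ≤ n → ∃[ k ] k + m ≡ n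
    ≤⇒∃+ {m} {n} le = n ∸ m , ℕ.m∸n+n≡m le

    opaque
      -- Rows are filled up first because `remove` presupposes exactly `r` unmatched columns.
      -- Padding comes last because a decisive tableau speaks of extensions of one exact size.
      resize : Model (system M) → Σ (Model (system M)) λ 𝑀′ → ncols 𝑀′ ≡ bound
      resize 𝑀 with k , eq ← ≤⇒∃+ (rows-≤ 𝑀) with 𝑀₁ , size ← fill-rows k 𝑀 eq
        with 𝑀₂ , small ← shrink _ 𝑀₁ refl size with k₂ , eq₂ ← ≤⇒∃+ small = pad k₂ 𝑀₂ eq₂

    -- With every column taken as a ground element, the digraph of the model represents a strict
    -- gammoid; on subsets of `E M` independence is the same linkage condition as before.
    model-extension : (𝑀 : Model (system M)) →
                      ∃[ N ] N IsExtensionOf M × ∣ E N ∣ ≡ ncols 𝑀 × IsStrictGammoid N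
    model-extension 𝑀 = N , ((λ {_} → ground⊆) , λ X → mk⇔ (link X) (unlink X)) , unique⇒∣∣ ucols ,
      (D , T , mk⇔ id id , ∖-⊆ cols _ , (mk⇔ id id , λ X → mk⇔ id id))
      where
      open Model 𝑀 hiding (N)
      ∅-free₀ : Free []
      ∅-free₀ = free ∅-indep
      D : Digraph
      D = digraph 𝑀 ∅-free₀
      T : List U
      T = terminals 𝑀 ∅-free₀
      N : Matroid
      N = record { system = Γ D T cols ; isMatroid = strict-gammoid-isMatroid D T }
      link : ∀ X → Indep (system M) X → Indep (Γ D T cols) X × X ⊆ E M
      link X i = ((λ {_} → X⊆cols) , from (linked⇔free 𝑀 ∅-free₀ (λ {_} → X⊆cols)) (free i)) , (λ {_} → indep⊆ground i)
        where
        X⊆cols : X ⊆ cols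
        X⊆cols p = ground⊆ (indep⊆ground i p)
      unlink : ∀ X → Indep (Γ D T cols) X × X ⊆ E M → Indep (system M) X
      unlink X ((X⊆cols , routing) , X⊆E) =
        indep {X} (λ {_} → X⊆E) (to (linked⇔free 𝑀 ∅-free₀ {X} (λ {_} → X⊆cols)) routing)

    strict-extension : IsGammoid M → ∃[ N ] N IsExtensionOf M × ∣ E N ∣ ≡ bound × IsStrictGammoid N
    strict-extension γ = let 𝑀 , size = resize (gammoid⇒model M γ)
                             N , extension , eq , strict = model-extension 𝑀
                         in N , extension , trans eq size , strict

-- Goals of decisive tableaux.

lemma2p4 : ∀ (U : Set) (_≟_ : DecidableEquality U) → Infinite U →
    let open Matroids U _≟_ in
    ∀ {ℓ} (𝐓 : Tableau ℓ) → Decisive 𝐓 →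
    let open Tableau 𝐓 in
    IsGammoid G ⇔ (∃[ M ] 𝒢 M × G ≃ M)
lemma2p4 U _≟_ infinite 𝐓 decisive = mk⇔ forward backward
  where
  open Matroids U _≟_
  open Tableau 𝐓
  open Decisive decisive
  open Valid valid
  open FiniteSet _≟_ using (∈-∖⁺; ∖-⊆)
  open MinorsAndIsomorphisms U _≟_ infinite
  open Resizing U _≟_ infinite

  -- This places `G` in the carrier, so that `classes` applies to its own equivalence class.
  G-minor : G IsMinorOf G
  G-minor = [] , [] , (λ ()) , (λ ()) , (λ ()) ,
    mk⇔ keep (∖-⊆ (E G) [] ∘ ∖-⊆ (E G ∖ []) []) , λ X → mk⇔
      (λ i → ((λ {_} p → ∈-∖⁺ (indep⊆ground i p) λ ()) , [] , ((λ ()) , ∅-indep , λ ()) , hereditary (drop-[] X) i) ,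
             λ {_} p → keep (indep⊆ground i p))
      (λ { ((_ , _ , _ , i) , _) → hereditary ∈-++⁺ˡ i })
    where
    open IsMatroid (isMatroid G)
    keep : E G ⊆ (E G ∖ []) ∖ []
    keep p = ∈-∖⁺ (∈-∖⁺ p λ ()) λ ()
    drop-[] : ∀ X → X ++ [] ⊆ X
    drop-[] X p with ∈-++⁻ X p
    ... | inj₁ q = q

  forward : IsGammoid G → ∃[ M ] 𝒢 M × G ≃ M
  forward γ with cases
  ... | inj₁ found = found
  ... | inj₂ (inj₁ (X , X∈𝒳 , N , minor , iso)) =
    ⊥-elim (𝒳-no-gammoid X X∈𝒳 (isomorphic-gammoid X N iso (minor-gammoid G N minor γ)))
  -- A gammoid `G` has a strict gammoid extension of exactly the size in question; the member of `ℳ`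
  -- isomorphic to it would be a strict gammoid too.
  ... | inj₂ (inj₂ all-strict-excluded)
    with N , extension , size , strict ← strict-extension G γ
    with M , M∈ℳ , iso ← all-strict-excluded N extension size =
    ⊥-elim (ℳ-no-strict-gammoid M M∈ℳ (isomorphic-strict-gammoid M N iso strict))

  backward : (∃[ M ] 𝒢 M × G ≃ M) → IsGammoid G
  backward (M , M∈𝒢 , G≃M) with classes G (inj₁ G-minor)
  ... | inj₁ gammoids = gammoids G (inj₁ G-minor) (IsEquivalence.refl ≃-isEquivalence {G , inj₁ G-minor})
  -- The class of `G` contains the gammoid `M`.
  ... | inj₂ none = ⊥-elim (none M (inj₂ (inj₁ M∈𝒢)) G≃M (𝒢-gammoids M M∈𝒢))
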